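{- Assume the following hypothesis ($\text{SYM}\circ\text{AND}$ Hypothesis): there are constants $c, k > 1$ such that for all sufficiently large $n$, there is a function $f:\{0,1\}^n \to \{0,1\}$ computable by a $\mathsf{TC}^0$ circuit of depth $c$ with at most $\tilde{O}(n)$ gates, each of fan-in $\tilde{O}(n)$, such that $f$ does not have a $\text{SYM}\circ\text{AND}$ circuit of size $\exp(O(n^{1/k}))$. Then there is a fixed $\alpha > 0$ such that for every modulus $m$ and every depth $d$, every depth-$d$ $\mathsf{ACC}^0[m]$ circuit computing the MAJORITY function on $n$ inputs requires size at least $\exp(n^{\alpha/(rd)})$ for all sufficiently large $n$, where $r$ is the number of distinct prime factors of $m$.
   Context: A $\mathsf{TC}^0$ circuit consists of MAJORITY and NOT gates. A $\text{SYM}\circ\text{AND}$ circuit is a depth-two circuit whose output gate computes an arbitrary symmetric function (one depending only on the number of ones among its inputs) of its inputs, each of which is an AND of input variables and their negations; its size is the number of AND gates. An $\mathsf{ACC}^0[m]$ (also written $\mathsf{AC}^0[m]$) circuit consists of unbounded fan-in AND, OR, NOT and $\text{MOD}_m$ gates, where a $\text{MOD}_m$ gate outputs $1$ iff the sum of its inputs is divisible by $m$. MAJORITY on $n$ inputs outputs $1$ iff at least half the inputs are $1$. $\tilde{O}(\cdot)$ hides polylogarithmic factors in $n$. -}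

module Defs where

open import Data.Bool using (Bool; true; false; not; _∧_; if_then_else_)
open import Data.Nat using (ℕ; zero; suc; _+_; _*_; _^_; _≤_; _<_; _⊔_; _≤ᵇ_)
open import Data.Nat.Logarithm using (⌊log₂_⌋)
open import Data.Nat.Divisibility using (_∣?_)
open import Data.Nat.Primality using (prime?)
open import Data.Fin using (Fin)
open import Data.List as List using (List; []; _∷_; length; filter; upTo)
open import Data.Vec as Vec using (Vec; []; _∷_; _∷ʳ_; lookup; last)
open import Data.Product using (_×_; _,_; Σ; ∃; proj₁; proj₂)
open import Relation.Nullary using (¬_; does)
open import Relation.Nullary.Decidable using (_×-dec_)
open import Relation.Binary.PropositionalEquality using (_≡_)

BoolFun : ℕ → Set
BoolFun n = Vec Bool n → Bool

ones : List Bool → ℕ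
ones []           = 0
ones (true ∷ bs)  = suc (ones bs)
ones (false ∷ bs) = ones bs

allB : List Bool → Bool
allB []       = true
allB (b ∷ bs) = b ∧ allB bs

anyB : List Bool → Bool
anyB []       = false
anyB (b ∷ bs) = if b then true else anyB bs

onesV : ∀ {n} → Vec Bool n → ℕ
onesV xs = ones (Vec.toList xs)

MAJ : (n : ℕ) → BoolFun n
MAJ n x = n ≤ᵇ 2 * onesV x

-- Generic circuits (DAGs in topological order).
-- A circuit on n inputs with w wires: wires 0..n-1 are the inputs, each gate
-- adds one new wire whose inputs are earlier wires (repetitions allowed).
-- The output is the last wire.

data Circuit (Gate : ℕ → Set) (n : ℕ) : ℕ → Set where
  inputs : Circuit Gate n n
  _▷_    : ∀ {w} → Circuit Gate n w → Gate w → Circuit Gate n (suc w)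

record GateKind : Set₁ where
  field
    Gate    : ℕ → Set
    ins     : ∀ {w} → Gate w → List (Fin w)
    evalG   : ∀ {w} → Gate w → List Bool → Bool

module _ (K : GateKind) where
  open GateKind K

  Circ : ℕ → ℕ → Set
  Circ n w = Circuit Gate n w

  size : ∀ {n w} → Circ n w → ℕ
  size inputs  = 0
  size (c ▷ _) = suc (size c)

  wires : ∀ {n w} → Circ n w → Vec Bool n → Vec Bool w
  wires inputs  x = x
  wires (c ▷ g) x = let v = wires c x in v ∷ʳ evalG g (List.map (lookup v) (ins g))

  depths : ∀ {n w} → Circ n w → Vec ℕ w
  depths {n} inputs = Vec.replicate n 0
  depths (c ▷ g) = let d = depths c in
    d ∷ʳ suc (List.foldr _⊔_ 0 (List.map (lookup d) (ins g)))

  maxFanIn : ∀ {n w} → Circ n w → ℕ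
  maxFanIn inputs  = 0
  maxFanIn (c ▷ g) = maxFanIn c ⊔ length (ins g)

  output : ∀ {n w} → Circ n (suc w) → Vec Bool n → Bool
  output c x = last (wires c x)

  depth : ∀ {n w} → Circ n (suc w) → ℕ
  depth c = last (depths c)

  Computes : ∀ {n w} → Circ n (suc w) → BoolFun n → Set
  Computes c f = ∀ x → output c x ≡ f x

  record CircuitFor (n : ℕ) (f : BoolFun n) : Set where
    field
      width    : ℕ
      circ     : Circ n (suc width)
      computes : Computes circ f

data TCGate (w : ℕ) : Set where
  majG : List (Fin w) → TCGate w
  notG : Fin w → TCGate w

TC : GateKind
TC = record
  { Gate  = TCGate
  ; ins   = λ { (majG is) → is ; (notG i) → i ∷ [] }
  ; evalG = λ { (majG is) bs → length bs ≤ᵇ 2 * ones bs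
              ; (notG i)  bs → not (allB bs) }
  }

data ACCGate (w : ℕ) : Set where
  andG : List (Fin w) → ACCGate w
  orG  : List (Fin w) → ACCGate w
  notG : Fin w → ACCGate w
  modG : List (Fin w) → ACCGate w

ACC : ℕ → GateKind
ACC m = record
  { Gate  = ACCGate
  ; ins   = λ { (andG is) → is ; (orG is) → is ; (notG i) → i ∷ [] ; (modG is) → is }
  ; evalG = λ { (andG _) bs → allB bs
              ; (orG _)  bs → anyB bs
              ; (notG _) bs → not (allB bs)
              ; (modG _) bs → does (m ∣? ones bs) }
  }

-- SYM ∘ AND circuits: a list of AND gates over literals, fed into an
-- arbitrary symmetric function, i.e. a function of the number of ones.

Literal : ℕ → Set
Literal n = Fin n × Bool

evalLit : ∀ {n} → Literal n → Vec Bool n → Bool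
evalLit (i , true)  x = lookup x i
evalLit (i , false) x = not (lookup x i)

record SymAnd (n : ℕ) : Set where
  field
    terms : List (List (Literal n))
    sym   : ℕ → Bool

evalSymAnd : ∀ {n} → SymAnd n → Vec Bool n → Bool
evalSymAnd C x =
  SymAnd.sym C (ones (List.map (λ t → allB (List.map (λ l → evalLit l x) t)) (SymAnd.terms C)))

symAndSize : ∀ {n} → SymAnd n → ℕ
symAndSize C = length (SymAnd.terms C)

quasiLin : ℕ → ℕ → ℕ
quasiLin C n = C * n * (⌊log₂ n ⌋ + 1) ^ C

numPrimeFactors : ℕ → ℕ
numPrimeFactors m = length (filter (λ p → prime? p ×-dec (p ∣? m)) (upTo (suc m)))

-- The SYM∘AND hypothesis (exp / real exponents rendered over ℕ)

SymAndHypothesis : Set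
SymAndHypothesis =
  Σ ℕ λ c → Σ ℕ λ k → Σ ℕ λ C → (1 < c) × (1 < k) × Σ ℕ λ N →
    ∀ n → N ≤ n → Σ (BoolFun n) λ f →
      (Σ (CircuitFor TC n f) λ D →
         let c' = CircuitFor.circ D in
         (depth TC c' ≤ c) × (size TC c' ≤ quasiLin C n) × (maxFanIn TC c' ≤ quasiLin C n))
      ×
      -- f has no SYM∘AND circuit of size ≤ 2^(n^(1/k))
      (∀ x → x ^ k ≤ n → ¬ (Σ (SymAnd n) λ S →
          (symAndSize S ≤ 2 ^ x) × (∀ y → evalSymAnd S y ≡ f y)))

-- Conclusion: ∃ α = 1/q > 0, ∀ m ≥ 2, d ≥ 1, for large n every depth-≤d
-- ACC⁰[m] circuit for MAJ_n has size ≥ 2^(n^(α/(r d))).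
MajorityLowerBound : Set
MajorityLowerBound =
  Σ ℕ λ q → (1 ≤ q) × (∀ m d → 2 ≤ m → 1 ≤ d → Σ ℕ λ N → ∀ n → N ≤ n →
    (D : CircuitFor (ACC m) n (MAJ n)) →
    depth (ACC m) (CircuitFor.circ D) ≤ d →
    ∀ x → x ^ (q * numPrimeFactors m * d) ≤ n →
      2 ^ x ≤ size (ACC m) (CircuitFor.circ D))

{-# OPTIONS --safe #-}
module Submission where

-- Suppose that MAJORITY on n ≈ y^(4E) inputs, E a constant times r d, has a depth-d ACC⁰[m] circuit
-- with fewer than 2^y gates.  Substituting it for the gates of the hard TC⁰ function on n₀ = y^(2E)
-- inputs gives a formula of OR and MOD_m nodes of depth O(c d) and fan-in 2^O(y).  After Razborov and
-- Smolensky each OR is replaced by a conjunction of O(y) parities; boosting shows that the majority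
-- of O(n₀) such formulas is exact.  The formula now consists of O(c r d) layers of gates MOD_q with
-- one prime power q per layer, and these are removed from the top, keeping the function in the form
-- g(Σ) with Σ a sum of at most 2^K products of at most K gates of the current top layer.  A product
-- of K gates is an affine function of a sum of single gates MOD_p, and modulo p^O(K) a single gate
-- is a polynomial of degree O(K) (an idea of Chen and Papakonstantinou, in place of the amplification
-- of Beigel and Tarui that would square K).  So each layer multiplies K by O(y) only, and in the end
-- K is y^O(c r d), small enough for 2^K to contradict the hardness of the function.

open import Defs
open import Data.Bool using (Bool; true; false; not; _∧_; _xor_; if_then_else_)
open import Data.Bool.Properties using (not-involutive; xor-same; ∧-identityʳ)
open import Data.Empty using (⊥; ⊥-elim)
open import Data.Fin using (Fin; zero; suc; inject₁; fromℕ)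
open import Data.Fin.Relation.Unary.Top using (view; ‵fromℕ; ‵inject₁)
open import Data.Integer as ℤ using (ℤ)
import Data.Integer.DivMod as ℤ
import Data.Integer.Divisibility.Signed as ℤ∣
import Data.Integer.Properties as ℤ
import Data.Integer.Tactic.RingSolver as ℤ-Solver
open import Data.List as List using (List; []; _∷_; _++_; length; concatMap; replicate; filter; upTo)
open import Data.List.Membership.Propositional using (_∈_)
open import Data.List.Membership.Propositional.Properties using (∈-filter⁺; ∈-upTo⁺; ∈-lookup)
open import Data.List.Properties using (length-++; length-map; length-replicate; map-cong-local; map-∘)
open import Data.List.Relation.Binary.Pointwise using (Pointwise; []; _∷_)
open import Data.List.Relation.Binary.Sublist.Propositional using (_⊆_; []; _∷_) renaming (_∷ʳ_ to _∷ˢ_)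
open import Data.List.Relation.Binary.Sublist.Propositional.Properties using (All-resp-⊆; length-mono-≤)
open import Data.List.Relation.Unary.All as All using (All; []; _∷_)
import Data.List.Relation.Unary.All.Properties as All
open import Data.List.Relation.Unary.Any using (here; there)
open import Data.Nat as ℕ using (ℕ; zero; suc; _+_; _*_; _^_; _∸_; _/_; _%_; _⊔_; _≤_; _<_; _≤ᵇ_; _≤?_; _<?_; z≤n; s≤s; NonZero)
open import Data.Nat.Combinatorics using (_C_; nCn≡1; nC1≡n; nCk+nC[k+1]≡[n+1]C[k+1])
open import Data.Nat.Divisibility
open import Data.Nat.DivMod using ([m+kn]%n≡m%n; m<n⇒m%n≡m; m*n/n≡m; m≡m%n+[m/n]*n; m%n<n)
open import Data.Nat.GCD using (gcd; gcd[m,n]∣m; gcd[m,n]∣n; gcd-greatest)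
open import Data.Nat.ListAction using (product)
open import Data.Nat.Logarithm using (⌊log₂_⌋; ⌊log₂⌋-mono-≤; ⌊log₂[2^n]⌋≡n)
open import Data.Nat.Primality using (Prime; prime?; euclidsLemma; prime⇒nonZero; prime⇒nonTrivial; prime[2])
open import Data.Nat.Primality.Factorisation using (factorise; PrimeFactorisation; factors)
open import Data.Nat.Properties
import Data.Nat.Tactic.RingSolver as ℕ-Solver
open import Data.Product using (_×_; _,_; Σ; ∃; proj₁; proj₂)
open import Data.Sum using (_⊎_; inj₁; inj₂)
open import Data.Vec as Vec using (Vec; lookup; last; []; _∷_; _∷ʳ_)
open import Data.Vec.Properties using (lookup∘tabulate)
open import Function using (mk⇔)
open import Relation.Binary.PropositionalEquality using (_≡_; refl; sym; trans; cong; cong₂; subst; subst₂; module ≡-Reasoning)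
open import Relation.Nullary using (¬_; Dec; yes; no; does)
open import Relation.Nullary.Decidable using (_×-dec_; dec-true; dec-false; does-⇔; toWitness)


-- Binomial expansion of periodic functions

-- The factor `r` in the exponent has one source: a congruence modulo a power of `p` can only
-- express gates of the prime `p`, so a MOD_m gate is split over one layer for each prime divisor of
-- `m`. The modulus p^(3K) is so large because the affine function has slope p^(K-1) (p - 1), which
-- is not invertible modulo `p` once K > 1: the old sum has to be recovered as an integer, from a
-- residue that it does not exceed. Written directly as a product, an OR of fan-in 2^O(y) would have
-- degree 2^O(y); parities bring this down to O(y) but err on some inputs, whereas the hardness
-- assumption is about exact computation. The approximation is therefore proved for every weighting
-- of the inputs, which is the form that boosting consumes; all random choices are replaced by
-- averaging. Unfolding circuits into formulas does no harm, because only depth and fan-in enter: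
-- the number of nodes is paid for by the error 2^(-ℓ) with ℓ = O(y). Finally n₀² ≤ n leaves room
-- for the quasi-linear fan-in of the TC⁰ circuit.

C-absorb : ∀ n k → suc k * (suc n C suc k) ≡ suc n * (n C k)
C-absorb n zero = trans (*-identityˡ (suc n C 1)) (trans (nC1≡n (suc n)) (sym (*-identityʳ (suc n))))
C-absorb zero    (suc k) = trans (*-zeroʳ (suc (suc k))) refl
C-absorb (suc n) (suc k) = begin
  suc (suc k) * (suc (suc n) C suc (suc k))
    ≡⟨ cong (suc (suc k) *_) (sym (nCk+nC[k+1]≡[n+1]C[k+1] (suc n) (suc k))) ⟩
  suc (suc k) * (B + (suc n C suc (suc k)))
    ≡⟨ *-distribˡ-+ (suc (suc k)) B _ ⟩
  (B + suc k * B) + suc (suc k) * (suc n C suc (suc k))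
    ≡⟨ cong₂ (λ u v → (B + u) + v) (C-absorb n k) (C-absorb n (suc k)) ⟩
  (B + suc n * (n C k)) + suc n * (n C suc k)
    ≡⟨ trans (+-assoc B _ _) (cong (_+_ B) (sym (*-distribˡ-+ (suc n) (n C k) (n C suc k)))) ⟩
  B + suc n * (n C k + n C suc k)
    ≡⟨ cong (λ u → B + suc n * u) (nCk+nC[k+1]≡[n+1]C[k+1] n k) ⟩
  suc (suc n) * B ∎
  where
  open ≡-Reasoning
  B = suc n C suc k

-- Euclid's lemma extracts one factor `p` from `b` at a time; after cancelling it, the induction on
-- `e` applies to the cofactor.
prime∤⇒coprime^ : ∀ {p a} → Prime p → ∀ e → ¬ (p ∣ a) → ∀ b → p ^ e ∣ a * b → p ^ e ∣ b
prime∤⇒coprime^ pp zero p∤a b h = 1∣ b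
prime∤⇒coprime^ {p} {a} pp (suc e) p∤a b (divides t eq)
  with euclidsLemma a b pp (∣-trans (m∣m*n (p ^ e)) (divides t eq))
... | inj₁ p∣a = ⊥-elim (p∤a p∣a)
... | inj₂ (divides b' refl) = divides (proj₁ r) (trans (cong (_* p) (proj₂ r)) (lem₂ (proj₁ r) (p ^ e) p))
  where
  lem₁ : ∀ p a b' → p * (a * b') ≡ a * (b' * p)
  lem₁ = ℕ-Solver.solve-∀
  lem₂ : ∀ r e p → r * e * p ≡ r * (p * e)
  lem₂ = ℕ-Solver.solve-∀
  lem₃ : ∀ r e p → r * (p * e) ≡ p * (r * e)
  lem₃ = ℕ-Solver.solve-∀
  r : Σ ℕ λ r → b' ≡ r * p ^ e
  r with prime∤⇒coprime^ pp e p∤a b'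
           (divides t (*-cancelˡ-≡ (a * b') (t * p ^ e) p ⦃ prime⇒nonZero pp ⦄
              (trans (lem₁ p a b') (trans eq (lem₃ t (p ^ e) p)))))
  ... | divides r e = r , e

-- Otherwise absorption, `suc i * (q C suc i) ≡ q * z` with q = pᵉ, would force q to divide the
-- smaller positive number `suc i`.
p∣C : ∀ {p} → Prime p → ∀ e i → suc i < p ^ e → p ∣ ((p ^ e) C suc i)
p∣C {p} pp e i i<q with p ∣? ((p ^ e) C suc i)
... | yes h = h
... | no ¬h = ⊥-elim (<⇒≱ i<q (∣⇒≤ q∣i))
  where
  absorb : ∀ q → 0 < q → ∃ λ z → suc i * (q C suc i) ≡ q * z
  absorb (suc q) _ = q C i , C-absorb q i
  q∣i : p ^ e ∣ suc i
  q∣i with absorb (p ^ e) (<-trans (s≤s z≤n) i<q)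
  ... | z , eq = prime∤⇒coprime^ pp e ¬h (suc i)
        (divides z (trans (*-comm ((p ^ e) C suc i) (suc i)) (trans eq (*-comm (p ^ e) z))))

module _ where

  open import Data.Integer using (+_; -[1+_])

  sumTo : ℕ → (ℕ → ℤ) → ℤ
  sumTo zero    f = + 0
  sumTo (suc J) f = f 0 ℤ.+ sumTo J (λ j → f (suc j))

  sumTo-cong : ∀ J {f g} → (∀ j → f j ≡ g j) → sumTo J f ≡ sumTo J g
  sumTo-cong zero    h = refl
  sumTo-cong (suc J) h = cong₂ ℤ._+_ (h 0) (sumTo-cong J (λ j → h (suc j)))

  sumTo-+ : ∀ J f g → sumTo J (λ j → f j ℤ.+ g j) ≡ sumTo J f ℤ.+ sumTo J g
  sumTo-+ zero    f g = refl
  sumTo-+ (suc J) f g =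
    trans (cong (λ z → f 0 ℤ.+ g 0 ℤ.+ z) (sumTo-+ J (λ j → f (suc j)) (λ j → g (suc j))))
          (lem (f 0) (g 0) (sumTo J (λ j → f (suc j))) (sumTo J (λ j → g (suc j))))
    where
    lem : ∀ a b c d → a ℤ.+ b ℤ.+ (c ℤ.+ d) ≡ a ℤ.+ c ℤ.+ (b ℤ.+ d)
    lem = ℤ-Solver.solve-∀

  sumTo-last : ∀ J f → sumTo (suc J) f ≡ sumTo J f ℤ.+ f J
  sumTo-last zero    f = trans (ℤ.+-identityʳ (f 0)) (sym (ℤ.+-identityˡ (f 0)))
  sumTo-last (suc J) f = trans (cong (λ w → f 0 ℤ.+ w) (sumTo-last J (λ j → f (suc j))))
                               (sym (ℤ.+-assoc (f 0) (sumTo J (λ j → f (suc j))) (f (suc J))))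

  sumTo-∣ : ∀ {d} J {f} → (∀ j → j < J → d ℤ∣.∣ f j) → d ℤ∣.∣ sumTo J f
  sumTo-∣ zero    h = ℤ∣.divides (+ 0) refl
  sumTo-∣ (suc J) h = ℤ∣.∣m∣n⇒∣m+n (h 0 (s≤s z≤n)) (sumTo-∣ J (λ j j<J → h (suc j) (s≤s j<J)))

  Δ : (ℕ → ℤ) → ℕ → ℤ
  Δ h z = h (suc z) ℤ.- h z

  Δ^ : ℕ → (ℕ → ℤ) → ℕ → ℤ
  Δ^ zero    h = h
  Δ^ (suc j) h = Δ^ j (Δ h)

  Δ^-Δ : ∀ j h z → Δ^ j (Δ h) z ≡ Δ (Δ^ j h) z
  Δ^-Δ zero    h z = refl
  Δ^-Δ (suc j) h z = Δ^-Δ j (Δ h) z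

  Δ^-+ : ∀ i j h z → Δ^ i (Δ^ j h) z ≡ Δ^ (j + i) h z
  Δ^-+ i zero    h z = refl
  Δ^-+ i (suc j) h z = Δ^-+ i j (Δ h) z

  -- The expansion of (1 + Δ)ⁿ. Any length `J` above `n` is allowed, as the extra binomials vanish;
  -- this slack lets the sums for `h` and for `Δ h` in the induction differ in length by one, as
  -- Pascal's rule wants.
  newton-shift : ∀ n J h z → n < J → h (n + z) ≡ sumTo J (λ i → + (n C i) ℤ.* Δ^ i h z)
  newton-shift zero (suc J) h z _ = sym (trans (cong₂ ℤ._+_ (ℤ.*-identityˡ (h z)) (zeros J (λ i → Δ^ (suc i) h z))) (ℤ.+-identityʳ (h z)))
    where
    zeros : ∀ J (a : ℕ → ℤ) → sumTo J (λ i → + 0 ℤ.* a i) ≡ + 0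
    zeros zero    a = refl
    zeros (suc J) a = trans (ℤ.+-identityˡ _) (zeros J (λ j → a (suc j)))
  newton-shift (suc n) (suc J) h z (s≤s n<J) = begin
    h (suc n + z)                                  ≡⟨ lem₁ (h (n + z)) (h (suc n + z)) ⟩
    h (n + z) ℤ.+ Δ h (n + z)                      ≡⟨ cong₂ ℤ._+_ (newton-shift n (suc J) h z (m<n⇒m<1+n n<J)) (newton-shift n J (Δ h) z n<J) ⟩
    (+ 1 ℤ.* h z ℤ.+ sumTo J (λ i → + (n C suc i) ℤ.* Δ^ i (Δ h) z)) ℤ.+ sumTo J (λ i → + (n C i) ℤ.* Δ^ i (Δ h) z)
      ≡⟨ ℤ.+-assoc (+ 1 ℤ.* h z) _ _ ⟩
    + 1 ℤ.* h z ℤ.+ (sumTo J (λ i → + (n C suc i) ℤ.* Δ^ i (Δ h) z) ℤ.+ sumTo J (λ i → + (n C i) ℤ.* Δ^ i (Δ h) z))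
      ≡⟨ cong (λ u → + 1 ℤ.* h z ℤ.+ u) (trans (sym (sumTo-+ J _ _)) (sumTo-cong J pascal)) ⟩
    + 1 ℤ.* h z ℤ.+ sumTo J (λ i → + (suc n C suc i) ℤ.* Δ^ i (Δ h) z) ∎
    where
    open ≡-Reasoning
    lem₁ : ∀ a b → b ≡ a ℤ.+ (b ℤ.- a)
    lem₁ = ℤ-Solver.solve-∀
    pascal : ∀ i → + (n C suc i) ℤ.* Δ^ i (Δ h) z ℤ.+ + (n C i) ℤ.* Δ^ i (Δ h) z ≡ + (suc n C suc i) ℤ.* Δ^ i (Δ h) z
    pascal i = trans (sym (ℤ.*-distribʳ-+ (Δ^ i (Δ h) z) (+ (n C suc i)) (+ (n C i))))
      (cong (λ u → + u ℤ.* Δ^ i (Δ h) z) (trans (+-comm (n C suc i) (n C i)) (nCk+nC[k+1]≡[n+1]C[k+1] n i)))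

  Periodic : ℕ → (ℕ → ℤ) → Set
  Periodic q h = ∀ z → h (q + z) ≡ h z

  Δ-periodic : ∀ {q h} → Periodic q h → Periodic q (Δ h)
  Δ-periodic {q} {h} per z = cong₂ ℤ._-_ (trans (cong h (sym (+-suc q z))) (per (suc z))) (per z)

  Δ^-periodic : ∀ {q h} j → Periodic q h → Periodic q (Δ^ j h)
  Δ^-periodic zero    per = per
  Δ^-periodic (suc j) per = Δ^-periodic j (Δ-periodic per)

  ∣*∣ : ∀ {a b c d} → a ℤ∣.∣ b → c ℤ∣.∣ d → a ℤ.* c ℤ∣.∣ b ℤ.* d
  ∣*∣ {a} {b} {c} {d} (ℤ∣.divides s refl) (ℤ∣.divides t refl) = ℤ∣.divides (s ℤ.* t) (lem s a t c)
    where
    lem : ∀ s a t c → s ℤ.* a ℤ.* (t ℤ.* c) ≡ s ℤ.* t ℤ.* (a ℤ.* c)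
    lem = ℤ-Solver.solve-∀

  -- Writing the shift by q = pᵉ as (1 + Δ)^q and using p ∣ C(q , i) for 0 < i < q, a q-periodic
  -- function satisfies Δ^q h ∈ p · span(Δ h, …, Δ^(q-1) h).
  Δ^-periodic-∣ : ∀ {p} → Prime p → ∀ e {h} → Periodic (p ^ e) h →
    ∀ k j z → p ^ e * k ≤ j → + (p ^ k) ℤ∣.∣ Δ^ j h z
  Δ^-periodic-∣ pp e {h} per zero j z _ = ℤ∣.divides (Δ^ j h z) (sym (ℤ.*-identityʳ _))
  Δ^-periodic-∣ {p} pp e {h} per (suc k) j z qk≤j = go (p ^ e) refl
    where
    go : ∀ q → p ^ e ≡ q → + (p ^ suc k) ℤ∣.∣ Δ^ j h z
    go zero eq = ⊥-elim (ℕ.≢-nonZero⁻¹ (p ^ e) ⦃ m^n≢0 p e ⦃ prime⇒nonZero pp ⦄ ⦄ eq)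
    go (suc q) eq = subst (+ (p ^ suc k) ℤ∣.∣_) top≡ d-top
      where
      -- Each further `p ^ e` differences gain one factor `p`: after `j'` differences, all later
      -- ones are divisible by `p ^ k` by induction.
      j' = j ∸ suc q
      qk≤j₁ : suc q + suc q * k ≤ j
      qk≤j₁ = subst (_≤ j) (trans (cong (_* suc k) eq) (*-suc (suc q) k)) qk≤j
      j≡ : j' + suc q ≡ j
      j≡ = m∸n+n≡m (≤-trans (m≤m+n (suc q) _) qk≤j₁)
      qk≤j' : p ^ e * k ≤ j'
      qk≤j' = subst (λ w → w * k ≤ j') (sym eq)
        (≤-trans (≤-reflexive (sym (m+n∸m≡n (suc q) (suc q * k)))) (∸-monoˡ-≤ (suc q) qk≤j₁))
      g = Δ^ j' h
      perg : Periodic (suc q) g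
      perg = subst (λ w → Periodic w g) eq (Δ^-periodic j' per)
      a : ℕ → ℤ
      a i = + (suc q C i) ℤ.* Δ^ i g z
      top≡ : Δ^ (suc q) g z ≡ Δ^ j h z
      top≡ = trans (Δ^-+ (suc q) j' h z) (cong (λ w → Δ^ w h z) j≡)
      d-mid : + (p ^ suc k) ℤ∣.∣ sumTo q (λ i → a (suc i))
      d-mid = sumTo-∣ q λ i i<q → subst (ℤ∣._∣ a (suc i)) (sym (ℤ.pos-* p (p ^ k)))
        (∣*∣ {+ p} {+ (suc q C suc i)} {+ (p ^ k)} {Δ^ (suc i) g z} (ℤ∣.∣ᵤ⇒∣ (subst (λ w → p ∣ (w C suc i)) eq (p∣C pp e i (subst (suc i <_) (sym eq) (s≤s i<q)))))
             (subst (+ (p ^ k) ℤ∣.∣_) (sym (Δ^-+ (suc i) j' h z))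
               (Δ^-periodic-∣ pp e per k (j' + suc i) z (≤-trans qk≤j' (m≤m+n j' (suc i))))))
      eqn : g z ≡ g z ℤ.+ (sumTo q (λ i → a (suc i)) ℤ.+ Δ^ (suc q) g z)
      eqn = begin
        g z                                        ≡⟨ sym (perg z) ⟩
        g (suc q + z)                              ≡⟨ newton-shift (suc q) (suc (suc q)) g z ≤-refl ⟩
        + 1 ℤ.* g z ℤ.+ sumTo (suc q) (λ i → a (suc i))
          ≡⟨ cong₂ ℤ._+_ (ℤ.*-identityˡ (g z)) (sumTo-last q (λ i → a (suc i))) ⟩
        g z ℤ.+ (sumTo q (λ i → a (suc i)) ℤ.+ + (suc q C suc q) ℤ.* Δ^ (suc q) g z)
          ≡⟨ cong (λ w → g z ℤ.+ (sumTo q (λ i → a (suc i)) ℤ.+ w))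
               (trans (cong (λ w → + w ℤ.* Δ^ (suc q) g z) (nCn≡1 (suc q))) (ℤ.*-identityˡ (Δ^ (suc q) g z))) ⟩
        g z ℤ.+ (sumTo q (λ i → a (suc i)) ℤ.+ Δ^ (suc q) g z) ∎
        where open ≡-Reasoning
      lem : ∀ x y w → x ≡ x ℤ.+ (y ℤ.+ w) → w ≡ ℤ.- y
      lem x y w e = trans (l₁ x y w) (trans (cong (λ t → t ℤ.- x ℤ.- y) (sym e)) (l₂ x y))
        where
        l₁ : ∀ x y w → w ≡ x ℤ.+ (y ℤ.+ w) ℤ.- x ℤ.- y
        l₁ = ℤ-Solver.solve-∀
        l₂ : ∀ x y → x ℤ.- x ℤ.- y ≡ ℤ.- y
        l₂ = ℤ-Solver.solve-∀
      d-top : + (p ^ suc k) ℤ∣.∣ Δ^ (suc q) g z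
      d-top = subst (+ (p ^ suc k) ℤ∣.∣_) (sym (lem (g z) _ _ eqn)) (ℤ∣.∣m⇒∣-m d-mid)

  infix 4 _≡_[mod_]

  -- Multiples of the modulus are added on both sides, so that ℕ needs no subtraction and symmetry
  -- is immediate; modulus 0 means equality.
  _≡_[mod_] : ℕ → ℕ → ℕ → Set
  a ≡ b [mod n ] = Σ ℕ λ s → Σ ℕ λ t → a + s * n ≡ b + t * n

  -- Induction on `J` and on `z`: by Pascal's rule, the error of the truncated series for `h`
  -- changes from `z` to `suc z` by the error of the series for `Δ h`, which has one term less.
  newton-mod : ∀ {P} J h → (∀ z → P ℤ∣.∣ Δ^ J h z) →
    ∀ z → P ℤ∣.∣ (h z ℤ.- sumTo J (λ j → Δ^ j h 0 ℤ.* + (z C j)))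
  newton-mod zero h d z = subst (_ ℤ∣.∣_) (sym (ℤ.+-identityʳ (h z))) (d z)
  newton-mod {P} (suc J) h d = go
    where
    c : ℕ → ℤ
    c j = Δ^ j (Δ h) 0
    go : ∀ z → P ℤ∣.∣ (h z ℤ.- (h 0 ℤ.* + 1 ℤ.+ sumTo J (λ j → c j ℤ.* + (z C suc j))))
    go zero = ℤ∣.divides (+ 0) (trans (cong (λ w → h 0 ℤ.- (h 0 ℤ.* + 1 ℤ.+ w)) (zeros J c)) (lem (h 0)))
      where
      zeros : ∀ J (a : ℕ → ℤ) → sumTo J (λ i → a i ℤ.* + 0) ≡ + 0
      zeros zero    a = refl
      zeros (suc J) a = trans (cong₂ ℤ._+_ (ℤ.*-zeroʳ (a 0)) (zeros J (λ j → a (suc j)))) refl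
      lem : ∀ x → x ℤ.- (x ℤ.* + 1 ℤ.+ + 0) ≡ + 0
      lem = ℤ-Solver.solve-∀
    go (suc z) = subst (P ℤ∣.∣_) (sym eq) (ℤ∣.∣m∣n⇒∣m+n (go z) (newton-mod J (Δ h) d z))
      where
      S₁ = sumTo J (λ j → c j ℤ.* + (z C suc j))
      S₀ = sumTo J (λ j → c j ℤ.* + (z C j))
      pascal : sumTo J (λ j → c j ℤ.* + (suc z C suc j)) ≡ S₁ ℤ.+ S₀
      pascal = trans (sumTo-cong J (λ j → trans
                 (cong (λ w → c j ℤ.* + w) (trans (sym (nCk+nC[k+1]≡[n+1]C[k+1] z j)) (+-comm (z C j) (z C suc j))))
                 (ℤ.*-distribˡ-+ (c j) (+ (z C suc j)) (+ (z C j)))))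
               (sumTo-+ J _ _)
      lem : ∀ x y w s₁ s₀ → y ℤ.- (w ℤ.+ (s₁ ℤ.+ s₀)) ≡ (x ℤ.- (w ℤ.+ s₁)) ℤ.+ ((y ℤ.- x) ℤ.- s₀)
      lem = ℤ-Solver.solve-∀
      eq : h (suc z) ℤ.- (h 0 ℤ.* + 1 ℤ.+ sumTo J (λ j → c j ℤ.* + (suc z C suc j)))
         ≡ (h z ℤ.- (h 0 ℤ.* + 1 ℤ.+ S₁)) ℤ.+ (Δ h z ℤ.- S₀)
      eq = trans (cong (λ w → h (suc z) ℤ.- (h 0 ℤ.* + 1 ℤ.+ w)) pascal) (lem (h z) (h (suc z)) (h 0 ℤ.* + 1) S₁ S₀)

  ∑< : ℕ → (ℕ → ℕ) → ℕ
  ∑< zero    f = 0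
  ∑< (suc J) f = f 0 + ∑< J (λ j → f (suc j))

  +-∑< : ∀ J f → + ∑< J f ≡ sumTo J (λ j → + f j)
  +-∑< zero    f = refl
  +-∑< (suc J) f = cong (λ w → + f 0 ℤ.+ w) (+-∑< J (λ j → f (suc j)))

  ∣-⇒mod : ∀ {n} a b → + n ℤ∣.∣ (+ a ℤ.- + b) → a ≡ b [mod n ]
  ∣-⇒mod {n} a b (ℤ∣.divides (+ t) eq) = 0 , t , ℤ.+-injective
    (trans (l₁ (+ a) (+ b)) (cong (λ w → + b ℤ.+ w) (trans eq (sym (ℤ.pos-* t n)))))
    where
    l₁ : ∀ a b → a ℤ.+ + 0 ≡ b ℤ.+ (a ℤ.- b)
    l₁ = ℤ-Solver.solve-∀
  ∣-⇒mod {n} a b (ℤ∣.divides -[1+ t ] eq) = suc t , 0 , ℤ.+-injective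
    (trans (cong (λ w → + a ℤ.+ w) (ℤ.pos-* (suc t) n))
      (trans (l₁ (+ a) (+ suc t) (+ n)) (trans (cong (λ w → + a ℤ.- w) (sym eq)) (l₂ (+ a) (+ b)))))
    where
    l₁ : ∀ a t n → a ℤ.+ t ℤ.* n ≡ a ℤ.- (ℤ.- t) ℤ.* n
    l₁ = ℤ-Solver.solve-∀
    l₂ : ∀ a b → a ℤ.- (a ℤ.- b) ≡ b ℤ.+ + 0
    l₂ = ℤ-Solver.solve-∀

  -- Mahler expansion, cut off where Δ^-periodic-∣ makes the remaining coefficients vanish modulo pᵏ.
  periodic-binomial : ∀ {p} → Prime p → ∀ e (h : ℕ → ℕ) → (∀ z → h (p ^ e + z) ≡ h z) → ∀ k →
    Σ (ℕ → ℕ) λ b → (∀ j → b j ≤ p ^ k) ×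
      (∀ z → h z ≡ ∑< (p ^ e * k) (λ j → b j * (z C j)) [mod p ^ k ])
  periodic-binomial {p} pp e h per k = b , (λ j → <⇒≤ (ℤ.n%ℕd<d (c j) P)) , λ z → ∣-⇒mod (h z) _ (main z)
    where
    J = p ^ e * k
    P = p ^ k
    instance
      P≢0 : NonZero (p ^ k)
      P≢0 = m^n≢0 p k ⦃ prime⇒nonZero pp ⦄
    c : ℕ → ℤ
    c j = Δ^ j (λ z → + h z) 0
    -- Lists of products can only have coefficients in ℕ, so the integer differences are reduced
    -- modulo `P`; what is removed is collected in `R`.
    b : ℕ → ℕ
    b j = c j ℤ.%ℕ P
    main : ∀ z → + P ℤ∣.∣ (+ h z ℤ.- + ∑< J (λ j → b j * (z C j)))
    main z = subst (+ P ℤ∣.∣_) eq (ℤ∣.∣m∣n⇒∣m+n d₁ d₂)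
      where
      S = sumTo J (λ j → c j ℤ.* + (z C j))
      d₁ : + P ℤ∣.∣ (+ h z ℤ.- S)
      d₁ = newton-mod J (λ z → + h z) (λ z → Δ^-periodic-∣ pp e (λ z → cong +_ (per z)) k J z ≤-refl) z
      r : ℕ → ℤ
      r j = c j ℤ./ℕ P
      R = sumTo J (λ j → (r j ℤ.* + P) ℤ.* + (z C j))
      d₂ : + P ℤ∣.∣ R
      d₂ = sumTo-∣ J (λ j _ → ℤ∣.∣m⇒∣m*n (+ (z C j)) (ℤ∣.divides (r j) refl))
      S≡ : S ≡ + ∑< J (λ j → b j * (z C j)) ℤ.+ R
      S≡ = trans (sumTo-cong J (λ j → trans (cong (λ w → w ℤ.* + (z C j)) (ℤ.a≡a%ℕn+[a/ℕn]*n (c j) P))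
                    (trans (ℤ.*-distribʳ-+ (+ (z C j)) (+ b j) (r j ℤ.* + P))
                           (cong (λ w → w ℤ.+ (r j ℤ.* + P) ℤ.* + (z C j)) (sym (ℤ.pos-* (b j) (z C j)))))))
             (trans (sumTo-+ J _ _) (cong (λ w → w ℤ.+ R) (sym (+-∑< J _))))
      lem : ∀ x t r → (x ℤ.- (t ℤ.+ r)) ℤ.+ r ≡ x ℤ.- t
      lem = ℤ-Solver.solve-∀
      eq : (+ h z ℤ.- S) ℤ.+ R ≡ + h z ℤ.- + ∑< J (λ j → b j * (z C j))
      eq = trans (cong (λ w → (+ h z ℤ.- w) ℤ.+ R) S≡) (lem (+ h z) (+ ∑< J (λ j → b j * (z C j))) R)

-- Counting polynomials

≡⇒mod : ∀ {n a b} → a ≡ b → a ≡ b [mod n ]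
≡⇒mod refl = 0 , 0 , refl

mod-sym : ∀ {n a b} → a ≡ b [mod n ] → b ≡ a [mod n ]
mod-sym (s , t , eq) = t , s , sym eq

mod-trans : ∀ {n a b c} → a ≡ b [mod n ] → b ≡ c [mod n ] → a ≡ c [mod n ]
mod-trans {n} {a} {b} {c} (s , t , eq) (s' , t' , eq') = s + s' , t + t' , (begin
  a + (s + s') * n    ≡⟨ l₁ a s s' n ⟩
  (a + s * n) + s' * n  ≡⟨ cong (_+ s' * n) eq ⟩
  (b + t * n) + s' * n  ≡⟨ l₂ b t s' n ⟩
  (b + s' * n) + t * n  ≡⟨ cong (_+ t * n) eq' ⟩
  (c + t' * n) + t * n  ≡⟨ l₃ c t' t n ⟩
  c + (t + t') * n ∎)
  where
  open ≡-Reasoning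
  l₁ : ∀ a s s' n → a + (s + s') * n ≡ (a + s * n) + s' * n
  l₁ = ℕ-Solver.solve-∀
  l₂ : ∀ b t s' n → (b + t * n) + s' * n ≡ (b + s' * n) + t * n
  l₂ = ℕ-Solver.solve-∀
  l₃ : ∀ c t' t n → (c + t' * n) + t * n ≡ c + (t + t') * n
  l₃ = ℕ-Solver.solve-∀

mod-+ : ∀ {n a b c d} → a ≡ b [mod n ] → c ≡ d [mod n ] → a + c ≡ b + d [mod n ]
mod-+ {n} {a} {b} {c} {d} (s , t , eq) (s' , t' , eq') = s + s' , t + t' ,
  trans (l a c s s' n) (trans (cong₂ _+_ eq eq') (sym (l b d t t' n)))
  where
  l : ∀ a c s s' n → a + c + (s + s') * n ≡ (a + s * n) + (c + s' * n)
  l = ℕ-Solver.solve-∀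

mod-*ˡ : ∀ {n a b} c → a ≡ b [mod n ] → c * a ≡ c * b [mod n ]
mod-*ˡ {n} {a} {b} c (s , t , eq) = c * s , c * t , trans (l c a s n) (trans (cong (c *_) eq) (sym (l c b t n)))
  where
  l : ∀ c a s n → c * a + c * s * n ≡ c * (a + s * n)
  l = ℕ-Solver.solve-∀

mod⇒∣ : ∀ {n a b} → a ≡ b [mod n ] → n ∣ a → n ∣ b
mod⇒∣ {n} {a} {b} (s , t , eq) n∣a =
  ∣m+n∣m⇒∣n (subst (n ∣_) (trans eq (+-comm b (t * n))) (∣m∣n⇒∣m+n n∣a (n∣m*n s))) (n∣m*n t)

mod⇒% : ∀ {n a b} .⦃ _ : NonZero n ⦄ → a ≡ b [mod n ] → a % n ≡ b % n
mod⇒% {n} {a} {b} (s , t , eq) = trans (sym ([m+kn]%n≡m%n a s n)) (trans (cong (_% n) eq) ([m+kn]%n≡m%n b t n))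

-- Indicators of divisibility and finite sums

bit : Bool → ℕ
bit true  = 1
bit false = 0

ι : ℕ → ℕ → ℕ
ι q z = bit (does (q ∣? z))

ι-yes : ∀ {q z} → q ∣ z → ι q z ≡ 1
ι-yes {q} {z} h with q ∣? z
... | yes _ = refl
... | no ¬h = ⊥-elim (¬h h)

ι-no : ∀ {q z} → ¬ (q ∣ z) → ι q z ≡ 0
ι-no {q} {z} ¬h with q ∣? z
... | yes h = ⊥-elim (¬h h)
... | no _ = refl

ι-cong : ∀ {q a b} → a ≡ b [mod q ] → ι q a ≡ ι q b
ι-cong {q} {a} {b} h with q ∣? a
... | yes q∣a = sym (ι-yes (mod⇒∣ h q∣a))
... | no ¬q∣a = sym (ι-no λ q∣b → ¬q∣a (mod⇒∣ (mod-sym h) q∣b))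

ι-periodic : ∀ q z → ι q (q + z) ≡ ι q z
ι-periodic q z = ι-cong {q} {q + z} {z} (0 , 1 , l q z)
  where
  l : ∀ q z → q + z + 0 * q ≡ z + 1 * q
  l = ℕ-Solver.solve-∀

∑<-cong : ∀ J {f g} → (∀ j → f j ≡ g j) → ∑< J f ≡ ∑< J g
∑<-cong zero    h = refl
∑<-cong (suc J) h = cong₂ _+_ (h 0) (∑<-cong J (λ j → h (suc j)))

∑<-const : ∀ J c → ∑< J (λ _ → c) ≡ J * c
∑<-const zero    c = refl
∑<-const (suc J) c = cong (c +_) (∑<-const J c)

∑<-*ˡ : ∀ J c f → ∑< J (λ j → c * f j) ≡ c * ∑< J f
∑<-*ˡ zero    c f = sym (*-zeroʳ c)
∑<-*ˡ (suc J) c f = trans (cong (c * f 0 +_) (∑<-*ˡ J c _)) (sym (*-distribˡ-+ c (f 0) _))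

∑<-last : ∀ J f → ∑< (suc J) f ≡ ∑< J f + f J
∑<-last zero    f = +-identityʳ (f 0)
∑<-last (suc J) f = trans (cong (f 0 +_) (∑<-last J (λ j → f (suc j)))) (sym (+-assoc (f 0) _ _))

∑<-zero : ∀ J {f} → (∀ j → j < J → f j ≡ 0) → ∑< J f ≡ 0
∑<-zero zero    h = refl
∑<-zero (suc J) h = cong₂ _+_ (h 0 (s≤s z≤n)) (∑<-zero J (λ j j<J → h (suc j) (s≤s j<J)))

-- Sliding the window of `p` consecutive numbers by one loses `z` and gains `z + p`, which are
-- divisible by `p` together or not at all.
∑-residues : ∀ p .⦃ _ : NonZero p ⦄ z → ∑< p (λ a → ι p (z + a)) ≡ 1
∑-residues (suc p) zero = cong₂ _+_ (ι-yes (suc p ∣0))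
  (∑<-zero p λ j j<p → ι-no λ h → <⇒≱ (s≤s j<p) (∣⇒≤ h))
∑-residues p (suc z) = +-cancelˡ-≡ (f 0) _ _ (begin
  f 0 + ∑< p (λ a → ι p (suc z + a)) ≡⟨ cong (f 0 +_) (∑<-cong p (λ a → cong (ι p) (sym (+-suc z a)))) ⟩
  ∑< (suc p) f                      ≡⟨ ∑<-last p f ⟩
  ∑< p f + f p                      ≡⟨ cong₂ _+_ (∑-residues p z) fp ⟩
  1 + f 0                           ≡⟨ +-comm 1 (f 0) ⟩
  f 0 + 1 ∎)
  where
  open ≡-Reasoning
  f : ℕ → ℕ
  f a = ι p (z + a)
  fp : f p ≡ f 0
  fp = trans (cong (ι p) (+-comm z p)) (trans (ι-periodic p z) (cong (ι p) (sym (+-identityʳ z))))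

module _ {A : Set} where

  ∑ : List A → (A → ℕ) → ℕ
  ∑ []       f = 0
  ∑ (a ∷ as) f = f a + ∑ as f

  ∑-cong : ∀ as {f g} → (∀ a → f a ≡ g a) → ∑ as f ≡ ∑ as g
  ∑-cong []       h = refl
  ∑-cong (a ∷ as) h = cong₂ _+_ (h a) (∑-cong as h)

  ∑-++ : ∀ as bs f → ∑ (as ++ bs) f ≡ ∑ as f + ∑ bs f
  ∑-++ []       bs f = refl
  ∑-++ (a ∷ as) bs f = trans (cong (f a +_) (∑-++ as bs f)) (sym (+-assoc (f a) _ _))

  ∑-bound : ∀ as {f} B → All (λ a → f a ≤ B) as → ∑ as f ≤ length as * B
  ∑-bound []       B []       = z≤n
  ∑-bound (a ∷ as) B (h ∷ hs) = +-mono-≤ h (∑-bound as B hs)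

  ∑-mod : ∀ {n} as {f g} → (∀ a → f a ≡ g a [mod n ]) → ∑ as f ≡ ∑ as g [mod n ]
  ∑-mod []       h = ≡⇒mod refl
  ∑-mod (a ∷ as) h = mod-+ (h a) (∑-mod as h)

  ∑-affine : ∀ as a b (f : A → ℕ) → ∑ as (λ i → a + b * f i) ≡ length as * a + b * ∑ as f
  ∑-affine []       a b f = sym (*-zeroʳ b)
  ∑-affine (i ∷ as) a b f = trans (cong (a + b * f i +_) (∑-affine as a b f)) (l a b (f i) (length as * a) (∑ as f))
    where
    l : ∀ a b x y z → a + b * x + (y + b * z) ≡ a + y + b * (x + z)
    l = ℕ-Solver.solve-∀

  glue : ℕ → (ℕ → List A) → List A
  glue zero    F = []
  glue (suc J) F = F 0 ++ glue J (λ j → F (suc j))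

  ∑-glue : ∀ J F f → ∑ (glue J F) f ≡ ∑< J (λ j → ∑ (F j) f)
  ∑-glue zero    F f = refl
  ∑-glue (suc J) F f = trans (∑-++ (F 0) _ f) (cong (∑ (F 0) f +_) (∑-glue J _ f))

  length-glue : ∀ J F B → (∀ j → j < J → length (F j) ≤ B) → length (glue J F) ≤ J * B
  length-glue zero    F B h = z≤n
  length-glue (suc J) F B h = subst (_≤ B + J * B) (sym (length-++ (F 0)))
    (+-mono-≤ (h 0 (s≤s z≤n)) (length-glue J _ B λ j j<J → h (suc j) (s≤s j<J)))

  All-glue : ∀ {R : A → Set} J F → (∀ j → j < J → All R (F j)) → All R (glue J F)
  All-glue zero    F h = []
  All-glue (suc J) F h = All.++⁺ (h 0 (s≤s z≤n)) (All-glue J _ λ j j<J → h (suc j) (s≤s j<J))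

  rep : ℕ → List A → List A
  rep c P = glue c (λ _ → P)

  ∑-rep : ∀ c P f → ∑ (rep c P) f ≡ c * ∑ P f
  ∑-rep c P f = trans (∑-glue c _ f) (∑<-const c _)

∑-map : ∀ {A B : Set} (g : A → B) as f → ∑ (List.map g as) f ≡ ∑ as (λ a → f (g a))
∑-map g []       f = refl
∑-map g (a ∷ as) f = cong (f (g a) +_) (∑-map g as f)

∑-concatMap : ∀ {A B : Set} (F : A → List B) as f → ∑ (concatMap F as) f ≡ ∑ as (λ a → ∑ (F a) f)
∑-concatMap F []       f = refl
∑-concatMap F (a ∷ as) f = trans (∑-++ (F a) _ f) (cong (∑ (F a) f +_) (∑-concatMap F as f))

length-concatMap : ∀ {A B : Set} (F : A → List B) as N → All (λ a → length (F a) ≤ N) as →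
  length (concatMap F as) ≤ length as * N
length-concatMap F []       N []       = z≤n
length-concatMap F (a ∷ as) N (h ∷ hs) = subst (_≤ N + length as * N) (sym (length-++ (F a)))
  (+-mono-≤ h (length-concatMap F as N hs))

All-concatMap : ∀ {A B : Set} {R : B → Set} (F : A → List B) as → All (λ a → All R (F a)) as → All R (concatMap F as)
All-concatMap F []       []       = []
All-concatMap F (a ∷ as) (h ∷ hs) = All.++⁺ h (All-concatMap F as hs)

-- A list of lists of atoms stands for the number of its members whose atoms are all true,
-- that is, for the input of the symmetric gate of a SYM∘AND circuit.
Poly : Set → Set
Poly A = List (List A)

module _ {A : Set} where

  mon : (A → Bool) → List A → ℕ
  mon v []      = 1
  mon v (a ∷ M) = bit (v a) * mon v M

  ev : (A → Bool) → Poly A → ℕ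
  ev v P = ∑ P (mon v)

  Deg≤ : ℕ → Poly A → Set
  Deg≤ d P = All (λ M → length M ≤ d) P

  mon-++ : ∀ v M N → mon v (M ++ N) ≡ mon v M * mon v N
  mon-++ v []      N = sym (+-identityʳ _)
  mon-++ v (a ∷ M) N = trans (cong (bit (v a) *_) (mon-++ v M N)) (sym (*-assoc (bit (v a)) _ _))

  mon-bit : ∀ v M → ∃ λ b → mon v M ≡ bit b
  mon-bit v []      = true , refl
  mon-bit v (a ∷ M) with v a
  ... | true  = proj₁ (mon-bit v M) , trans (+-identityʳ _) (proj₂ (mon-bit v M))
  ... | false = false , refl

  mon≤1 : ∀ v M → mon v M ≤ 1
  mon≤1 v M with mon-bit v M
  ... | true  , eq = ≤-reflexive eq
  ... | false , eq = subst (_≤ 1) (sym eq) z≤n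

  choose : ℕ → Poly A → Poly A
  choose zero    P       = [] ∷ []
  choose (suc j) []      = []
  choose (suc j) (M ∷ P) = List.map (M ++_) (choose j P) ++ choose (suc j) P

  -- `choose j P` is the elementary symmetric polynomial of degree `j` in the members of `P`. Each
  -- member is 0 or 1, so it counts the `j`-subsets of those equal to 1.
  ev-choose : ∀ v j P → ev v (choose j P) ≡ (ev v P C j)
  ev-choose v zero    P       = refl
  ev-choose v (suc j) []      = refl
  ev-choose v (suc j) (M ∷ P) = begin
    ∑ (List.map (M ++_) (choose j P) ++ choose (suc j) P) (mon v) ≡⟨ ∑-++ (List.map (M ++_) (choose j P)) _ (mon v) ⟩
    ∑ (List.map (M ++_) (choose j P)) (mon v) + ev v (choose (suc j) P) ≡⟨ cong₂ _+_ front (ev-choose v (suc j) P) ⟩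
    mon v M * (ev v P C j) + (ev v P C suc j)  ≡⟨ pascal ⟩
    (mon v M + ev v P) C suc j ∎
    where
    open ≡-Reasoning
    front : ∑ (List.map (M ++_) (choose j P)) (mon v) ≡ mon v M * (ev v P C j)
    front = trans (∑-map (M ++_) (choose j P) (mon v)) (trans (∑-cong (choose j P) (mon-++ v M))
      (trans (∑-affine (choose j P) 0 (mon v M) (mon v))
        (cong₂ _+_ (*-zeroʳ (length (choose j P))) (cong (mon v M *_) (ev-choose v j P)))))
    pascal : mon v M * (ev v P C j) + (ev v P C suc j) ≡ (mon v M + ev v P) C suc j
    pascal with mon-bit v M
    ... | true  , eq rewrite eq = trans (cong (_+ (ev v P C suc j)) (+-identityʳ _)) (nCk+nC[k+1]≡[n+1]C[k+1] (ev v P) j)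
    ... | false , eq rewrite eq = refl

  length-choose : ∀ j P → length (choose j P) ≤ suc (length P) ^ j
  length-choose zero    P       = ≤-refl
  length-choose (suc j) []      = z≤n
  length-choose (suc j) (M ∷ P) = begin
    length (List.map (M ++_) (choose j P) ++ choose (suc j) P) ≡⟨ trans (length-++ (List.map (M ++_) (choose j P))) (cong (_+ length (choose (suc j) P)) (length-map (M ++_) (choose j P))) ⟩
    length (choose j P) + length (choose (suc j) P) ≤⟨ +-mono-≤ (length-choose j P) (length-choose (suc j) P) ⟩
    suc (suc l) * suc l ^ j ≤⟨ *-monoʳ-≤ (suc (suc l)) (^-monoˡ-≤ j (n≤1+n (suc l))) ⟩
    suc (suc l) ^ suc j ∎
    where
    open ≤-Reasoning
    l = length P

  Deg-choose : ∀ {d} j P → Deg≤ d P → Deg≤ (j * d) (choose j P)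
  Deg-choose zero    P       h        = z≤n ∷ []
  Deg-choose (suc j) []      h        = []
  Deg-choose (suc j) (M ∷ P) (h ∷ hs) = All.++⁺
    (All.map⁺ (All.map (λ {N} k → subst (_≤ _) (sym (length-++ M)) (+-mono-≤ h k)) (Deg-choose j P hs)))
    (Deg-choose (suc j) P hs)

  -- Applies a binomial expansion to the value of `P`, which turns periodic functions of a sum into
  -- polynomials; natural coefficients become repetitions.
  comb : (ℕ → ℕ) → ℕ → Poly A → Poly A
  comb b J P = glue J (λ j → rep (b j) (choose j P))

  ev-comb : ∀ v b J P → ev v (comb b J P) ≡ ∑< J (λ j → b j * (ev v P C j))
  ev-comb v b J P = trans (∑-glue J _ (mon v)) (∑<-cong J λ j →
    trans (∑-rep (b j) (choose j P) (mon v)) (cong (b j *_) (ev-choose v j P)))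

  length-comb : ∀ b J P B → (∀ j → b j ≤ B) → length (comb b J P) ≤ J * (B * suc (length P) ^ J)
  length-comb b J P B h = length-glue J _ _ λ j j<J →
    ≤-trans (length-glue (b j) _ _ λ _ _ → ≤-trans (length-choose j P) (^-monoʳ-≤ (suc (length P)) (<⇒≤ j<J)))
            (*-monoˡ-≤ _ (h j))

  Deg-comb : ∀ {d} b J P → Deg≤ d P → Deg≤ (J * d) (comb b J P)
  Deg-comb {d} b J P h = All-glue J _ λ j j<J → All-glue (b j) _ λ _ _ →
    All.map (λ k → ≤-trans k (*-monoˡ-≤ d (<⇒≤ j<J))) (Deg-choose j P h)

  -- Linear combinations modulo p

  module _ (p : ℕ) where

    -- The sums Σ aᵢ uᵢ for all choices of coefficients aᵢ in 0, ..., p - 1.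
    combos : List (Poly A) → List (Poly A)
    combos []       = [] ∷ []
    combos (u ∷ us) = glue p (λ a → List.map (rep a u ++_) (combos us))

    -- The offset `c` carries the terms whose coefficients are already fixed; both counts below go
    -- by induction for all offsets at once.
    ∑-combos : ∀ v u us c → ∑ (combos (u ∷ us)) (λ Q → ι p (c + ev v Q)) ≡
      ∑< p (λ a → ∑ (combos us) (λ Q → ι p (c + a * ev v u + ev v Q)))
    ∑-combos v u us c = trans (∑-glue p _ _) (∑<-cong p λ a → trans (∑-map (rep a u ++_) (combos us) _)
      (∑-cong (combos us) λ Q → cong (ι p) (trans (cong (c +_)
        (trans (∑-++ (rep a u) Q (mon v)) (cong (_+ ev v Q) (∑-rep a u (mon v))))) (sym (+-assoc c _ _)))))

    length-combos : ∀ us → length (combos us) ≤ p ^ length us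
    length-combos []       = ≤-refl
    length-combos (u ∷ us) = length-glue p _ _ λ a _ →
      subst (_≤ p ^ length us) (sym (length-map (rep a u ++_) (combos us))) (length-combos us)

    combos-short : ∀ us B → All (λ u → length u ≤ B) us → All (λ Q → length Q ≤ length us * (p * B)) (combos us)
    combos-short []       B []       = z≤n ∷ []
    combos-short (u ∷ us) B (h ∷ hs) = All-glue p _ λ a a<p → All.map⁺ (All.map (λ {Q} k →
      subst (_≤ _) (sym (length-++ (rep a u))) (+-mono-≤
        (≤-trans (length-glue a _ B λ _ _ → h) (*-monoˡ-≤ B (<⇒≤ a<p))) k)) (combos-short us B hs))

    combos-Deg : ∀ us d → All (Deg≤ d) us → All (Deg≤ d) (combos us)
    combos-Deg []       d []       = [] ∷ []
    combos-Deg (u ∷ us) d (h ∷ hs) = All-glue p _ λ a _ → All.map⁺ (All.map (λ k →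
      All.++⁺ (All-glue a _ λ _ _ → h) k) (combos-Deg us d hs))

    module _ (v : A → Bool) where

      Bits : List (Poly A) → List Bool → Set
      Bits = Pointwise (λ u b → ev v u ≡ bit b [mod p ])

      ∑-combos-zero : ∀ {us bs} → Bits us bs → anyB bs ≡ false → ∀ c →
        ∑ (combos us) (λ Q → ι p (c + ev v Q)) ≡ p ^ length us * ι p c
      ∑-combos-zero []                        _ c = cong (λ w → ι p w + 0) (+-identityʳ c)
      ∑-combos-zero {u ∷ us} {false ∷ bs} (h ∷ hs) e c = begin
        ∑ (combos (u ∷ us)) (λ Q → ι p (c + ev v Q))  ≡⟨ ∑-combos v u us c ⟩
        ∑< p (λ a → ∑ (combos us) (λ Q → ι p (c + a * ev v u + ev v Q)))
          ≡⟨ ∑<-cong p (λ a → trans (∑-combos-zero hs e (c + a * ev v u)) (cong (p ^ length us *_) (ι-cong {p} {c + a * ev v u} {c} (drop a)))) ⟩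
        ∑< p (λ a → p ^ length us * ι p c)            ≡⟨ ∑<-const p _ ⟩
        p * (p ^ length us * ι p c)                   ≡⟨ sym (*-assoc p _ _) ⟩
        p * p ^ length us * ι p c ∎
        where
        open ≡-Reasoning
        drop : ∀ a → c + a * ev v u ≡ c [mod p ]
        drop a = mod-trans (mod-+ (≡⇒mod {a = c} refl) (mod-*ˡ a h)) (≡⇒mod (trans (cong (c +_) (*-zeroʳ a)) (+-identityʳ c)))

      -- One combination in `p` vanishes: the coefficient of the last true bit moves the sum through
      -- all residues, exactly one of which is 0. The factor `p` on the left avoids a division.
      ∑-combos-nonzero : .⦃ _ : NonZero p ⦄ → ∀ {us bs} → Bits us bs → anyB bs ≡ true → ∀ c →
        p * ∑ (combos us) (λ Q → ι p (c + ev v Q)) ≡ p ^ length us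
      ∑-combos-nonzero {u ∷ us} {true ∷ bs} (h ∷ hs) e c = trans (cong (p *_) (∑-combos v u us c)) (go (anyB bs) refl)
        where
        open ≡-Reasoning
        go : ∀ b → anyB bs ≡ b → p * ∑< p (λ a → ∑ (combos us) (λ Q → ι p (c + a * ev v u + ev v Q))) ≡ p * p ^ length us
        go true e' = begin
          p * ∑< p (λ a → ∑ (combos us) (λ Q → ι p (c + a * ev v u + ev v Q)))
            ≡⟨ sym (∑<-*ˡ p p _) ⟩
          ∑< p (λ a → p * ∑ (combos us) (λ Q → ι p (c + a * ev v u + ev v Q)))
            ≡⟨ ∑<-cong p (λ a → ∑-combos-nonzero hs e' (c + a * ev v u)) ⟩
          ∑< p (λ a → p ^ length us) ≡⟨ ∑<-const p _ ⟩
          p * p ^ length us ∎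
        go false e' = cong (p *_) (begin
          ∑< p (λ a → ∑ (combos us) (λ Q → ι p (c + a * ev v u + ev v Q)))
            ≡⟨ ∑<-cong p (λ a → trans (∑-combos-zero hs e' (c + a * ev v u)) (cong (p ^ length us *_) (ι-cong {p} {c + a * ev v u} {c + a} (one a)))) ⟩
          ∑< p (λ a → p ^ length us * ι p (c + a)) ≡⟨ ∑<-*ˡ p (p ^ length us) (λ a → ι p (c + a)) ⟩
          p ^ length us * ∑< p (λ a → ι p (c + a)) ≡⟨ cong (p ^ length us *_) (∑-residues p c) ⟩
          p ^ length us * 1 ≡⟨ *-identityʳ _ ⟩
          p ^ length us ∎)
          where
          one : ∀ a → c + a * ev v u ≡ c + a [mod p ]
          one a = mod-trans (mod-+ (≡⇒mod {a = c} refl) (mod-*ˡ a h)) (≡⇒mod (cong (c +_) (*-identityʳ a)))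
      ∑-combos-nonzero {u ∷ us} {false ∷ bs} (h ∷ hs) e c = begin
        p * ∑ (combos (u ∷ us)) (λ Q → ι p (c + ev v Q))  ≡⟨ cong (p *_) (∑-combos v u us c) ⟩
        p * ∑< p (λ a → ∑ (combos us) (λ Q → ι p (c + a * ev v u + ev v Q)))  ≡⟨ sym (∑<-*ˡ p p _) ⟩
        ∑< p (λ a → p * ∑ (combos us) (λ Q → ι p (c + a * ev v u + ev v Q)))
          ≡⟨ ∑<-cong p (λ a → ∑-combos-nonzero hs e (c + a * ev v u)) ⟩
        ∑< p (λ a → p ^ length us) ≡⟨ ∑<-const p _ ⟩
        p * p ^ length us ∎
        where open ≡-Reasoning

-- Removing one layer of modular gates

-- One prime power serves the whole layer, since the gates will be replaced by congruences modulo
-- powers of a single prime.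
record Layer {X A B : Set} (val : X → A → Bool) (val' : X → B → Bool) (m s ℓ : ℕ) : Set where
  field
    {p e q}  : ℕ
    p-prime  : Prime p
    q≡       : q ≡ p ^ e
    p≤m      : p ≤ m
    q≤m      : q ≤ m
    gate     : B → Poly A
    gate-len : ∀ b → length (gate b) ≤ s
    gate-deg : ∀ b → Deg≤ ℓ (gate b)
    gate-val : ∀ x b → bit (val' x b) ≡ ι q (ev (val x) (gate b))

-- A single `K` bounds both the degree and the logarithm of the number of products, so that removing
-- a layer costs one factor.
record SymSum {X A : Set} (val : X → A → Bool) (K : ℕ) (f : X → Bool) : Set where
  field
    poly    : Poly A
    deg     : Deg≤ K poly
    len     : length poly ≤ 2 ^ K
    dec     : ℕ → Bool
    correct : ∀ x → dec (ev (val x) poly) ≡ f x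

-- The terms without `ℓ` are the exponent of the number of products (`len-exp`), the last one is the
-- degree (`deg-exp`). It is linear in `σ` and `ℓ`, hence O(y) for fixed `m`.
growth : ℕ → ℕ → ℕ → ℕ
growth m σ ℓ = 1 + 7 * m + 3 * m * (m + 5) * σ + 3 * m * m * ℓ

periodic-binomial′ : ∀ {p q P} → Prime p → ∀ e k → q ≡ p ^ e → P ≡ p ^ k → (h : ℕ → ℕ) → (∀ z → h (q + z) ≡ h z) →
  Σ (ℕ → ℕ) λ b → (∀ j → b j ≤ P) × (∀ z → h z ≡ ∑< (q * k) (λ j → b j * (z C j)) [mod P ])
periodic-binomial′ pp e k refl refl h per = periodic-binomial pp e h per k

-- Since `a + b * F` lies below `P`, it is the remainder of `z` itself, and `F` follows by exact
-- division; `b` need not be a unit modulo `P`.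
affine-decoder : ∀ P a b → 0 < b → Σ (ℕ → ℕ) λ d → ∀ z F → a + b * F < P → z ≡ a + b * F [mod P ] → d z ≡ F
affine-decoder zero    a b       _ = (λ z → z) , λ _ _ ()
affine-decoder (suc P) a (suc b) _ = (λ z → (z % suc P ∸ a) / suc b) , λ z F F<P z≡ →
  trans (cong (λ w → (w ∸ a) / suc b) (trans (mod⇒% {suc P} z≡) (m<n⇒m%n≡m F<P)))
    (trans (cong (_/ suc b) (trans (m+n∸m≡n a (suc b * F)) (*-comm (suc b) F))) (m*n/n≡m F (suc b)))

n≤2^n : ∀ n → n ≤ 2 ^ n
n≤2^n zero    = z≤n
n≤2^n (suc n) = ≤-trans (+-mono-≤ (m^n>0 2 n) (n≤2^n n)) (≤-reflexive (cong (2 ^ n +_) (sym (+-identityʳ (2 ^ n)))))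

n<2^n : ∀ n → n < 2 ^ n
n<2^n zero    = s≤s z≤n
n<2^n (suc n) = ≤-trans (+-mono-≤ (m^n>0 2 n) (n<2^n n)) (≤-reflexive (cong (2 ^ n +_) (sym (+-identityʳ (2 ^ n)))))

^-mono : ∀ {a b} u → a ≤ 2 ^ u → ∀ {k l} → b ≤ k → u * k ≤ l → a ^ b ≤ 2 ^ l
^-mono {a} {b} u h {k} {l} b≤k uk≤l = begin
  a ^ b         ≤⟨ ^-monoˡ-≤ b h ⟩
  (2 ^ u) ^ b   ≡⟨ ^-*-assoc 2 u b ⟩
  2 ^ (u * b)   ≤⟨ ^-monoʳ-≤ 2 (≤-trans (*-monoʳ-≤ u b≤k) uk≤l) ⟩
  2 ^ l ∎
  where open ≤-Reasoning

2^-* : ∀ {a b} u w → a ≤ 2 ^ u → b ≤ 2 ^ w → a * b ≤ 2 ^ (u + w)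
2^-* u w h k = ≤-trans (*-mono-≤ h k) (≤-reflexive (sym (^-distribˡ-+-* 2 u w)))

mon-not-any : ∀ {A : Set} (v : A → Bool) M → mon v M ≡ bit (not (anyB (List.map (λ a → not (v a)) M)))
mon-not-any v []      = refl
mon-not-any v (a ∷ M) with v a
... | true  = trans (+-identityʳ _) (mon-not-any v M)
... | false = refl

anyB-++-false : ∀ bs n → anyB (bs ++ replicate n false) ≡ anyB bs
anyB-++-false []           zero    = refl
anyB-++-false []           (suc n) = anyB-++-false [] n
anyB-++-false (true ∷ bs)  n       = refl
anyB-++-false (false ∷ bs) n       = anyB-++-false bs n

module _ {X A B : Set} {val : X → A → Bool} {val' : X → B → Bool} {m s ℓ : ℕ}
         (𝓛 : Layer val val' m s ℓ) where
  open Layer 𝓛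

  instance
    p≢0 : NonZero p
    p≢0 = prime⇒nonZero p-prime

  private
    p₁ = p ∸ 1

    p≡ : suc p₁ ≡ p
    p≡ = m+[n∸m]≡n (ℕ.>-nonZero⁻¹ p)

    p₁>0 : 0 < p₁
    p₁>0 = m<n⇒0<n∸m (ℕ.nonTrivial⇒n>1 p ⦃ prime⇒nonTrivial p-prime ⦄)

    p≥2 : 2 ≤ p
    p≥2 = ℕ.nonTrivial⇒n>1 p ⦃ prime⇒nonTrivial p-prime ⦄

    -- The negated gate as a polynomial of degree below `q`. Modulo the first power of `p` is
    -- enough, because it only enters sums tested for divisibility by `p`.
    negation : Σ (ℕ → ℕ) λ b → (∀ j → b j ≤ p) × (∀ z → 1 ∸ ι q z ≡ ∑< (q * 1) (λ j → b j * (z C j)) [mod p ])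
    negation = periodic-binomial′ p-prime e 1 q≡ (sym (^-identityʳ p)) (λ z → 1 ∸ ι q z) (λ z → cong (1 ∸_) (ι-periodic q z))

  negate : B → Poly A
  negate b = comb (proj₁ negation) (q * 1) (gate b)

  negate-val : ∀ x b → ev (val x) (negate b) ≡ bit (not (val' x b)) [mod p ]
  negate-val x b = mod-trans (≡⇒mod (ev-comb (val x) (proj₁ negation) (q * 1) (gate b)))
    (mod-trans (mod-sym (proj₂ (proj₂ negation) (ev (val x) (gate b))))
      (≡⇒mod (trans (cong (1 ∸_) (sym (gate-val x b))) (flip (val' x b)))))
    where
    flip : ∀ c → 1 ∸ bit c ≡ bit (not c)
    flip true  = refl
    flip false = refl

  negate-len : ∀ σ b → suc s ≤ 2 ^ σ → m ≤ 2 ^ σ → length (negate b) ≤ 2 ^ (σ + (σ + σ * m))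
  negate-len σ b s≤ m≤ = ≤-trans (length-comb (proj₁ negation) (q * 1) (gate b) p (proj₁ (proj₂ negation)))
    (2^-* σ (σ + σ * m) (≤-trans q1≤m m≤) (2^-* σ (σ * m) (≤-trans p≤m m≤)
      (^-mono σ (≤-trans (s≤s (gate-len b)) s≤) q1≤m ≤-refl)))
    where
    q1≤m : q * 1 ≤ m
    q1≤m = subst (_≤ m) (sym (*-identityʳ q)) q≤m

  negate-deg : ∀ b → Deg≤ (m * ℓ) (negate b)
  negate-deg b = All.map (λ h → ≤-trans h (*-monoˡ-≤ ℓ (subst (_≤ m) (sym (*-identityʳ q)) q≤m)))
    (Deg-comb (proj₁ negation) (q * 1) (gate b) (gate-deg b))

  module _ (K : ℕ) where

    -- The empty sums added here are 0, that is, conditions never violated. With exactly `K` entries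
    -- for every product, the affine function is the same for all products, and summing over them
    -- stays affine.
    padded : List B → List (Poly A)
    padded M = List.map negate M ++ replicate (K ∸ length M) []

    length-padded : ∀ M → length M ≤ K → length (padded M) ≡ K
    length-padded M M≤K = trans (length-++ (List.map negate M))
      (trans (cong₂ _+_ (length-map negate M) (length-replicate (K ∸ length M))) (m+[n∸m]≡n M≤K))

    flags : X → List B → List Bool
    flags x M = List.map (λ b → not (val' x b)) M ++ replicate (K ∸ length M) false

    padded-bits : ∀ x M → Bits p (val x) (padded M) (flags x M)
    padded-bits x M = go M
      where
      pad : ∀ n → Bits p (val x) (replicate n []) (replicate n false)
      pad zero    = []
      pad (suc n) = ≡⇒mod refl ∷ pad n
      go : ∀ L → Bits p (val x) (List.map negate L ++ replicate (K ∸ length M) [])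
                      (List.map (λ b → not (val' x b)) L ++ replicate (K ∸ length M) false)
      go []      = pad _
      go (b ∷ L) = negate-val x b ∷ go L

  -- The conjunction of K gates [q ∣ g₁], …, [q ∣ g_K] becomes an affine function of the sum over
  -- a ∈ {0,…,p-1}ᴷ of the single gates [p ∣ Σ aᵢ uᵢ], where uᵢ ≡ [q ∤ gᵢ] mod p.  No product of
  -- gates survives, which is what keeps the growth of the degree linear in K.
  ∑-padded : ∀ K₀ x M → length M ≤ suc K₀ →
    ∑ (combos p (padded (suc K₀) M)) (λ Q → ι p (ev (val x) Q)) ≡ p ^ K₀ + p ^ K₀ * p₁ * mon (val' x) M
  ∑-padded K₀ x M M≤K = go (anyB (List.map (λ b → not (val' x b)) M)) refl
    where
    open ≡-Reasoning
    K = suc K₀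
    S = ∑ (combos p (padded K M)) (λ Q → ι p (ev (val x) Q))
    len≡ : p ^ length (padded K M) ≡ p * p ^ K₀
    len≡ = cong (p ^_) (length-padded K M M≤K)
    go : ∀ b → anyB (List.map (λ b → not (val' x b)) M) ≡ b → S ≡ p ^ K₀ + p ^ K₀ * p₁ * mon (val' x) M
    go true e = begin
      S        ≡⟨ *-cancelˡ-≡ _ _ p (trans (∑-combos-nonzero p (val x) (padded-bits K x M) (trans (anyB-++-false (List.map (λ b → not (val' x b)) M) (K ∸ length M)) e) 0) len≡) ⟩
      p ^ K₀   ≡⟨ sym (trans (cong (p ^ K₀ +_) (*-zeroʳ (p ^ K₀ * p₁))) (+-identityʳ _)) ⟩
      p ^ K₀ + p ^ K₀ * p₁ * 0 ≡⟨ cong (λ w → p ^ K₀ + p ^ K₀ * p₁ * w) (sym (trans (mon-not-any (val' x) M) (cong (λ c → bit (not c)) e))) ⟩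
      p ^ K₀ + p ^ K₀ * p₁ * mon (val' x) M ∎
    go false e = begin
      S        ≡⟨ ∑-combos-zero p (val x) (padded-bits K x M) (trans (anyB-++-false (List.map (λ b → not (val' x b)) M) (K ∸ length M)) e) 0 ⟩
      p ^ length (padded K M) * ι p 0 ≡⟨ cong₂ _*_ len≡ (ι-yes {p} {0} (p ∣0)) ⟩
      p * p ^ K₀ * 1  ≡⟨ cong (λ w → w * p ^ K₀ * 1) (sym p≡) ⟩
      (p ^ K₀ + p₁ * p ^ K₀) * 1 ≡⟨ lem (p ^ K₀) p₁ ⟩
      p ^ K₀ + p ^ K₀ * p₁ * 1 ≡⟨ cong (λ w → p ^ K₀ + p ^ K₀ * p₁ * w) (sym (trans (mon-not-any (val' x) M) (cong (λ c → bit (not c)) e))) ⟩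
      p ^ K₀ + p ^ K₀ * p₁ * mon (val' x) M ∎
      where
      lem : ∀ a b → (a + b * a) * 1 ≡ a + a * b * 1
      lem = ℕ-Solver.solve-∀

  module _ (k : ℕ) where

    private
      indicator : Σ (ℕ → ℕ) λ b → (∀ j → b j ≤ p ^ k) × (∀ z → ι p z ≡ ∑< (p * k) (λ j → b j * (z C j)) [mod p ^ k ])
      indicator = periodic-binomial′ p-prime 1 k (sym (^-identityʳ p)) refl (ι p) (ι-periodic p)

    -- The period of `ι p` is `p` whatever the exponent `k`, so `p * k` terms give it modulo
    -- `p ^ k`, and the degree is linear in `k`.
    amplify : Poly A → Poly A
    amplify Q = comb (proj₁ indicator) (p * k) Q

    amplify-val : ∀ x Q → ev (val x) (amplify Q) ≡ ι p (ev (val x) Q) [mod p ^ k ]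
    amplify-val x Q = mod-trans (≡⇒mod (ev-comb (val x) (proj₁ indicator) (p * k) Q))
      (mod-sym (proj₂ (proj₂ indicator) (ev (val x) Q)))

    amplify-len : ∀ Q → length (amplify Q) ≤ p * k * (p ^ k * suc (length Q) ^ (p * k))
    amplify-len Q = length-comb (proj₁ indicator) (p * k) Q (p ^ k) (proj₁ (proj₂ indicator))

    amplify-deg : ∀ {d} Q → Deg≤ d Q → Deg≤ (p * k * d) (amplify Q)
    amplify-deg Q = Deg-comb (proj₁ indicator) (p * k) Q

  module _ {σ K₀ : ℕ} (1≤σ : 1 ≤ σ) (s≤ : suc s ≤ 2 ^ σ) (m≤ : m ≤ 2 ^ σ) (K≤ : suc K₀ ≤ 2 ^ σ) where

    private
      K = suc K₀
      -- The number to be decoded is at most `N * p ^ K` with N ≤ 2^K ≤ p^K, hence at most p^(2K),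
      -- and K > 0 makes p^(3K) strictly larger.
      k = 3 * K
      -- Exponents of 2 bounding lengths: `B₁` for a negated gate, `B₂` for one more than a linear
      -- combination of `K` of them (the last `σ` pays for the one more), `B₃` for its
      -- amplification.
      B₁ = σ + (σ + σ * m)
      B₂ = σ + (σ + B₁) + σ
      B₃ = 3 * m * K + (m * k + B₂ * (3 * m * K))

      pk≤ : p * k ≤ 3 * m * K
      pk≤ = ≤-trans (*-monoˡ-≤ k p≤m) (≤-reflexive (lem m K))
        where
        lem : ∀ m K → m * (3 * K) ≡ 3 * m * K
        lem = ℕ-Solver.solve-∀

      p≤2^m : p ≤ 2 ^ m
      p≤2^m = ≤-trans p≤m (n≤2^n m)

      combo-len : ∀ M → length M ≤ K → All (λ Q → suc (length Q) ≤ 2 ^ B₂) (combos p (padded K M))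
      combo-len M M≤K = All.map
        (λ {Q} h → ≤-trans (+-mono-≤ (m^n>0 2 (σ + (σ + B₁))) (≤-trans h (≤-trans (≤-reflexive (cong (_* (p * 2 ^ B₁)) (length-padded K M M≤K)))
            (2^-* σ (σ + B₁) K≤ (2^-* σ B₁ (≤-trans p≤m m≤) ≤-refl)))))
          (≤-trans (≤-reflexive (lem (2 ^ (σ + (σ + B₁))))) (2^-* (σ + (σ + B₁)) σ ≤-refl (^-monoʳ-≤ 2 1≤σ))))
        (combos-short p (padded K M) (2 ^ B₁) (All.++⁺ (All.map⁺ (All.universal (λ b → negate-len σ b s≤ m≤) M))
          (All.replicate⁺ (K ∸ length M) z≤n)))
        where
        lem : ∀ a → a + a ≡ a * 2
        lem = ℕ-Solver.solve-∀

      combo-deg : ∀ M → All (Deg≤ (m * ℓ)) (combos p (padded K M))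
      combo-deg M = combos-Deg p (padded K M) (m * ℓ) (All.++⁺ (All.map⁺ (All.universal negate-deg M))
          (All.replicate⁺ (K ∸ length M) []))

      amp-len : ∀ Q → suc (length Q) ≤ 2 ^ B₂ → length (amplify k Q) ≤ 2 ^ B₃
      amp-len Q h = ≤-trans (amplify-len k Q)
        (2^-* (3 * m * K) (m * k + B₂ * (3 * m * K)) (≤-trans pk≤ (n≤2^n (3 * m * K)))
          (2^-* (m * k) (B₂ * (3 * m * K)) (^-mono m p≤2^m {k} ≤-refl ≤-refl) (^-mono B₂ h pk≤ ≤-refl)))

      block : List B → Poly A
      block M = concatMap (amplify k) (combos p (padded K M))

      block-len : ∀ M → length M ≤ K → length (block M) ≤ 2 ^ (m * K + B₃)
      block-len M M≤K = ≤-trans (length-concatMap (amplify k) (combos p (padded K M)) (2 ^ B₃)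
          (All.map (λ {Q} → amp-len Q) (combo-len M M≤K)))
        (2^-* (m * K) B₃ (≤-trans (length-combos p (padded K M)) (^-mono m p≤2^m (≤-reflexive (length-padded K M M≤K)) ≤-refl)) ≤-refl)

      block-val : ∀ x M → length M ≤ K → ev (val x) (block M) ≡ p ^ K₀ + p ^ K₀ * p₁ * mon (val' x) M [mod p ^ k ]
      block-val x M M≤K = mod-trans (≡⇒mod (∑-concatMap (amplify k) (combos p (padded K M)) (mon (val x))))
        (mod-trans (∑-mod (combos p (padded K M)) (amplify-val k x)) (≡⇒mod (∑-padded K₀ x M M≤K)))

      len-exp : K + (m * K + B₃) ≤ growth m σ ℓ * K
      len-exp = ≤-trans (≤-reflexive (lem₁ m K σ))
        (*-monoˡ-≤ K (m≤m+n (1 + 7 * m + 3 * m * (m + 5) * σ) (3 * m * m * ℓ)))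
        where
        lem₁ : ∀ m K σ → K + (m * K + (3 * m * K + (m * (3 * K) + (σ + (σ + (σ + (σ + σ * m))) + σ) * (3 * m * K)))) ≡ (1 + 7 * m + 3 * m * (m + 5) * σ) * K
        lem₁ = ℕ-Solver.solve-∀

      deg-exp : p * k * (m * ℓ) ≤ growth m σ ℓ * K
      deg-exp = ≤-trans (*-monoˡ-≤ (m * ℓ) pk≤) (≤-trans (≤-reflexive (lem m K ℓ))
        (*-monoˡ-≤ K (m≤n+m (3 * m * m * ℓ) (1 + 7 * m + 3 * m * (m + 5) * σ))))
        where
        lem : ∀ m K ℓ → 3 * m * K * (m * ℓ) ≡ 3 * m * m * ℓ * K
        lem = ℕ-Solver.solve-∀

    -- Every product becomes its `block`, congruent modulo `p ^ k` to the common affine function of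
    -- the product. The new sum is thus congruent to an affine function of the old one, which the
    -- decoder undoes before `dec` is applied.
    layer-step : ∀ {f} → SymSum val' K f → SymSum val (growth m σ ℓ * K) f
    layer-step {f} S = record
      { poly    = concatMap block poly
      ; deg     = All-concatMap block poly (All.map (λ {M} _ → All-concatMap (amplify k) (combos p (padded K M))
                    (All.map (λ {Q} h → All.map (λ h' → ≤-trans h' deg-exp) (amplify-deg k Q h)) (combo-deg M))) deg)
      ; len     = ≤-trans (length-concatMap block poly _ (All.map (λ {M} → block-len M) deg))
                    (≤-trans (2^-* K (m * K + B₃) len ≤-refl) (^-monoʳ-≤ 2 len-exp))
      ; dec     = λ z → dec (proj₁ decoder z)
      ; correct = λ x → trans (cong dec (proj₂ decoder _ (ev (val' x) poly) (small x) (value x))) (correct x)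
      }
      where
      open SymSum S
      N = length poly
      a = N * p ^ K₀
      c = p ^ K₀ * p₁
      decoder = affine-decoder (p ^ k) a c (*-mono-≤ (m^n>0 p K₀) p₁>0)
      value : ∀ x → ev (val x) (concatMap block poly) ≡ a + c * ev (val' x) poly [mod p ^ k ]
      value x = mod-trans (≡⇒mod (∑-concatMap block poly (mon (val x)))) (mod-trans (go poly deg)
          (≡⇒mod (∑-affine poly (p ^ K₀) c (mon (val' x)))))
        where
        go : ∀ P → Deg≤ K P → ∑ P (λ M → ev (val x) (block M)) ≡ ∑ P (λ M → p ^ K₀ + c * mon (val' x) M) [mod p ^ k ]
        go []      []       = ≡⇒mod refl
        go (M ∷ P) (h ∷ hs) = mod-+ (block-val x M h) (go P hs)
      small : ∀ x → a + c * ev (val' x) poly < p ^ k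
      small x = begin-strict
        a + c * ev (val' x) poly  ≤⟨ +-monoʳ-≤ a (*-monoʳ-≤ c (subst (ev (val' x) poly ≤_) (*-identityʳ N)
                                       (∑-bound poly 1 (All.universal (mon≤1 (val' x)) poly)))) ⟩
        N * p ^ K₀ + p ^ K₀ * p₁ * N ≡⟨ lem N (p ^ K₀) p₁ ⟩
        N * (suc p₁ * p ^ K₀)     ≡⟨ cong (λ w → N * (w * p ^ K₀)) p≡ ⟩
        N * p ^ K                 ≤⟨ *-monoˡ-≤ (p ^ K) (≤-trans len (^-monoˡ-≤ K p≥2)) ⟩
        p ^ K * p ^ K             ≡⟨ sym (^-distribˡ-+-* p K K) ⟩
        p ^ (K + K)               <⟨ ^-monoʳ-< p p≥2 (subst (K + K <_) (lem₂ K) (m<m+n (K + K) (s≤s z≤n))) ⟩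
        p ^ k ∎
        where
        open ≤-Reasoning
        lem : ∀ N u p → N * u + u * p * N ≡ N * (suc p * u)
        lem = ℕ-Solver.solve-∀
        lem₂ : ∀ K → K + K + K ≡ 3 * K
        lem₂ = ℕ-Solver.solve-∀

-- Prime powers of the modulus and the layers of an approximating formula

record PrimePower (m : ℕ) : Set where
  field
    p e q   : ℕ
    p-prime : Prime p
    q≡      : q ≡ p ^ e
    p≤m     : p ≤ m
    q≤m     : q ≤ m
    1<q     : 1 < q

open PrimePower using (q)

record FullPower (m p : ℕ) : Set where
  field
    power   : PrimePower m
    e       : ℕ
    q≡      : q power ≡ p ^ e
    q∣m     : q power ∣ m
    maximal : ¬ (p ^ suc e ∣ m)

open FullPower using (power)

-- The exponents are tried upwards; `m` steps are enough because `m < p ^ m`.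
maximal-power : ∀ m p → 0 < m → 1 < p → ∃ λ e → (p ^ e ∣ m) × ¬ (p ^ suc e ∣ m)
maximal-power m p m>0 p>1 = search m 0 (1∣ m) (λ h → <⇒≱ (m<p^m m) (∣⇒≤ ⦃ ℕ.>-nonZero m>0 ⦄ (∣-trans (∣-next m) h)))
  where
  ∣-next : ∀ k → p ^ k ∣ p ^ suc (k + 0)
  ∣-next k = subst (λ w → p ^ k ∣ p ^ suc w) (sym (+-identityʳ k)) (n∣m*n p)
  m<p^m : ∀ k → k < p ^ k
  m<p^m k = ≤-trans (n<2^n k) (^-monoˡ-≤ k p>1)
  search : ∀ fuel e → p ^ e ∣ m → ¬ (p ^ suc (fuel + e) ∣ m) → ∃ λ e → (p ^ e ∣ m) × ¬ (p ^ suc e ∣ m)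
  search zero       e h ¬h = e , h , ¬h
  search (suc fuel) e h ¬h with p ^ suc e ∣? m
  ... | yes h' = search fuel (suc e) h' (λ k → ¬h (subst (λ w → p ^ suc w ∣ m) (+-suc fuel e) k))
  ... | no ¬h' = e , h , ¬h'

full-power : ∀ {m} → 0 < m → ∀ p → Prime p → p ∣ m → FullPower m p
full-power {m} m>0 p pp p∣m with maximal-power m p m>0 (ℕ.nonTrivial⇒n>1 p ⦃ prime⇒nonTrivial pp ⦄)
... | zero  , _ , ¬h = ⊥-elim (¬h (subst (_∣ m) (sym (*-identityʳ p)) p∣m))
... | suc e , h , ¬h = record
  { power = record
    { p = p ; e = suc e ; q = p ^ suc e ; p-prime = pp ; q≡ = refl
    ; p≤m = ∣⇒≤ ⦃ ℕ.>-nonZero m>0 ⦄ p∣m ; q≤m = ∣⇒≤ ⦃ ℕ.>-nonZero m>0 ⦄ h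
    ; 1<q = ≤-trans (≤-trans (ℕ.nonTrivial⇒n>1 p ⦃ prime⇒nonTrivial pp ⦄) (≤-reflexive (sym (*-identityʳ p))))
              (*-monoʳ-≤ p (m^n>0 p ⦃ prime⇒nonZero pp ⦄ e)) }
  ; e = suc e ; q≡ = refl ; q∣m = h ; maximal = ¬h }

module _ {m : ℕ} (m>0 : 0 < m) where

  private
    ps : List ℕ
    ps = filter (λ p → prime? p ×-dec (p ∣? m)) (upTo (suc m))

    powers : ∀ {ps} → All (λ p → Prime p × p ∣ m) ps → List (PrimePower m)
    powers []                       = []
    powers {p ∷ _} ((pp , p∣m) ∷ h) = power (full-power m>0 p pp p∣m) ∷ powers h

    length-powers : ∀ {ps} (h : All (λ p → Prime p × p ∣ m) ps) → length (powers h) ≡ length ps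
    length-powers []      = refl
    length-powers (_ ∷ h) = cong suc (length-powers h)

    powers-∣ : ∀ {ps} (h : All (λ p → Prime p × p ∣ m) ps) → All (λ P → q P ∣ m) (powers h)
    powers-∣         []               = []
    powers-∣ {p ∷ _} ((pp , p∣m) ∷ h) = FullPower.q∣m (full-power m>0 p pp p∣m) ∷ powers-∣ h

    ∈-powers : ∀ {ps p} (h : All (λ p → Prime p × p ∣ m) ps) → p ∈ ps → Σ (FullPower m p) λ F → power F ∈ powers h
    ∈-powers {p ∷ _} ((pp , p∣m) ∷ h) (here refl) = full-power m>0 p pp p∣m , here refl
    ∈-powers         (_ ∷ h)          (there i) with ∈-powers h i
    ... | F , F∈ = F , there F∈

    ps-ok : All (λ p → Prime p × p ∣ m) ps
    ps-ok = All.all-filter (λ p → prime? p ×-dec (p ∣? m)) (upTo (suc m))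

  primePowers : List (PrimePower m)
  primePowers = powers ps-ok

  length-primePowers : length primePowers ≡ numPrimeFactors m
  length-primePowers = length-powers ps-ok

  -- Otherwise some prime p divides m / gcd(m , z), and p · pᵉ divides m for the full power pᵉ of p in m.
  primePowers-∣ : ∀ {z} → All (λ P → q P ∣ z) primePowers → m ∣ z
  primePowers-∣ {z} h with gcd[m,n]∣m m z
  ... | divides (suc zero) eq = subst (_∣ z) (sym (trans eq (*-identityˡ (gcd m z)))) (gcd[m,n]∣n m z)
  ... | divides zero eq = ⊥-elim (<⇒≢ m>0 (sym eq))
  ... | divides c@(suc (suc _)) eq = ⊥-elim (go (factors F) isFactorisation factorsPrime)
    where
    F = factorise c
    open PrimeFactorisation F using (isFactorisation; factorsPrime)
    go : ∀ L → c ≡ product L → ¬ All Prime L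
    go []      c≡ _ = <⇒≢ (s≤s (s≤s z≤n)) (sym c≡)
    go (p ∷ L) c≡ (pp ∷ _) = contra (∈-powers ps-ok p∈ps)
      where
      p∣c : p ∣ c
      p∣c = subst (p ∣_) (sym c≡) (m∣m*n (product L))
      p∣m : p ∣ m
      p∣m = subst (p ∣_) (sym eq) (∣m⇒∣m*n (gcd m z) p∣c)
      p∈ps : p ∈ ps
      p∈ps = ∈-filter⁺ (λ p → prime? p ×-dec (p ∣? m)) (∈-upTo⁺ (s≤s (∣⇒≤ ⦃ ℕ.>-nonZero m>0 ⦄ p∣m))) (pp , p∣m)
      contra : ¬ (Σ (FullPower m p) λ F → power F ∈ primePowers)
      contra (F , F∈) = maximal (subst (p ^ suc e ∣_) (sym eq)
          (*-pres-∣ p∣c (gcd-greatest (subst (_∣ m) q≡ q∣m) (subst (_∣ z) q≡ (All.lookup h F∈)))))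
        where open FullPower F

  primePowers∣m : All (λ P → q P ∣ m) primePowers
  primePowers∣m = powers-∣ ps-ok

allB-true : ∀ {A : Set} (f : A → Bool) L → All (λ a → f a ≡ true) L → allB (List.map f L) ≡ true
allB-true f []      []      = refl
allB-true f (a ∷ L) (h ∷ k) rewrite h = allB-true f L k

allB-elim : ∀ {A : Set} (f : A → Bool) L → allB (List.map f L) ≡ true → All (λ a → f a ≡ true) L
allB-elim f []      h = []
allB-elim f (a ∷ L) h with f a in eq
... | true = eq ∷ allB-elim f L h

does-true : ∀ {P : Set} (d : Dec P) → does d ≡ true → P
does-true (yes p) _ = p

-- The conjunction over the prime powers is what costs one layer for each prime divisor of `m`.
mod-split : ∀ {m} (m>0 : 0 < m) z →
  does (m ∣? z) ≡ allB (List.map (λ P → does (q P ∣? z)) (primePowers m>0))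
mod-split {m} m>0 z = go _ refl
  where
  f : PrimePower m → Bool
  f P = does (q P ∣? z)
  go : ∀ b → allB (List.map f (primePowers m>0)) ≡ b → does (m ∣? z) ≡ b
  go true  e = dec-true (m ∣? z) (primePowers-∣ m>0 (All.map (λ {P} → does-true (q P ∣? z)) (allB-elim f (primePowers m>0) e)))
  go false e = dec-false (m ∣? z) λ m∣z → true≢false (trans (sym (allB-true f (primePowers m>0)
      (All.map (λ {P} h → dec-true (q P ∣? z) (∣-trans h m∣z)) (primePowers∣m m>0)))) e)
    where
    true≢false : ¬ (true ≡ false)
    true≢false ()

-- Levels of an approximating formula as layers of prime power gates

module _ {A : Set} where

  count : (A → Bool) → List A → ℕ
  count v L = ∑ L (λ a → bit (v a))

  mon-allB : ∀ (v : A → Bool) M → mon v M ≡ bit (allB (List.map v M))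
  mon-allB v []      = refl
  mon-allB v (a ∷ M) with v a
  ... | true  = trans (+-identityʳ _) (mon-allB v M)
  ... | false = refl

module Levels (n s ℓ m : ℕ) where

  -- Here `or` stands for the approximation of an OR: it is true when some of its at most `ℓ`
  -- sublists has an odd number of true members.
  data ANode (A : Set) : Set where
    up  : A → ANode A
    mod : (L : List A) → length L ≤ s → ANode A
    or  : (Ls : List (List A)) → length Ls ≤ ℓ → All (λ L → length L ≤ s) Ls → ANode A

  anode : {A : Set} → (A → Bool) → ANode A → Bool
  anode v (up a)     = v a
  anode v (mod L _)  = does (m ∣? count v L)
  anode v (or Ls _ _) = not (allB (List.map (λ L → does (2 ∣? count v L)) Ls))

  AForm : ℕ → Set
  AForm zero    = Fin n
  AForm (suc δ) = ANode (AForm δ)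

  aval : ∀ δ → Vec Bool n → AForm δ → Bool
  aval zero    x i = lookup x i
  aval (suc δ) x   = anode (aval δ x)

  module _ (A : Set) where

    -- The values available between two levels: those of `A`, and its MOD_q gates for the prime
    -- powers listed. Adding one prime power is one layer, in which everything older is passed on.
    Atom : List (PrimePower m) → Set
    Atom []       = A
    Atom (q ∷ qs) = Atom qs ⊎ (Σ (List A) λ L → length L ≤ s)

    lift : ∀ qs → A → Atom qs
    lift []       a = a
    lift (q ∷ qs) a = inj₁ (lift qs a)

    atom : (A → Bool) → ∀ qs → Atom qs → Bool
    atom v []       a              = v a
    atom v (P ∷ qs) (inj₁ a)       = atom v qs a
    atom v (P ∷ qs) (inj₂ (L , _)) = does (q P ∣? count v L)

    atom-lift : ∀ v qs a → atom v qs (lift qs a) ≡ v a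
    atom-lift v []       a = refl
    atom-lift v (P ∷ qs) a = atom-lift v qs a

    mods : ∀ qs (L : List A) → length L ≤ s → List (Atom qs)
    mods []       L h = []
    mods (P ∷ qs) L h = inj₂ (L , h) ∷ List.map inj₁ (mods qs L h)

    length-mods : ∀ qs (L : List A) (h : length L ≤ s) → length (mods qs L h) ≡ length qs
    length-mods []       L h = refl
    length-mods (P ∷ qs) L h = cong suc (trans (length-map inj₁ (mods qs L h)) (length-mods qs L h))

    mon-map : ∀ {B D : Set} (v : D → Bool) (g : B → D) M → mon v (List.map g M) ≡ mon (λ b → v (g b)) M
    mon-map v g []      = refl
    mon-map v g (b ∷ M) = cong (bit (v (g b)) *_) (mon-map v g M)

    mon-mods : ∀ v qs (L : List A) (h : length L ≤ s) → mon (atom v qs) (mods qs L h) ≡ bit (allB (List.map (λ P → does (q P ∣? count v L)) qs))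
    mon-mods v []       L h = refl
    mon-mods v (P ∷ qs) L h = trans (cong (ι (q P) (count v L) *_)
        (trans (mon-map (atom v (P ∷ qs)) inj₁ (mods qs L h)) (mon-mods v qs L h))) (bit-∧ (does (q P ∣? count v L)) _)
      where
      bit-∧ : ∀ b c → bit b * bit c ≡ bit (b ∧ c)
      bit-∧ true  c = +-identityʳ (bit c)
      bit-∧ false c = refl

    singletons : ∀ qs → List A → Poly (Atom qs)
    singletons qs = List.map (λ a → lift qs a ∷ [])

    ev-singletons : ∀ v qs L → ev (atom v qs) (singletons qs L) ≡ count v L
    ev-singletons v qs L = trans (∑-map (λ a → lift qs a ∷ []) L _) (∑-cong L λ a →
      trans (*-identityʳ _) (cong bit (atom-lift v qs a)))

  module _ (2≤m : 2 ≤ m) (m≤s : m ≤ s) (1≤ℓ : 1 ≤ ℓ) where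

    atom-layer : ∀ {X A : Set} (val : X → A → Bool) P qs → Layer (λ x → atom A (val x) qs) (λ x → atom A (val x) (P ∷ qs)) m s ℓ
    atom-layer {X} {A} val P qs = record
      { e = e ; p-prime = p-prime ; q≡ = q≡ ; p≤m = p≤m ; q≤m = q≤m
      ; gate = gate ; gate-len = gate-len ; gate-deg = gate-deg ; gate-val = gate-val }
      where
      open PrimePower P hiding (q)
      gate : Atom A (P ∷ qs) → Poly (Atom A qs)
      -- Passing on a value through a MOD_q gate: 1 + (q - 1) a is q if a = 1, and 1 if a = 0.
      gate (inj₁ a)       = [] ∷ rep (q P ∸ 1) ((a ∷ []) ∷ [])
      gate (inj₂ (L , _)) = singletons A qs L
      gate-len : ∀ b → length (gate b) ≤ s
      gate-len (inj₁ a)       = ≤-trans (s≤s (≤-trans (length-glue (q P ∸ 1) (λ _ → (a ∷ []) ∷ []) 1 (λ _ _ → ≤-refl)) (≤-reflexive (*-identityʳ (q P ∸ 1)))))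
                                  (≤-trans (≤-reflexive (m+[n∸m]≡n (<⇒≤ 1<q))) (≤-trans q≤m m≤s))
      gate-len (inj₂ (L , h)) = subst (_≤ s) (sym (length-map (λ a → lift A qs a ∷ []) L)) h
      gate-deg : ∀ b → Deg≤ ℓ (gate b)
      gate-deg (inj₁ a)       = z≤n ∷ All-glue (q P ∸ 1) _ (λ _ _ → 1≤ℓ ∷ [])
      gate-deg (inj₂ (L , h)) = All.map⁺ (All.universal (λ _ → 1≤ℓ) L)
      gate-val : ∀ x b → bit (atom A (val x) (P ∷ qs) b) ≡ ι (q P) (ev (atom A (val x) qs) (gate b))
      gate-val x (inj₁ a) = trans (go (atom A (val x) qs a)) (cong (λ w → ι (q P) (1 + w)) (sym (∑-rep (q P ∸ 1) ((a ∷ []) ∷ []) (mon (atom A (val x) qs)))))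
        where
        go : ∀ b → bit b ≡ ι (q P) (1 + (q P ∸ 1) * (bit b * 1 + 0))
        go true  = sym (ι-yes {q P} (subst (q P ∣_) (sym (trans (cong suc (*-identityʳ (q P ∸ 1))) (m+[n∸m]≡n (<⇒≤ 1<q)))) ∣-refl))
        go false = sym (ι-no {q P} λ h → <⇒≱ 1<q (∣⇒≤ (subst (q P ∣_) (cong suc (*-zeroʳ (q P ∸ 1))) h)))
      gate-val x (inj₂ (L , h)) = cong (ι (q P)) (sym (ev-singletons A (val x) qs L))

    two : PrimePower m
    two = record { p = 2 ; e = 1 ; q = 2 ; p-prime = prime[2] ; q≡ = refl ; p≤m = 2≤m ; q≤m = 2≤m ; 1<q = ≤-refl }

    module _ (m>0 : 0 < m) (r≤ℓ : length (primePowers m>0) ≤ ℓ) where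

      moduli : List (PrimePower m)
      moduli = two ∷ primePowers m>0

      node-layer : ∀ {X A : Set} (val : X → A → Bool) → Layer (λ x → atom A (val x) moduli) (λ x → anode (val x)) m s ℓ
      node-layer {X} {A} val = record
        { p = 2 ; e = 1 ; q = 2 ; p-prime = prime[2] ; q≡ = refl ; p≤m = 2≤m ; q≤m = 2≤m
        ; gate = gate ; gate-len = gate-len ; gate-deg = gate-deg ; gate-val = gate-val }
        where
        qs = primePowers m>0
        parities : (Ls : List (List A)) → All (λ L → length L ≤ s) Ls → List (Atom A moduli)
        parities []       []       = []
        parities (L ∷ Ls) (h ∷ hs) = inj₂ (L , h) ∷ parities Ls hs
        gate : ANode A → Poly (Atom A moduli)
        -- Every node becomes a parity test of a product M of 0/1 values: 1 + M is even iff M = 1,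
        -- and for `or`, with M the conjunction of "even", M is even iff some parity is odd.
        gate (up a)      = [] ∷ (lift A moduli a ∷ []) ∷ []
        gate (mod L h)   = [] ∷ List.map inj₁ (mods A qs L h) ∷ []
        gate (or Ls _ h) = parities Ls h ∷ []
        gate-len : ∀ b → length (gate b) ≤ s
        gate-len (up a)     = ≤-trans 2≤m m≤s
        gate-len (mod L h)  = ≤-trans 2≤m m≤s
        gate-len (or Ls _ h) = ≤-trans (<⇒≤ 2≤m) m≤s
        length-parities : ∀ Ls hs → length (parities Ls hs) ≡ length Ls
        length-parities []       []       = refl
        length-parities (L ∷ Ls) (h ∷ hs) = cong suc (length-parities Ls hs)
        gate-deg : ∀ b → Deg≤ ℓ (gate b)
        gate-deg (up a)      = z≤n ∷ 1≤ℓ ∷ []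
        gate-deg (mod L h)   = z≤n ∷ subst (_≤ ℓ) (sym (trans (length-map inj₁ (mods A qs L h)) (length-mods A qs L h))) r≤ℓ ∷ []
        gate-deg (or Ls k h) = subst (_≤ ℓ) (sym (length-parities Ls h)) k ∷ []
        bit-odd : ∀ b → bit b ≡ ι 2 (1 + (bit b + 0))
        bit-odd true  = refl
        bit-odd false = refl
        bit-even : ∀ b → bit (not b) ≡ ι 2 (bit b + 0)
        bit-even true  = refl
        bit-even false = refl
        mon-parities : ∀ v Ls hs → mon (atom A v moduli) (parities Ls hs) ≡ bit (allB (List.map (λ L → does (2 ∣? count v L)) Ls))
        mon-parities v []       []       = refl
        mon-parities v (L ∷ Ls) (h ∷ hs) with does (2 ∣? count v L)
        ... | true  = trans (+-identityʳ _) (mon-parities v Ls hs)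
        ... | false = refl
        gate-val : ∀ x b → bit (anode (val x) b) ≡ ι 2 (ev (atom A (val x) moduli) (gate b))
        gate-val x (up a) = trans (bit-odd (val x a)) (cong (λ w → ι 2 (1 + (w + 0)))
          (sym (trans (*-identityʳ _) (cong bit (atom-lift A (val x) (primePowers m>0) a)))))
        gate-val x (mod L h) = trans (bit-odd (does (m ∣? count (val x) L))) (cong (λ w → ι 2 (1 + (w + 0)))
          (sym (trans (mon-map A (atom A (val x) moduli) inj₁ (mods A qs L h))
            (trans (mon-mods A (val x) qs L h) (cong bit (sym (mod-split m>0 (count (val x) L))))))))
        gate-val x (or Ls _ h) = trans (bit-even (allB (List.map (λ L → does (2 ∣? count (val x) L)) Ls)))
          (cong (λ w → ι 2 (w + 0)) (sym (mon-parities (val x) Ls h)))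

      module _ {σ} (1≤σ : 1 ≤ σ) (s≤ : suc s ≤ 2 ^ σ) where

        private
          G = growth m σ ℓ

        chain : ℕ → ℕ → ℕ
        chain zero    K = K
        chain (suc L) K = chain L (G * K)

        chain≡ : ∀ L K → chain L K ≡ G ^ L * K
        chain≡ zero    K = sym (+-identityʳ K)
        chain≡ (suc L) K = trans (chain≡ L (G * K)) (trans (sym (*-assoc (G ^ L) G K)) (cong (_* K) (*-comm (G ^ L) G)))

        chain-+ : ∀ L L' K → chain (L + L') K ≡ chain L' (chain L K)
        chain-+ zero    L' K = refl
        chain-+ (suc L) L' K = chain-+ L L' (G * K)

        K≤chain : ∀ L K → K ≤ chain L K
        K≤chain zero    K = ≤-refl
        K≤chain (suc L) K = ≤-trans (m≤m+n K _) (K≤chain L (G * K))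

        step : ∀ {X A B : Set} {val : X → A → Bool} {val' : X → B → Bool} {f K} →
          Layer val val' m s ℓ → 1 ≤ K → K ≤ 2 ^ σ → SymSum val' K f → SymSum val (G * K) f
        step {K = suc K₀} 𝓛 _ K≤ S = layer-step 𝓛 1≤σ s≤ (≤-trans m≤s (≤-trans (n≤1+n s) s≤)) K≤ S

        atoms-chain : ∀ {X A : Set} (val : X → A → Bool) qs {f K} → 1 ≤ K → chain (length qs) K ≤ 2 ^ σ →
          SymSum (λ x → atom A (val x) qs) K f → SymSum val (chain (length qs) K) f
        atoms-chain val []       1≤K h S = S
        atoms-chain val (P ∷ qs) {K = K} 1≤K h S = atoms-chain val qs (≤-trans 1≤K (m≤m+n K _)) h
          (step (atom-layer val P qs) 1≤K (≤-trans (K≤chain (suc (length qs)) K) h) S)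

        -- A level takes one layer for its nodes, one for the modulus 2 and one for each of the r
        -- prime powers. As `chain` never decreases `K`, bounding its final value by `2 ^ σ` serves
        -- every step.
        levels-chain : ∀ δ {f K} → 1 ≤ K → chain (δ * suc (length moduli)) K ≤ 2 ^ σ →
          SymSum (aval δ) K f → SymSum (aval 0) (chain (δ * suc (length moduli)) K) f
        levels-chain zero    1≤K h S = S
        levels-chain (suc δ) {f} {K} 1≤K h S = subst (λ w → SymSum (aval 0) w f) (sym e)
            (levels-chain δ (≤-trans 1≤K (K≤chain (suc (length moduli)) K)) (subst (_≤ 2 ^ σ) e h)
              (atoms-chain (aval δ) moduli (≤-trans 1≤K (m≤m+n K _))
                (≤-trans (K≤chain (δ * suc (length moduli)) _) (subst (_≤ 2 ^ σ) e h))
                (step (node-layer (aval δ)) 1≤K (≤-trans (K≤chain (suc δ * suc (length moduli)) K) h) S)))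
          where
          e = chain-+ (suc (length moduli)) (δ * suc (length moduli)) K

symSum⇒symAnd : ∀ {n K f} → SymSum (λ (x : Vec Bool n) (i : Fin n) → lookup x i) K f →
  Σ (SymAnd n) λ S → symAndSize S ≤ 2 ^ K × (∀ x → evalSymAnd S x ≡ f x)
symSum⇒symAnd {n} S = record { terms = terms ; sym = dec } ,
  subst (_≤ _) (sym (length-map (List.map (λ i → i , true)) poly)) len ,
  λ x → trans (cong dec (value x poly)) (correct x)
  where
  open SymSum S
  terms = List.map (List.map (λ i → i , true)) poly
  allB-lits : ∀ x M → allB (List.map (λ l → evalLit l x) (List.map (λ i → i , true) M)) ≡ allB (List.map (lookup x) M)
  allB-lits x []      = refl
  allB-lits x (i ∷ M) = cong (lookup x i ∧_) (allB-lits x M)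
  value : ∀ (x : Vec Bool n) P → ones (List.map (λ t → allB (List.map (λ l → evalLit l x) t)) (List.map (List.map (λ i → i , true)) P))
    ≡ ev (lookup x) P
  value x []      = refl
  value x (M ∷ P) rewrite allB-lits x M | mon-allB (lookup x) M with allB (List.map (lookup x) M)
  ... | true  = cong suc (value x P)
  ... | false = value x P

-- Approximation by parities

∑ˣ : ∀ {n} → (Vec Bool n → ℕ) → ℕ
∑ˣ {zero}  f = f []
∑ˣ {suc n} f = ∑ˣ (λ x → f (true ∷ x)) + ∑ˣ (λ x → f (false ∷ x))

∑ˣ-mono : ∀ {n} {f g : Vec Bool n → ℕ} → (∀ x → f x ≤ g x) → ∑ˣ f ≤ ∑ˣ g
∑ˣ-mono {zero}  h = h []
∑ˣ-mono {suc n} h = +-mono-≤ (∑ˣ-mono λ x → h (true ∷ x)) (∑ˣ-mono λ x → h (false ∷ x))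

∑ˣ-cong : ∀ {n} {f g : Vec Bool n → ℕ} → (∀ x → f x ≡ g x) → ∑ˣ f ≡ ∑ˣ g
∑ˣ-cong {zero}  h = h []
∑ˣ-cong {suc n} h = cong₂ _+_ (∑ˣ-cong λ x → h (true ∷ x)) (∑ˣ-cong λ x → h (false ∷ x))

∑ˣ-+ : ∀ {n} (f g : Vec Bool n → ℕ) → ∑ˣ (λ x → f x + g x) ≡ ∑ˣ f + ∑ˣ g
∑ˣ-+ {zero}  f g = refl
∑ˣ-+ {suc n} f g = trans (cong₂ _+_ (∑ˣ-+ (λ x → f (true ∷ x)) (λ x → g (true ∷ x))) (∑ˣ-+ (λ x → f (false ∷ x)) (λ x → g (false ∷ x))))
  (l (∑ˣ λ x → f (true ∷ x)) (∑ˣ λ x → g (true ∷ x)) (∑ˣ λ x → f (false ∷ x)) (∑ˣ λ x → g (false ∷ x)))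
  where
  l : ∀ a b c d → a + b + (c + d) ≡ a + c + (b + d)
  l = ℕ-Solver.solve-∀

∑ˣ-*ˡ : ∀ {n} c (f : Vec Bool n → ℕ) → ∑ˣ (λ x → c * f x) ≡ c * ∑ˣ f
∑ˣ-*ˡ {zero}  c f = refl
∑ˣ-*ˡ {suc n} c f = trans (cong₂ _+_ (∑ˣ-*ˡ c (λ x → f (true ∷ x))) (∑ˣ-*ˡ c (λ x → f (false ∷ x)))) (sym (*-distribˡ-+ c _ _))

∑ˣ-weighted-+ : ∀ {n} (u f g : Vec Bool n → ℕ) →
  ∑ˣ (λ x → u x * (f x + g x)) ≡ ∑ˣ (λ x → u x * f x) + ∑ˣ (λ x → u x * g x)
∑ˣ-weighted-+ u f g = trans (∑ˣ-cong (λ x → *-distribˡ-+ (u x) (f x) (g x))) (∑ˣ-+ (λ x → u x * f x) (λ x → u x * g x))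

∑ˣ-≥ : ∀ {n} (f : Vec Bool n → ℕ) x → f x ≤ ∑ˣ f
∑ˣ-≥ f []          = ≤-refl
∑ˣ-≥ f (true ∷ x)  = ≤-trans (∑ˣ-≥ (λ x → f (true ∷ x)) x) (m≤m+n _ _)
∑ˣ-≥ f (false ∷ x) = ≤-trans (∑ˣ-≥ (λ x → f (false ∷ x)) x) (m≤n+m _ _)

∑ˣ-1 : ∀ n → ∑ˣ {n} (λ _ → 1) ≡ 2 ^ n
∑ˣ-1 zero    = refl
∑ˣ-1 (suc n) = cong₂ _+_ (∑ˣ-1 n) (trans (∑ˣ-1 n) (sym (+-identityʳ (2 ^ n))))

^-distribʳ-* : ∀ k a b → (a * b) ^ k ≡ a ^ k * b ^ k
^-distribʳ-* zero    a b = refl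
^-distribʳ-* (suc k) a b = trans (cong (a * b *_) (^-distribʳ-* k a b)) (l a b (a ^ k) (b ^ k))
  where
  l : ∀ a b c d → a * b * (c * d) ≡ a * c * (b * d)
  l = ℕ-Solver.solve-∀

odd : {I : Set} → (I → Bool) → List I → Bool
odd v []      = false
odd v (i ∷ L) = v i xor odd v L

even-suc : ∀ c → does (2 ∣? suc c) ≡ not (does (2 ∣? c))
even-suc zero    = refl
even-suc (suc c) = trans (does-⇔ (mk⇔ (λ h → ∣m+n∣m⇒∣n h ∣-refl) (∣m∣n⇒∣m+n ∣-refl)) (2 ∣? suc (suc c)) (2 ∣? c))
  (trans (sym (not-involutive _)) (cong not (sym (even-suc c))))

even-odd : ∀ {I : Set} (v : I → Bool) L → does (2 ∣? count v L) ≡ not (odd v L)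
even-odd v []      = refl
even-odd v (i ∷ L) with v i
... | true  = trans (even-suc (count v L)) (cong not (even-odd v L))
... | false = even-odd v L

module _ {n : ℕ} {I : Set} (v : Vec Bool n → I → Bool) where

  any : List I → Vec Bool n → Bool
  any L x = anyB (List.map (v x) L)

  -- The conditional expectation of α [S even] + β [S odd] over a random sublist S of L is
  -- (α + β)/2 as long as some remaining element is true, and α otherwise; the elements of S are
  -- decided one at a time without increasing its total weight.
  select : ∀ L (α β : Vec Bool n → ℕ) → Σ (List I) λ S → S ⊆ L ×
    2 * ∑ˣ (λ x → if odd (v x) S then β x else α x) ≤ ∑ˣ (λ x → if any L x then α x + β x else 2 * α x)
  select []      α β = [] , [] , ≤-reflexive (sym (∑ˣ-*ˡ 2 α))
  select (i ∷ L) α β with select L α β | select L (λ x → if v x i then β x else α x) (λ x → if v x i then α x else β x)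
  ... | S , S⊆L , h | S' , S'⊆L , h' = pick (≤-total B₀ target)
    where
    f₀ f₁ f : Vec Bool n → ℕ
    f₀ x = if any L x then α x + β x else 2 * α x
    f₁ x = if any L x then (if v x i then β x else α x) + (if v x i then α x else β x) else 2 * (if v x i then β x else α x)
    f  x = if any (i ∷ L) x then α x + β x else 2 * α x
    B₀ = ∑ˣ f₀
    B₁ = ∑ˣ f₁
    target = ∑ˣ f
    average : B₀ + B₁ ≡ target + target
    average = trans (sym (∑ˣ-+ f₀ f₁)) (trans (∑ˣ-cong pointwise) (∑ˣ-+ f f))
      where
      pointwise : ∀ x → f₀ x + f₁ x ≡ f x + f x
      pointwise x with v x i | any L x
      ... | true  | true  = cong (α x + β x +_) (+-comm (β x) (α x))
      ... | true  | false = lem (α x) (β x)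
        where
        lem : ∀ a b → 2 * a + 2 * b ≡ a + b + (a + b)
        lem = ℕ-Solver.solve-∀
      ... | false | true  = refl
      ... | false | false = refl
    flip : ∀ x → (if odd (v x) (i ∷ S') then β x else α x) ≡ (if odd (v x) S' then (if v x i then α x else β x) else (if v x i then β x else α x))
    flip x with v x i | odd (v x) S'
    ... | true  | true  = refl
    ... | true  | false = refl
    ... | false | true  = refl
    ... | false | false = refl
    pick : B₀ ≤ target ⊎ target ≤ B₀ → _
    pick (inj₁ le) = S , i ∷ˢ S⊆L , ≤-trans h le
    pick (inj₂ ge) = i ∷ S' , refl ∷ S'⊆L , ≤-trans (≤-reflexive (cong (2 *_) (∑ˣ-cong flip)))
      (≤-trans h' (+-cancelˡ-≤ B₀ B₁ target (≤-trans (≤-reflexive average) (+-monoˡ-≤ target ge))))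

  missed : List I → List (List I) → Vec Bool n → Bool
  missed L Ss x = any L x ∧ allB (List.map (λ S → not (odd (v x) S)) Ss)

  -- Each sublist is selected against the weight of the inputs on which the OR holds and all earlier
  -- parities are even, and at least halves it. Inputs on which the OR fails are never misjudged.
  parities : ∀ L ℓ (u : Vec Bool n → ℕ) → Σ (List (List I)) λ Ss → length Ss ≤ ℓ × All (_⊆ L) Ss ×
    2 ^ ℓ * ∑ˣ (λ x → u x * bit (missed L Ss x)) ≤ ∑ˣ (λ x → u x * bit (any L x))
  parities L zero u = [] , z≤n , [] , ≤-trans (≤-reflexive (+-identityʳ _)) (∑ˣ-mono λ x → ≤-reflexive (cong (λ b → u x * bit b) (∧-identityʳ (any L x))))
  parities L (suc ℓ) u with select L (λ x → u x * bit (any L x)) (λ _ → 0)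
  ... | S , S⊆L , h with parities L ℓ (λ x → if odd (v x) S then 0 else u x)
  ...   | Ss , len , Ss⊆L , h' = S ∷ Ss , s≤s len , S⊆L ∷ Ss⊆L , (begin
    2 * 2 ^ ℓ * ∑ˣ (λ x → u x * bit (missed L (S ∷ Ss) x))  ≡⟨ cong (2 * 2 ^ ℓ *_) (∑ˣ-cong restrict) ⟩
    2 * 2 ^ ℓ * ∑ˣ (λ x → u' x * bit (missed L Ss x))       ≡⟨ *-assoc 2 (2 ^ ℓ) _ ⟩
    2 * (2 ^ ℓ * ∑ˣ (λ x → u' x * bit (missed L Ss x)))     ≤⟨ *-monoʳ-≤ 2 h' ⟩
    2 * ∑ˣ (λ x → u' x * bit (any L x))                     ≡⟨ cong (2 *_) (∑ˣ-cong move) ⟩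
    2 * ∑ˣ (λ x → if odd (v x) S then 0 else u x * bit (any L x)) ≤⟨ h ⟩
    ∑ˣ (λ x → if any L x then u x * bit (any L x) + 0 else 2 * (u x * bit (any L x))) ≡⟨ ∑ˣ-cong simplify ⟩
    ∑ˣ (λ x → u x * bit (any L x)) ∎)
    where
    open ≤-Reasoning
    u' : Vec Bool n → ℕ
    u' x = if odd (v x) S then 0 else u x
    restrict : ∀ x → u x * bit (missed L (S ∷ Ss) x) ≡ u' x * bit (missed L Ss x)
    restrict x with any L x | odd (v x) S
    ... | true  | true  = *-zeroʳ (u x)
    ... | true  | false = refl
    ... | false | true  = *-zeroʳ (u x)
    ... | false | false = refl
    move : ∀ x → u' x * bit (any L x) ≡ (if odd (v x) S then 0 else u x * bit (any L x))
    move x with odd (v x) S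
    ... | true  = refl
    ... | false = refl
    simplify : ∀ x → (if any L x then u x * bit (any L x) + 0 else 2 * (u x * bit (any L x))) ≡ u x * bit (any L x)
    simplify x with any L x
    ... | true  = +-identityʳ _
    ... | false = trans (cong (2 *_) (*-zeroʳ (u x))) (sym (*-zeroʳ (u x)))

xor-≡ : ∀ {b c} → bit (b xor c) ≡ 0 → b ≡ c
xor-≡ {true}  {true}  _ = refl
xor-≡ {false} {false} _ = refl

bit≤1 : ∀ b → bit b ≤ 1
bit≤1 true  = ≤-refl
bit≤1 false = z≤n

-- Approximating formulas and boosting to an exact majority

module Formulas (n s ℓ m : ℕ) where

  open Levels n s ℓ m

  data Node (A : Set) : Set where
    up  : A → Node A
    mod : (L : List A) → length L ≤ s → Node A
    or  : (L : List A) → length L ≤ s → Node A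

  node : {A : Set} → (A → Bool) → Node A → Bool
  node v (up a)    = v a
  node v (mod L _) = does (m ∣? count v L)
  node v (or L _)  = anyB (List.map v L)

  Form : ℕ → Set
  Form zero    = Fin n
  Form (suc δ) = Node (Form δ)

  val : ∀ δ → Vec Bool n → Form δ → Bool
  val zero    x i = lookup x i
  val (suc δ) x   = node (val δ x)

  nodes : ℕ → ℕ
  nodes zero    = 1
  nodes (suc δ) = suc (suc s * nodes δ)

  nodes>0 : ∀ δ → 0 < nodes δ
  nodes>0 zero    = s≤s z≤n
  nodes>0 (suc δ) = s≤s z≤n

  wrong : ∀ δ → Form δ → AForm δ → Vec Bool n → ℕ
  wrong δ t a x = bit (val δ x t xor aval δ x a)

  -- The weighting `u` is arbitrary because boosting calls for an approximation that is good under
  -- weights concentrated on earlier errors.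
  Approximable : ∀ δ → Form δ → Set
  Approximable δ t = ∀ u → Σ (AForm δ) λ a → 2 ^ ℓ * ∑ˣ (λ x → u x * wrong δ t a x) ≤ nodes δ * ∑ˣ u

  private
    Pairs : ℕ → Set
    Pairs δ = List (Form δ × AForm δ)

  mismatch : ∀ δ → Pairs δ → Vec Bool n → ℕ
  mismatch δ Ps x = ∑ Ps (λ P → wrong δ (proj₁ P) (proj₂ P) x)

  match : ∀ δ Ps x → mismatch δ Ps x ≡ 0 → All (λ P → val δ x (proj₁ P) ≡ aval δ x (proj₂ P)) Ps
  match δ []       x e = []
  match δ (P ∷ Ps) x e = xor-≡ (m+n≡0⇒m≡0 _ e) ∷ match δ Ps x (m+n≡0⇒n≡0 (wrong δ (proj₁ P) (proj₂ P) x) e)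

  children : ∀ δ → (∀ t → Approximable δ t) → ∀ (L : List (Form δ)) u →
    Σ (Pairs δ) λ Ps → List.map proj₁ Ps ≡ L × 2 ^ ℓ * ∑ˣ (λ x → u x * mismatch δ Ps x) ≤ length L * (nodes δ * ∑ˣ u)
  children δ app []      u = [] , refl , ≤-reflexive (trans (cong (2 ^ ℓ *_) (trans (∑ˣ-cong {f = λ x → u x * 0} (λ x → *-zeroʳ (u x))) (∑ˣ-*ˡ {n} 0 u))) (*-zeroʳ (2 ^ ℓ)))
  children δ app (t ∷ L) u with app t u | children δ app L u
  ... | a , h | Ps , refl , h' = (t , a) ∷ Ps , refl , (begin
    2 ^ ℓ * ∑ˣ (λ x → u x * (wrong δ t a x + mismatch δ Ps x))
      ≡⟨ cong (2 ^ ℓ *_) (∑ˣ-weighted-+ u (wrong δ t a) (mismatch δ Ps)) ⟩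
    2 ^ ℓ * (∑ˣ (λ x → u x * wrong δ t a x) + ∑ˣ (λ x → u x * mismatch δ Ps x))
      ≡⟨ *-distribˡ-+ (2 ^ ℓ) _ _ ⟩
    2 ^ ℓ * ∑ˣ (λ x → u x * wrong δ t a x) + 2 ^ ℓ * ∑ˣ (λ x → u x * mismatch δ Ps x) ≤⟨ +-mono-≤ h h' ⟩
    nodes δ * ∑ˣ u + length (List.map proj₁ Ps) * (nodes δ * ∑ˣ u) ∎)
    where open ≤-Reasoning

  count-match : ∀ {δ x} (Ps : Pairs δ) → All (λ P → val δ x (proj₁ P) ≡ aval δ x (proj₂ P)) Ps →
    count (val δ x) (List.map proj₁ Ps) ≡ count (aval δ x) (List.map proj₂ Ps)
  count-match []       []       = refl
  count-match (P ∷ Ps) (h ∷ hs) = cong₂ _+_ (cong bit h) (count-match Ps hs)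

  private
    -- The union bound: a node errs only where a child errs (`mis`) or where its own replacement
    -- does (`own`).
    bound : ∀ δ {N} (u w own mis : Vec Bool n → ℕ) → N ≤ s → (∀ x → w x ≤ 1) → (∀ x → mis x ≡ 0 → w x ≤ own x) →
      2 ^ ℓ * ∑ˣ (λ x → u x * mis x) ≤ N * (nodes δ * ∑ˣ u) → 2 ^ ℓ * ∑ˣ (λ x → u x * own x) ≤ ∑ˣ u →
      2 ^ ℓ * ∑ˣ (λ x → u x * w x) ≤ nodes (suc δ) * ∑ˣ u
    bound δ {N} u w own mis N≤s w≤1 w≤own hm ho = begin
      2 ^ ℓ * ∑ˣ (λ x → u x * w x)                    ≤⟨ *-monoʳ-≤ (2 ^ ℓ) (∑ˣ-mono (λ x → *-monoʳ-≤ (u x) (cases x (mis x) refl))) ⟩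
      2 ^ ℓ * ∑ˣ (λ x → u x * (own x + mis x))        ≡⟨ cong (2 ^ ℓ *_) (∑ˣ-weighted-+ u own mis) ⟩
      2 ^ ℓ * (∑ˣ (λ x → u x * own x) + ∑ˣ (λ x → u x * mis x)) ≡⟨ *-distribˡ-+ (2 ^ ℓ) _ _ ⟩
      2 ^ ℓ * ∑ˣ (λ x → u x * own x) + 2 ^ ℓ * ∑ˣ (λ x → u x * mis x) ≤⟨ +-mono-≤ ho hm ⟩
      ∑ˣ u + N * (nodes δ * ∑ˣ u)                     ≤⟨ +-monoʳ-≤ (∑ˣ u) (*-monoˡ-≤ (nodes δ * ∑ˣ u) (≤-trans N≤s (n≤1+n s))) ⟩
      ∑ˣ u + suc s * (nodes δ * ∑ˣ u)                 ≡⟨ cong (∑ˣ u +_) (sym (*-assoc (suc s) (nodes δ) (∑ˣ u))) ⟩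
      nodes (suc δ) * ∑ˣ u ∎
      where
      open ≤-Reasoning
      cases : ∀ x k → mis x ≡ k → w x ≤ own x + mis x
      cases x zero    e = ≤-trans (w≤own x e) (m≤m+n _ _)
      cases x (suc k) e = ≤-trans (w≤1 x) (≤-trans (≤-trans (s≤s z≤n) (≤-reflexive (sym e))) (m≤n+m _ _))

    no-own : ∀ (u : Vec Bool n → ℕ) → 2 ^ ℓ * ∑ˣ (λ x → u x * 0) ≤ ∑ˣ u
    no-own u = ≤-trans (≤-reflexive (trans (cong (2 ^ ℓ *_) (trans (∑ˣ-cong {f = λ x → u x * 0} (λ x → *-zeroʳ (u x))) (∑ˣ-*ˡ {n} 0 u))) (*-zeroʳ (2 ^ ℓ)))) z≤n

  approximable : ∀ δ t → Approximable δ t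
  approximable zero i u = i , ≤-trans (≤-reflexive (cong (2 ^ ℓ *_)
    (∑ˣ-cong (λ x → cong (λ b → u x * bit b) (xor-same (lookup x i)))))) (≤-trans (no-own u) (≤-reflexive (sym (+-identityʳ _))))
  approximable (suc δ) (up t) u with approximable δ t u
  ... | a , h = up a , ≤-trans h (*-monoˡ-≤ (∑ˣ u) (≤-trans (m≤m+n (nodes δ) (s * nodes δ)) (n≤1+n _)))
  approximable (suc δ) (mod L L≤) u with children δ (approximable δ) L u
  ... | Ps , refl , h = a ,
    bound δ u (wrong (suc δ) (mod (List.map proj₁ Ps) L≤) a) (λ _ → 0) (mismatch δ Ps) L≤ (λ x → bit≤1 _) exact h (no-own u)
    where
    a = mod (List.map proj₂ Ps) (subst (_≤ s) (trans (length-map proj₁ Ps) (sym (length-map proj₂ Ps))) L≤)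
    exact : ∀ x → mismatch δ Ps x ≡ 0 → wrong (suc δ) (mod (List.map proj₁ Ps) L≤) a x ≤ 0
    exact x e rewrite count-match {δ} {x} Ps (match δ Ps x e) =
      ≤-reflexive (cong bit (xor-same (does (m ∣? count (aval δ x) (List.map proj₂ Ps)))))
  approximable (suc δ) (or L L≤) u with children δ (approximable δ) L u
  -- The sublists are chosen for the exact values of the children, but out of pairs, so that each
  -- can be reread with the approximations; where no child errs the parities agree.
  ... | Ps , refl , h with parities (λ x (P : Form δ × AForm δ) → val δ x (proj₁ P)) Ps ℓ u
  ...   | Ss , len , Ss⊆ , h' = a ,
    bound δ u (wrong (suc δ) (or (List.map proj₁ Ps) L≤) a) (λ x → bit (missed v Ps Ss x)) (mismatch δ Ps) L≤ (λ x → bit≤1 _) exact h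
      (≤-trans h' (∑ˣ-mono λ x → ≤-trans (*-monoʳ-≤ (u x) (bit≤1 _)) (≤-reflexive (*-identityʳ (u x)))))
    where
    v : Vec Bool n → Form δ × AForm δ → Bool
    v x P = val δ x (proj₁ P)
    short : All (λ S → length S ≤ s) (List.map (List.map proj₂) Ss)
    short = All.map⁺ (All.map (λ {S} S⊆ → ≤-trans (≤-reflexive (length-map proj₂ S))
      (≤-trans (length-mono-≤ S⊆) (subst (_≤ s) (length-map proj₁ Ps) L≤))) Ss⊆)
    a = or (List.map (List.map proj₂) Ss) (subst (_≤ ℓ) (sym (length-map (List.map proj₂) Ss)) len) short
    or-val : ∀ x → mismatch δ Ps x ≡ 0 → aval (suc δ) x a ≡ not (allB (List.map (λ S → not (odd (v x) S)) Ss))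
    or-val x e = cong (λ bs → not (allB bs)) (trans (sym (map-∘ Ss)) (map-cong-local (All.map (λ {S} S⊆ →
        trans (cong (λ c → does (2 ∣? c)) (sym (trans (sym (∑-map proj₁ S _)) (count-match {δ} {x} S (All-resp-⊆ S⊆ (match δ Ps x e))))))
          (even-odd (v x) S)) Ss⊆)))
    any-map : ∀ x → node (val δ x) (or (List.map proj₁ Ps) L≤) ≡ any v Ps x
    any-map x = cong anyB (sym (map-∘ Ps))
    -- If every listed element is false, all the parities are even and the approximation is exact.
    none : ∀ x (Qs : Pairs δ) → anyB (List.map (v x) Qs) ≡ false → All (λ P → v x P ≡ false) Qs
    none x []       e = []
    none x (Q ∷ Qs) e with v x Q in eq
    ... | false = eq ∷ none x Qs e
    odd-none : ∀ x (S : Pairs δ) → All (λ P → v x P ≡ false) S → odd (v x) S ≡ false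
    odd-none x []      []       = refl
    odd-none x (Q ∷ S) (k ∷ ks) rewrite k = odd-none x S ks
    exact : ∀ x → mismatch δ Ps x ≡ 0 → wrong (suc δ) (or (List.map proj₁ Ps) L≤) a x ≤ bit (missed v Ps Ss x)
    exact x e rewrite or-val x e | any-map x with any v Ps x in eq
    ... | true  = ≤-reflexive (cong bit (not-involutive _))
    ... | false = ≤-reflexive (cong (λ b → bit (not b)) (allB-true (λ S → not (odd (v x) S)) Ss
        (All.map (λ {S} S⊆ → cong not (odd-none x S (All-resp-⊆ S⊆ (none x Ps eq)))) Ss⊆)))

  wrongs : ∀ δ → Form δ → List (AForm δ) → Vec Bool n → ℕ
  wrongs δ t as x = ∑ as (λ a → wrong δ t a x)

  module _ {δ : ℕ} (t : Form δ) (accurate : 8 * nodes δ ≤ 2 ^ ℓ) where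

    -- Boosting: an input's weight doubles whenever an approximation errs on it.
    boost : ∀ j → Σ (List (AForm δ)) λ as → length as ≡ j × 8 ^ j * ∑ˣ (λ x → 2 ^ wrongs δ t as x) ≤ 9 ^ j * 2 ^ n
    boost zero    = [] , refl , ≤-reflexive (cong (_+ 0) (∑ˣ-1 n))
    boost (suc j) with boost j
    ... | as , len , h with approximable δ t (λ x → 2 ^ wrongs δ t as x)
    ...   | a , h' = a ∷ as , cong suc len , (begin
      8 * 8 ^ j * ∑ˣ (λ x → 2 ^ (wrong δ t a x + wrongs δ t as x)) ≡⟨ cong (8 * 8 ^ j *_) (trans (∑ˣ-cong double) (∑ˣ-+ u (λ x → u x * wrong δ t a x))) ⟩
      8 * 8 ^ j * (Φ + E)   ≡⟨ lem (8 ^ j) Φ E ⟩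
      8 ^ j * (8 * Φ + 8 * E) ≤⟨ *-monoʳ-≤ (8 ^ j) (+-monoʳ-≤ (8 * Φ) 8E≤Φ) ⟩
      8 ^ j * (8 * Φ + Φ)     ≡⟨ lem₂ (8 ^ j) Φ ⟩
      9 * (8 ^ j * Φ)         ≤⟨ *-monoʳ-≤ 9 h ⟩
      9 * (9 ^ j * 2 ^ n)     ≡⟨ sym (*-assoc 9 (9 ^ j) (2 ^ n)) ⟩
      9 * 9 ^ j * 2 ^ n ∎)
      where
      open ≤-Reasoning
      u : Vec Bool n → ℕ
      u x = 2 ^ wrongs δ t as x
      Φ = ∑ˣ u
      E = ∑ˣ (λ x → u x * wrong δ t a x)
      double : ∀ x → 2 ^ (wrong δ t a x + wrongs δ t as x) ≡ u x + u x * wrong δ t a x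
      double x with val δ x t xor aval δ x a
      ... | true  = cong (u x +_) (trans (+-identityʳ (u x)) (sym (*-identityʳ (u x))))
      ... | false = sym (trans (cong (u x +_) (*-zeroʳ (u x))) (+-identityʳ (u x)))
      -- At most one eighth of the weight is misjudged, so doubling it raises the total by a factor
      -- of at most 9/8.
      8E≤Φ : 8 * E ≤ Φ
      8E≤Φ = *-cancelˡ-≤ (nodes δ) ⦃ ℕ.>-nonZero (nodes>0 δ) ⦄ (≤-trans (≤-reflexive (lem₃ (nodes δ) E)) (≤-trans (*-monoˡ-≤ E accurate) h'))
        where
        lem₃ : ∀ a b → a * (8 * b) ≡ 8 * a * b
        lem₃ = ℕ-Solver.solve-∀
      lem : ∀ a b c → 8 * a * (b + c) ≡ a * (8 * b + 8 * c)
      lem = ℕ-Solver.solve-∀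
      lem₂ : ∀ a b → a * (8 * b + b) ≡ 9 * (a * b)
      lem₂ = ℕ-Solver.solve-∀

    private
      -- By 9⁴ ≤ 2 · 8⁴, the total weight after `T` rounds is at most 2^(n+1) · 2^n. So an input is
      -- misjudged at most 2n + 1 times, which is less than T/2 = 2n + 2.
      T = 4 * suc n
      as = proj₁ (boost T)

      few-wrong : ∀ x → 2 * wrongs δ t as x < T
      few-wrong x = ≤-trans (s≤s (*-monoʳ-≤ 2 w≤)) (≤-trans (m≤m+n _ 1) (≤-reflexive (lem n)))
        where
        w = wrongs δ t as x
        lem : ∀ n → suc (2 * (suc n + n)) + 1 ≡ 4 * suc n
        lem = ℕ-Solver.solve-∀
        2^w≤ : 2 ^ w ≤ 2 ^ (suc n + n)
        2^w≤ = *-cancelˡ-≤ (8 ^ T) ⦃ m^n≢0 8 T ⦄ (begin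
          8 ^ T * 2 ^ w           ≤⟨ *-monoʳ-≤ (8 ^ T) (∑ˣ-≥ (λ x → 2 ^ wrongs δ t as x) x) ⟩
          8 ^ T * ∑ˣ (λ x → 2 ^ wrongs δ t as x) ≤⟨ proj₂ (proj₂ (boost T)) ⟩
          9 ^ T * 2 ^ n           ≡⟨ cong (_* 2 ^ n) (sym (^-*-assoc 9 4 (suc n))) ⟩
          (9 ^ 4) ^ suc n * 2 ^ n ≤⟨ *-monoˡ-≤ (2 ^ n) (^-monoˡ-≤ (suc n) (toWitness {a? = 9 ^ 4 ≤? 2 * 8 ^ 4} _)) ⟩
          (2 * 8 ^ 4) ^ suc n * 2 ^ n ≡⟨ cong (_* 2 ^ n) (^-distribʳ-* (suc n) 2 (8 ^ 4)) ⟩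
          2 ^ suc n * (8 ^ 4) ^ suc n * 2 ^ n ≡⟨ cong (λ z → 2 ^ suc n * z * 2 ^ n) (^-*-assoc 8 4 (suc n)) ⟩
          2 ^ suc n * 8 ^ T * 2 ^ n ≡⟨ lem₁ (2 ^ suc n) (8 ^ T) (2 ^ n) ⟩
          8 ^ T * (2 ^ suc n * 2 ^ n) ≡⟨ cong (8 ^ T *_) (sym (^-distribˡ-+-* 2 (suc n) n)) ⟩
          8 ^ T * 2 ^ (suc n + n) ∎)
          where
          open ≤-Reasoning
          lem₁ : ∀ a b c → a * b * c ≡ b * (a * c)
          lem₁ = ℕ-Solver.solve-∀
        w≤ : w ≤ suc n + n
        w≤ = ≮⇒≥ λ lt → <⇒≱ (^-monoʳ-< 2 ≤-refl lt) 2^w≤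

    majority-symSum : ∀ {K} → 1 ≤ K → T ≤ 2 ^ K → SymSum (aval δ) K (λ x → val δ x t)
    majority-symSum {K} 1≤K T≤ = record
      { poly    = List.map (λ a → a ∷ []) as
      ; deg     = All.map⁺ (All.universal (λ _ → 1≤K) as)
      ; len     = ≤-trans (≤-reflexive (trans (length-map (λ a → a ∷ []) as) (proj₁ (proj₂ (boost T))))) T≤
      ; dec     = λ z → does (T <? 2 * z)
      ; correct = correct
      }
      where
      value : ∀ x → ev (aval δ x) (List.map (λ a → a ∷ []) as) ≡ count (aval δ x) as
      value x = trans (∑-map (λ a → a ∷ []) as _) (∑-cong as (λ a → *-identityʳ _))
      right : ∀ x (L : List (AForm δ)) → val δ x t ≡ true → count (aval δ x) L + wrongs δ t L x ≡ length L
      right x []      e = refl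
      right x (a ∷ L) e with right x L e
      ... | ih rewrite e with aval δ x a
      ...   | true  = cong suc ih
      ...   | false = trans (+-suc _ _) (cong suc ih)
      none-right : ∀ x (L : List (AForm δ)) → val δ x t ≡ false → count (aval δ x) L ≡ wrongs δ t L x
      none-right x []      e = refl
      none-right x (a ∷ L) e with none-right x L e
      ... | ih rewrite e = cong (bit (aval δ x a) +_) ih
      correct : ∀ x → does (T <? 2 * ev (aval δ x) (List.map (λ a → a ∷ []) as)) ≡ val δ x t
      correct x = trans (cong (λ z → does (T <? 2 * z)) (value x)) (go (val δ x t) refl)
        where
        c = count (aval δ x) as
        w = wrongs δ t as x
        go : ∀ b → val δ x t ≡ b → does (T <? 2 * c) ≡ b
        go true  e = dec-true (T <? 2 * c) (+-cancelʳ-< (2 * w) T (2 * c) (begin-strict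
            T + 2 * w      <⟨ +-monoʳ-< T (few-wrong x) ⟩
            T + T          ≡⟨ cong (T +_) (sym (+-identityʳ T)) ⟩
            2 * T          ≡⟨ cong (2 *_) (sym (trans (right x as e) (proj₁ (proj₂ (boost T))))) ⟩
            2 * (c + w)    ≡⟨ *-distribˡ-+ 2 c w ⟩
            2 * c + 2 * w ∎))
          where open ≤-Reasoning
        go false e = dec-false (T <? 2 * c) (λ lt → <-asym lt (subst (λ z → 2 * z < T) (sym (none-right x as e)) (few-wrong x)))

-- From circuits to formulas

ones-count : ∀ {A : Set} (v : A → Bool) L → ones (List.map v L) ≡ count v L
ones-count v []      = refl
ones-count v (a ∷ L) with v a
... | true  = cong suc (ones-count v L)
... | false = ones-count v L

any⇒count : ∀ {A : Set} (v : A → Bool) L → anyB (List.map v L) ≡ false → count v L ≡ 0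
any⇒count v []      e = refl
any⇒count v (a ∷ L) e with v a
... | false = any⇒count v L e

count⇒any : ∀ {A : Set} (v : A → Bool) L → count v L ≡ 0 → anyB (List.map v L) ≡ false
count⇒any v []      e = refl
count⇒any v (a ∷ L) e with v a
... | false = count⇒any v L e

SameZero : ℕ → ℕ → Set
SameZero a b = (a ≡ 0 → b ≡ 0) × (b ≡ 0 → a ≡ 0)

any-cong : ∀ {A : Set} (v : A → Bool) L L' → SameZero (count v L) (count v L') → anyB (List.map v L) ≡ anyB (List.map v L')
any-cong v L L' (f , g) = go _ refl _ refl
  where
  go : ∀ b → anyB (List.map v L) ≡ b → ∀ c → anyB (List.map v L') ≡ c → anyB (List.map v L) ≡ anyB (List.map v L')
  go true  e true  e' = trans e (sym e')
  go false e _     _  = trans e (sym (count⇒any v L' (f (any⇒count v L e))))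
  go true  e false e' = trans (count⇒any v L (g (any⇒count v L' e'))) (sym e')

all-not-any : ∀ bs → allB bs ≡ not (anyB (List.map not bs))
all-not-any []           = refl
all-not-any (true ∷ bs)  = all-not-any bs
all-not-any (false ∷ bs) = refl

-- The size of a circuit does not bound the fan-in of its gates, since wires may be repeated: the
-- multiplicity k of each wire is replaced by h k ≤ H.
module Compress (h : ℕ → ℕ) (H : ℕ) (h≤H : ∀ k → h k ≤ H) (h0 : h 0 ≡ 0) (R : ℕ → ℕ → Set) (R00 : R 0 0)
                (R+ : ∀ {a b c d} → R a b → R c d → R (a + c) (b + d))
                (Rh : ∀ k b → R (h k * bit b) (k * bit b)) where

  private
    zeros : ∀ {w} → List (Fin (suc w)) → ℕ
    zeros []           = 0
    zeros (zero ∷ is)  = suc (zeros is)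
    zeros (suc _ ∷ is) = zeros is

    preds : ∀ {w} → List (Fin (suc w)) → List (Fin w)
    preds []           = []
    preds (zero ∷ is)  = preds is
    preds (suc i ∷ is) = i ∷ preds is

    count-split : ∀ {w} (v : Fin (suc w) → Bool) is → count v is ≡ zeros is * bit (v zero) + count (λ i → v (suc i)) (preds is)
    count-split v []           = refl
    count-split v (zero ∷ is)  = trans (cong (bit (v zero) +_) (count-split v is)) (sym (+-assoc (bit (v zero)) _ _))
    count-split v (suc i ∷ is) = trans (cong (bit (v (suc i)) +_) (count-split v is))
      (l (bit (v (suc i))) (zeros is * bit (v zero)) (count (λ i → v (suc i)) (preds is)))
      where
      l : ∀ a b c → a + (b + c) ≡ b + (a + c)
      l = ℕ-Solver.solve-∀

    All-preds : ∀ {w} {Q : Fin (suc w) → Set} is → All Q is → All (λ i → Q (suc i)) (preds is)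
    All-preds []           []       = []
    All-preds (zero ∷ is)  (q ∷ qs) = All-preds is qs
    All-preds (suc i ∷ is) (q ∷ qs) = q ∷ All-preds is qs

    All-zeros : ∀ {w} {Q : Fin (suc w) → Set} is → All Q is → All Q (replicate (h (zeros is)) zero)
    All-zeros []           []       = subst (λ k → All _ (replicate k zero)) (sym h0) []
    All-zeros (zero ∷ is)  (q ∷ qs) = All.replicate⁺ (h (suc (zeros is))) q
    All-zeros (suc i ∷ is) (q ∷ qs) = All-zeros is qs

    count-replicate : ∀ {A : Set} (v : A → Bool) k a → count v (replicate k a) ≡ k * bit (v a)
    count-replicate v zero    a = refl
    count-replicate v (suc k) a = cong (bit (v a) +_) (count-replicate v k a)

  compress : ∀ {w} → (is : List (Fin w)) → List (Fin w)
  compress {zero}  is = []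
  compress {suc w} is = replicate (h (zeros is)) zero ++ List.map suc (compress (preds is))

  compress-length : ∀ {w} (is : List (Fin w)) → length (compress is) ≤ w * H
  compress-length {zero}  is = z≤n
  compress-length {suc w} is = ≤-trans (≤-reflexive (trans (length-++ (replicate (h (zeros is)) zero))
      (cong₂ _+_ (length-replicate (h (zeros is))) (length-map suc (compress (preds is))))))
    (+-mono-≤ (h≤H (zeros is)) (compress-length (preds is)))

  compress-All : ∀ {w} {Q : Fin w → Set} (is : List (Fin w)) → All Q is → All Q (compress is)
  compress-All {zero}  is qs = []
  compress-All {suc w} is qs = All.++⁺ (All-zeros is qs) (All.map⁺ (compress-All (preds is) (All-preds is qs)))

  compress-count : ∀ {w} (v : Fin w → Bool) (is : List (Fin w)) → R (count v (compress is)) (count v is)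
  compress-count {zero}  v [] = R00
  compress-count {suc w} v is = subst₂ R (sym (trans (∑-++ (replicate (h (zeros is)) zero) _ _)
      (cong₂ _+_ (count-replicate v (h (zeros is)) zero) (∑-map suc (compress (preds is)) _)))) (sym (count-split v is))
    (R+ (Rh (zeros is) (v zero)) (compress-count (λ i → v (suc i)) (preds is)))

lookup-inject₁ : ∀ {A : Set} {n} (xs : Vec A n) y i → lookup (xs ∷ʳ y) (inject₁ i) ≡ lookup xs i
lookup-inject₁ (x ∷ xs) y zero    = refl
lookup-inject₁ (x ∷ xs) y (suc i) = lookup-inject₁ xs y i

lookup-fromℕ : ∀ {A : Set} {n} (xs : Vec A n) y → lookup (xs ∷ʳ y) (fromℕ n) ≡ y
lookup-fromℕ []       y = refl
lookup-fromℕ (x ∷ xs) y = lookup-fromℕ xs y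

last≡lookup : ∀ {A : Set} {n} (xs : Vec A (suc n)) → last xs ≡ lookup xs (fromℕ n)
last≡lookup xs with Vec.initLast xs
... | ys , y , refl = sym (lookup-fromℕ ys y)

max≤⇒All : ∀ {A : Set} {e} (f : A → ℕ) L → List.foldr _⊔_ 0 (List.map f L) ≤ e → All (λ a → f a ≤ e) L
max≤⇒All f []      h = []
max≤⇒All f (a ∷ L) h = ≤-trans (m≤m⊔n (f a) _) h ∷ max≤⇒All f L (≤-trans (m≤n⊔m (f a) _) h)

half : ∀ t → (∃ λ k → t ≡ k + k) ⊎ (∃ λ k → t ≡ suc (k + k))
half zero    = inj₁ (0 , refl)
half (suc t) with half t
... | inj₁ (k , refl) = inj₂ (k , refl)
... | inj₂ (k , refl) = inj₁ (suc k , cong suc (sym (+-suc k k)))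

-- A pair of one true and one false input changes nothing. A single leftover input has to be true
-- when `t` is even and false when `t` is odd, because a tie counts as a majority.
majority-padding : ∀ t r → Σ ℕ λ a → Σ ℕ λ b → a + b ≡ r × (∀ o → (t + r ≤ᵇ 2 * (o + a)) ≡ (t ≤ᵇ 2 * o))
majority-padding t zero = 0 , 0 , refl , λ o → cong₂ _≤ᵇ_ (+-identityʳ t) (cong (2 *_) (+-identityʳ o))
majority-padding t (suc zero) with half t
... | inj₁ (k , refl) = 1 , 0 , refl , λ o → does-⇔ (mk⇔ (f o) (g o)) (k + k + 1 ≤? 2 * (o + 1)) (k + k ≤? 2 * o)
  where
  f : ∀ o → k + k + 1 ≤ 2 * (o + 1) → k + k ≤ 2 * o
  f o h = subst (k + k ≤_) (cong (o +_) (sym (+-identityʳ o))) (+-mono-≤ k≤o k≤o)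
    where
    k≤o : k ≤ o
    k≤o = ≮⇒≥ λ o<k → <⇒≱ (≤-trans (s≤s (*-monoʳ-≤ 2 (subst (_≤ k) (+-comm 1 o) o<k))) (≤-reflexive (l k))) h
      where
      l : ∀ k → suc (2 * k) ≡ k + k + 1
      l = ℕ-Solver.solve-∀
  g : ∀ o → k + k ≤ 2 * o → k + k + 1 ≤ 2 * (o + 1)
  g o h = ≤-trans (+-monoˡ-≤ 1 h) (≤-trans (m≤m+n (2 * o + 1) 1) (≤-reflexive (l o)))
    where
    l : ∀ o → 2 * o + 1 + 1 ≡ 2 * (o + 1)
    l = ℕ-Solver.solve-∀
... | inj₂ (k , refl) = 0 , 1 , refl , λ o → does-⇔ (mk⇔ (f o) (g o)) (suc (k + k) + 1 ≤? 2 * (o + 0)) (suc (k + k) ≤? 2 * o)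
  where
  f : ∀ o → suc (k + k) + 1 ≤ 2 * (o + 0) → suc (k + k) ≤ 2 * o
  f o h = ≤-trans (m≤m+n (suc (k + k)) 1) (≤-trans h (≤-reflexive (cong (2 *_) (+-identityʳ o))))
  g : ∀ o → suc (k + k) ≤ 2 * o → suc (k + k) + 1 ≤ 2 * (o + 0)
  g o h = ≤-trans (≤-reflexive (l k)) (*-monoʳ-≤ 2 (subst (suc k ≤_) (sym (+-identityʳ o)) k<o))
    where
    l : ∀ k → suc (k + k) + 1 ≡ 2 * suc k
    l = ℕ-Solver.solve-∀
    k<o : k < o
    k<o = ≰⇒> λ o≤k → <⇒≱ h (≤-trans (*-monoʳ-≤ 2 o≤k) (≤-reflexive (cong (k +_) (+-identityʳ k))))
majority-padding t (suc (suc r)) with majority-padding t r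
... | a , b , refl , h = suc a , suc b , cong suc (+-suc a b) , λ o →
  trans (does-⇔ (mk⇔ (λ le → ℕ.s≤s⁻¹ (ℕ.s≤s⁻¹ (subst₂ _≤_ (l₁ t (a + b)) (l₂ o a) le)))
                     (λ le → subst₂ _≤_ (sym (l₁ t (a + b))) (sym (l₂ o a)) (s≤s (s≤s le))))
          (t + suc (suc (a + b)) ≤? 2 * (o + suc a)) (t + (a + b) ≤? 2 * (o + a))) (h o)
  where
  l₁ : ∀ t r → t + suc (suc r) ≡ suc (suc (t + r))
  l₁ = ℕ-Solver.solve-∀
  l₂ : ∀ o a → 2 * (o + suc a) ≡ suc (suc (2 * (o + a)))
  l₂ = ℕ-Solver.solve-∀

-- Substituting the circuit for MAJORITY into the threshold circuit

module Simulation (n s ℓ m : ℕ) (2≤m : 2 ≤ m) (m≤s : m ≤ s) where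

  open Formulas n s ℓ m

  Comp : ℕ → BoolFun n → Set
  Comp δ f = Σ (Form δ) λ t → ∀ x → val δ x t ≡ f x

  Comp-lift : ∀ {δ f} k → Comp δ f → Comp (k + δ) f
  Comp-lift zero    c = c
  Comp-lift (suc k) c with Comp-lift k c
  ... | t , h = up t , h

  Comp-≤ : ∀ {δ ε f} → δ ≤ ε → Comp δ f → Comp ε f
  Comp-≤ {δ} {ε} {f} δ≤ε c = subst (λ w → Comp w f) (m∸n+n≡m δ≤ε) (Comp-lift (ε ∸ δ) c)

  Comp-cong : ∀ {δ f g} → (∀ x → f x ≡ g x) → Comp δ f → Comp δ g
  Comp-cong e (t , h) = t , λ x → trans (h x) (e x)

  module _ {I : Set} (v : I → BoolFun n) where

    collect : ∀ {δ} is → All (λ i → Comp δ (v i)) is →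
      Σ (List (Form δ)) λ L → length L ≡ length is × (∀ x → List.map (val δ x) L ≡ List.map (λ i → v i x) is)
    collect []       []             = [] , refl , λ x → refl
    collect (i ∷ is) ((t , h) ∷ cs) with collect is cs
    ... | L , len , e = t ∷ L , cong suc len , λ x → cong₂ _∷_ (h x) (e x)

    Comp-or : ∀ {δ} is → length is ≤ s → All (λ i → Comp δ (v i)) is → Comp (suc δ) (λ x → anyB (List.map (λ i → v i x) is))
    Comp-or is h cs with collect is cs
    ... | L , len , e = or L (subst (_≤ s) (sym len) h) , λ x → cong anyB (e x)

    Comp-mod : ∀ {δ} is → length is ≤ s → All (λ i → Comp δ (v i)) is →
      Comp (suc δ) (λ x → does (m ∣? ones (List.map (λ i → v i x) is)))
    Comp-mod {δ} is h cs with collect is cs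
    ... | L , len , e = mod L (subst (_≤ s) (sym len) h) , λ x →
      cong (λ c → does (m ∣? c)) (trans (sym (ones-count (val δ x) L)) (cong ones (e x)))

  Comp-not : ∀ {δ f} → Comp δ f → Comp (suc δ) (λ x → not (f x))
  Comp-not {f = f} c = Comp-cong (λ x → flip (f x)) (Comp-mod (λ i → i) (f ∷ []) (≤-trans (<⇒≤ 2≤m) m≤s) (c ∷ []))
    where
    flip : ∀ b → does (m ∣? ones (b ∷ [])) ≡ not b
    flip true  = dec-false (m ∣? 1) λ h → <⇒≱ 2≤m (∣⇒≤ h)
    flip false = dec-true (m ∣? 0) (m ∣0)

  Comp-const : ∀ b → Comp 1 (λ _ → b)
  Comp-const true  = Comp-cong (λ x → dec-true (m ∣? 0) (m ∣0)) (Comp-mod {I = Fin 0} (λ ()) [] z≤n [])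
  Comp-const false = Comp-or {I = Fin 0} (λ ()) [] z≤n []

  module _ {w} (w≤ : w * m ≤ s) (v : Fin w → BoolFun n) where

    private
      instance
        m≢0 : NonZero m
        m≢0 = ℕ.>-nonZero (<⇒≤ 2≤m)

      -- An OR gate only needs multiplicities 0 and 1, a MOD_m gate only residues modulo `m`; both
      -- are at most `m`, whence the fan-in `w * m`.
      support : ℕ → ℕ
      support zero    = 0
      support (suc _) = 1

      support≤ : ∀ k → support k ≤ m
      support≤ zero    = z≤n
      support≤ (suc _) = <⇒≤ 2≤m

      SameZero-support : ∀ k b → SameZero (support k * bit b) (k * bit b)
      SameZero-support zero    b     = (λ e → e) , (λ e → e)
      SameZero-support (suc k) true  = (λ ()) , (λ ())
      SameZero-support (suc k) false = (λ _ → *-zeroʳ k) , (λ _ → refl)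

      SameZero-+ : ∀ {a b c d} → SameZero a b → SameZero c d → SameZero (a + c) (b + d)
      SameZero-+ {a} {b} {c} {d} (f , g) (f' , g') =
        (λ e → cong₂ _+_ (f (m+n≡0⇒m≡0 a e)) (f' (m+n≡0⇒n≡0 a e))) ,
        (λ e → cong₂ _+_ (g (m+n≡0⇒m≡0 b e)) (g' (m+n≡0⇒n≡0 b e)))

      module Or = Compress support m support≤ refl SameZero ((λ e → e) , (λ e → e)) SameZero-+ SameZero-support

      residue : ∀ k b → k % m * bit b ≡ k * bit b [mod m ]
      residue k b = k / m * bit b , 0 ,
        trans (l (k % m) (k / m) m (bit b)) (trans (cong (_* bit b) (sym (m≡m%n+[m/n]*n k m))) (sym (+-identityʳ _)))
        where
        l : ∀ r q m b → r * b + q * b * m ≡ (r + q * m) * b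
        l = ℕ-Solver.solve-∀

      module Mod = Compress (_% m) m (λ k → <⇒≤ (m%n<n k m)) (m<n⇒m%n≡m (<⇒≤ 2≤m)) (_≡_[mod m ]) (≡⇒mod refl) mod-+ residue

    Comp-any : ∀ {δ} is → All (λ i → Comp δ (v i)) is → Comp (suc δ) (λ x → anyB (List.map (λ i → v i x) is))
    Comp-any is cs = Comp-cong (λ x → any-cong (λ i → v i x) (Or.compress is) is (Or.compress-count (λ i → v i x) is))
      (Comp-or v (Or.compress is) (≤-trans (Or.compress-length is) w≤) (Or.compress-All is cs))

    Comp-∣ : ∀ {δ} is → All (λ i → Comp δ (v i)) is → Comp (suc δ) (λ x → does (m ∣? ones (List.map (λ i → v i x) is)))
    Comp-∣ is cs = Comp-cong (λ x → does-⇔ (mk⇔ (mod⇒∣ (same x)) (mod⇒∣ (mod-sym (same x)))) (m ∣? _) (m ∣? _))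
      (Comp-mod v (Mod.compress is) (≤-trans (Mod.compress-length is) w≤) (Mod.compress-All is cs))
      where
      same : ∀ x → ones (List.map (λ i → v i x) (Mod.compress is)) ≡ ones (List.map (λ i → v i x) is) [mod m ]
      same x = subst₂ (_≡_[mod m ]) (sym (ones-count (λ i → v i x) (Mod.compress is))) (sym (ones-count (λ i → v i x) is))
        (Mod.compress-count (λ i → v i x) is)

  -- De Morgan with two levels of negations, which are one-input MOD_m gates. These three levels are
  -- the factor 3 in all depths below.
  Comp-all : ∀ {w} → w * m ≤ s → (v : Fin w → BoolFun n) → ∀ {δ} is → All (λ i → Comp δ (v i)) is →
    Comp (3 + δ) (λ x → allB (List.map (λ i → v i x) is))
  Comp-all w≤ v is cs = Comp-cong
    (λ x → sym (trans (all-not-any (List.map (λ i → v i x) is)) (cong (λ bs → not (anyB bs)) (sym (map-∘ is)))))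
    (Comp-not (Comp-any w≤ (λ i x → not (v i x)) is (All.map Comp-not cs)))

  -- The circuit is unfolded on top of arbitrary formulas `y` for its inputs, which is what
  -- substitution for a gate requires; shared wires are duplicated.
  acc-wires : ∀ {n' w b} (E : Circ (ACC m) n' w) (y : Fin n' → BoolFun n) → (∀ j → Comp b (y j)) → w * m ≤ s →
    ∀ e i → lookup (depths (ACC m) E) i ≤ e → Comp (e * 3 + b) (λ x → lookup (wires (ACC m) E (Vec.tabulate (λ j → y j x))) i)
  acc-wires inputs y cs w≤ e i _ = Comp-cong (λ x → sym (lookup∘tabulate (λ j → y j x) i)) (Comp-lift (e * 3) (cs i))
  acc-wires {b = b} (_▷_ {w} E g) y cs w≤ e i h with view i
  ... | ‵inject₁ j = Comp-cong (λ x → sym (lookup-inject₁ (wires (ACC m) E (Vec.tabulate (λ j → y j x))) _ j))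
    (acc-wires E y cs (≤-trans (m≤n+m _ m) w≤) e j (subst (_≤ e) (lookup-inject₁ (depths (ACC m) E) _ j) h))
  ... | ‵fromℕ = Comp-cong (λ x → sym (lookup-fromℕ (wires (ACC m) E (Vec.tabulate (λ j → y j x))) _))
    (gate e (subst (_≤ e) (lookup-fromℕ (depths (ACC m) E) _) h))
    where
    w≤' : w * m ≤ s
    w≤' = ≤-trans (m≤n+m (w * m) m) w≤
    v : Fin w → BoolFun n
    v i x = lookup (wires (ACC m) E (Vec.tabulate (λ j → y j x))) i
    ins : List (Fin w)
    ins = GateKind.ins (ACC m) g
    gate : ∀ e → suc (List.foldr _⊔_ 0 (List.map (lookup (depths (ACC m) E)) ins)) ≤ e →
      Comp (e * 3 + b) (λ x → GateKind.evalG (ACC m) g (List.map (λ i → v i x) ins))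
    gate (suc e) (s≤s h) = go g (All.map (λ {i} → acc-wires E y cs w≤' e i) (max≤⇒All (lookup (depths (ACC m) E)) ins h))
      where
      go : ∀ g → All (λ i → Comp (e * 3 + b) (v i)) (GateKind.ins (ACC m) g) →
        Comp (suc e * 3 + b) (λ x → GateKind.evalG (ACC m) g (List.map (λ i → v i x) (GateKind.ins (ACC m) g)))
      go (andG is) cs = Comp-all w≤' v is cs
      go (orG is)  cs = Comp-lift 2 (Comp-any w≤' v is cs)
      go (notG i)  cs = Comp-not (Comp-lift 2 (Comp-cong (λ x → sym (∧-identityʳ (v i x))) (All.head cs)))
      go (modG is) cs = Comp-lift 2 (Comp-∣ w≤' v is cs)

  module _ {n' d : ℕ} (1≤d : 1 ≤ d) (E : CircuitFor (ACC m) n' (MAJ n')) where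

    open CircuitFor E using (width; circ; computes)

    module _ (depth≤ : depth (ACC m) circ ≤ d) (wires≤ : suc width * m ≤ s) where

      maj-wires : ∀ {b} (y : Fin n' → BoolFun n) → (∀ j → Comp b (y j)) →
        Comp (d * 3 + b) (λ x → n' ≤ᵇ 2 * onesV (Vec.tabulate (λ j → y j x)))
      maj-wires y cs = Comp-cong (λ x → trans (sym (last≡lookup (wires (ACC m) circ (Vec.tabulate (λ j → y j x))))) (computes _))
        (acc-wires circ y cs wires≤ d (fromℕ width) (subst (_≤ d) (last≡lookup (depths (ACC m) circ)) depth≤))

      Comp-maj : ∀ {b} (fs : List (BoolFun n)) → length fs ≡ n' → All (Comp b) fs →
        Comp (d * 3 + b) (λ x → n' ≤ᵇ 2 * ones (List.map (λ f → f x) fs))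
      Comp-maj fs refl cs = Comp-cong (λ x → cong (λ o → length fs ≤ᵇ 2 * ones o) (tab fs x))
        (maj-wires (List.lookup fs) (λ j → All.lookup cs (∈-lookup j)))
        where
        tab : ∀ fs x → Vec.toList (Vec.tabulate (λ j → List.lookup fs j x)) ≡ List.map (λ f → f x) fs
        tab []       x = refl
        tab (f ∷ fs) x = cong (f x ∷_) (tab fs x)

      Comp-small-maj : ∀ {I : Set} {b} (v : I → BoolFun n) → 1 ≤ b → ∀ is → length is ≤ n' → All (λ i → Comp b (v i)) is →
        Comp (d * 3 + b) (λ x → length (List.map (λ i → v i x) is) ≤ᵇ 2 * ones (List.map (λ i → v i x) is))
      Comp-small-maj {I} {b} v 1≤b is len cs with majority-padding (length is) (n' ∸ length is)
      ... | p , q , p+q , pad = Comp-cong value (Comp-maj fs len-fs all-fs)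
        where
        fs : List (BoolFun n)
        fs = List.map v is ++ replicate p (λ _ → true) ++ replicate q (λ _ → false)
        len-fs : length fs ≡ n'
        len-fs = trans (length-++ (List.map v is)) (trans (cong₂ _+_ (length-map v is)
          (trans (length-++ (replicate p (λ _ → true))) (trans (cong₂ _+_ (length-replicate p) (length-replicate q)) p+q)))
          (m+[n∸m]≡n len))
        all-fs : All (Comp b) fs
        all-fs = All.++⁺ (All.map⁺ cs) (All.++⁺ (All.replicate⁺ p (Comp-≤ 1≤b (Comp-const true)))
                                               (All.replicate⁺ q (Comp-≤ 1≤b (Comp-const false))))
        ones-fs : ∀ x is → ones (List.map (λ f → f x) (List.map v is ++ replicate p (λ _ → true) ++ replicate q (λ _ → false)))
          ≡ ones (List.map (λ i → v i x) is) + p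
        ones-fs x []       = trans (trues p) refl
          where
          falses : ∀ q → ones (List.map (λ (f : BoolFun n) → f x) (replicate q (λ _ → false))) ≡ 0
          falses zero    = refl
          falses (suc q) = falses q
          trues : ∀ p → ones (List.map (λ (f : BoolFun n) → f x) (replicate p (λ _ → true) ++ replicate q (λ _ → false))) ≡ p
          trues zero    = falses q
          trues (suc p) = cong suc (trues p)
        ones-fs x (i ∷ is) with v i x
        ... | true  = cong suc (ones-fs x is)
        ... | false = ones-fs x is
        value : ∀ x → (n' ≤ᵇ 2 * ones (List.map (λ f → f x) fs)) ≡ (length (List.map (λ i → v i x) is) ≤ᵇ 2 * ones (List.map (λ i → v i x) is))
        value x = trans (cong₂ (λ k o → k ≤ᵇ 2 * o) (sym (m+[n∸m]≡n len)) (ones-fs x is))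
          (trans (pad (ones (List.map (λ i → v i x) is))) (cong (_≤ᵇ 2 * ones (List.map (λ i → v i x) is)) (sym (length-map (λ i → v i x) is))))

      -- The extra level at the bottom makes room for the constants that pad a majority gate to `n'`
      -- inputs.
      tc-wires : ∀ {w} (D : Circ TC n w) → maxFanIn TC D ≤ n' → ∀ e i → lookup (depths TC D) i ≤ e →
        Comp (e * (d * 3) + 1) (λ x → lookup (wires TC D x) i)
      tc-wires inputs fan e i _ = Comp-lift {1} (e * (d * 3)) (Comp-lift {0} 1 (i , λ x → refl))
      tc-wires (_▷_ {w} D g) fan e i h with view i
      ... | ‵inject₁ j = Comp-cong (λ x → sym (lookup-inject₁ (wires TC D x) _ j))
        (tc-wires D (≤-trans (m≤m⊔n _ _) fan) e j (subst (_≤ e) (lookup-inject₁ (depths TC D) _ j) h))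
      ... | ‵fromℕ = Comp-cong (λ x → sym (lookup-fromℕ (wires TC D x) _))
        (gate e (subst (_≤ e) (lookup-fromℕ (depths TC D) _) h))
        where
        v : Fin w → BoolFun n
        v i x = lookup (wires TC D x) i
        gate : ∀ e → suc (List.foldr _⊔_ 0 (List.map (lookup (depths TC D)) (GateKind.ins TC g))) ≤ e →
          Comp (e * (d * 3) + 1) (λ x → GateKind.evalG TC g (List.map (λ i → v i x) (GateKind.ins TC g)))
        gate (suc e) (s≤s h) = subst (λ δ → Comp δ (λ x → GateKind.evalG TC g (List.map (λ i → v i x) (GateKind.ins TC g)))) (sym (+-assoc (d * 3) (e * (d * 3)) 1))
            (go g (≤-trans (m≤n⊔m _ _) fan) (All.map (λ {i} → tc-wires D (≤-trans (m≤m⊔n _ _) fan) e i)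
              (max≤⇒All (lookup (depths TC D)) (GateKind.ins TC g) h)))
          where
          b = e * (d * 3) + 1
          go : ∀ g → length (GateKind.ins TC g) ≤ n' → All (λ i → Comp b (v i)) (GateKind.ins TC g) →
            Comp (d * 3 + b) (λ x → GateKind.evalG TC g (List.map (λ i → v i x) (GateKind.ins TC g)))
          go (majG is) len cs = Comp-small-maj v (m≤n+m 1 _) is len cs
          go (notG i)  len cs = Comp-≤ (+-monoˡ-≤ b (≤-trans 1≤d (m≤m*n d 3))) (Comp-not (Comp-cong (λ x → sym (∧-identityʳ (v i x))) (All.head cs)))

      tc-output : ∀ {f c} (D : CircuitFor TC n f) → maxFanIn TC (CircuitFor.circ D) ≤ n' → depth TC (CircuitFor.circ D) ≤ c →
        Comp (c * (d * 3) + 1) f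
      tc-output D fan dep = Comp-cong (λ x → trans (sym (last≡lookup (wires TC (CircuitFor.circ D) x))) (CircuitFor.computes D x))
        (tc-wires (CircuitFor.circ D) fan _ (fromℕ (CircuitFor.width D)) (subst (_≤ _) (last≡lookup (depths TC (CircuitFor.circ D))) dep))

-- Choice of parameters

integer-root : ∀ e n → 0 < e → ∃ λ y → y ^ e ≤ n × n < suc y ^ e
integer-root (suc e) zero    _ = 0 , z≤n , m^n>0 1 (suc e)
integer-root (suc e) (suc n) _ with integer-root (suc e) n (s≤s z≤n)
... | y , lo , hi with suc y ^ suc e ≤? suc n
...   | yes le = suc y , le , ≤-trans (s≤s hi) (^-monoˡ-< (suc e) ≤-refl)
...   | no ¬le = y , m≤n⇒m≤1+n lo , ≰⇒> ¬le

root-mono : ∀ e {n x y} → x ^ e ≤ n → n < suc y ^ e → x ≤ y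
root-mono e lo hi = ≮⇒≥ λ y<x → <⇒≱ hi (≤-trans (^-monoˡ-≤ e y<x) lo)

wires≡ : ∀ (𝓖 : GateKind) {n w} (c : Circ 𝓖 n w) → w ≡ n + size 𝓖 c
wires≡ 𝓖 {n} inputs  = sym (+-identityʳ n)
wires≡ 𝓖 {n} (c ▷ g) = trans (cong suc (wires≡ 𝓖 c)) (sym (+-suc n (size 𝓖 c)))

1≤numPrimeFactors : ∀ {m} → 2 ≤ m → 1 ≤ numPrimeFactors m
1≤numPrimeFactors {m} 2≤m = n≢0⇒n>0 λ r≡0 → <⇒≱ 2≤m (∣⇒≤ (primePowers-∣ m>0 (none (trans (length-primePowers m>0) r≡0))))
  where
  m>0 : 0 < m
  m>0 = <⇒≤ 2≤m
  none : ∀ {L : List (PrimePower m)} → length L ≡ 0 → All (λ P → PrimePower.q P ∣ 1) L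
  none {[]} _ = []

-- A constant factor not exceeding `y` is absorbed by doubling the exponent; hence the 2 in
-- `n₀ = y ^ (2 * E)`.
square-bound : ∀ a y u v → a ≤ y → 1 ≤ a * y → u ≤ v → (a * y) ^ u ≤ y ^ (2 * v)
square-bound a y u v a≤y 1≤ay u≤v = begin
  (a * y) ^ u   ≤⟨ ^-monoʳ-≤ (a * y) ⦃ ℕ.>-nonZero 1≤ay ⦄ u≤v ⟩
  (a * y) ^ v   ≤⟨ ^-monoˡ-≤ v (*-monoˡ-≤ y a≤y) ⟩
  (y * y) ^ v   ≡⟨ cong (λ w → (y * w) ^ v) (sym (*-identityʳ y)) ⟩
  (y ^ 2) ^ v   ≡⟨ ^-*-assoc y 2 v ⟩
  y ^ (2 * v) ∎
  where open ≤-Reasoning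

nodes-bound : ∀ n s ℓ m {σ} → suc s ≤ 2 ^ σ → ∀ δ → Formulas.nodes n s ℓ m δ ≤ 2 ^ (δ * suc σ)
nodes-bound n s ℓ m {σ} s≤ zero    = ≤-refl
nodes-bound n s ℓ m {σ} s≤ (suc δ) = begin
  suc (suc s * N)        ≤⟨ +-monoˡ-≤ (suc s * N) (*-mono-≤ (s≤s (z≤n {s})) (Formulas.nodes>0 n s ℓ m δ)) ⟩
  suc s * N + suc s * N  ≡⟨ lem (suc s) N ⟩
  suc s * 2 * N          ≤⟨ *-mono-≤ (*-monoˡ-≤ 2 s≤) (nodes-bound n s ℓ m s≤ δ) ⟩
  2 ^ σ * 2 * 2 ^ (δ * suc σ) ≡⟨ cong (_* 2 ^ (δ * suc σ)) (*-comm (2 ^ σ) 2) ⟩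
  2 ^ suc σ * 2 ^ (δ * suc σ) ≡⟨ sym (^-distribˡ-+-* 2 (suc σ) (δ * suc σ)) ⟩
  2 ^ (suc δ * suc σ) ∎
  where
  open ≤-Reasoning
  N = Formulas.nodes n s ℓ m δ
  lem : ∀ a b → a * b + a * b ≡ a * 2 * b
  lem = ℕ-Solver.solve-∀

module _ (n₀ s ℓ m σ c d n : ℕ) (2≤m : 2 ≤ m) (m≤s : m ≤ s) (1≤d : 1 ≤ d) (1≤ℓ : 1 ≤ ℓ) (r≤ℓ : numPrimeFactors m ≤ ℓ)
         (1≤σ : 1 ≤ σ) (s≤ : suc s ≤ 2 ^ σ) where

  private
    m>0 : 0 < m
    m>0 = <⇒≤ 2≤m

    powers≤ℓ : length (primePowers m>0) ≤ ℓ
    powers≤ℓ = ≤-trans (≤-reflexive (length-primePowers m>0)) r≤ℓ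

    open Levels n₀ s ℓ m
    open Formulas n₀ s ℓ m using (Form; val; nodes; majority-symSum)
    open Simulation n₀ s ℓ m 2≤m m≤s using (tc-output)

    collapse-form : ∀ δ (t : Form δ) → 8 * nodes δ ≤ 2 ^ ℓ → 4 * suc n₀ ≤ 2 ^ σ →
      growth m σ ℓ ^ (δ * suc (suc (numPrimeFactors m))) * σ ≤ 2 ^ σ →
      Σ (SymAnd n₀) λ S → symAndSize S ≤ 2 ^ (growth m σ ℓ ^ (δ * suc (suc (numPrimeFactors m))) * σ) × (∀ x → evalSymAnd S x ≡ val δ x t)
    collapse-form δ t accurate samples≤ K≤ =
      subst (λ K → Σ (SymAnd n₀) λ S → symAndSize S ≤ 2 ^ K × (∀ x → evalSymAnd S x ≡ val δ x t)) chain≡K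
        (symSum⇒symAnd (levels-chain 2≤m m≤s 1≤ℓ m>0 powers≤ℓ 1≤σ s≤ δ 1≤σ (subst (_≤ 2 ^ σ) (sym chain≡K) K≤)
          (majority-symSum t accurate 1≤σ samples≤)))
      where
      chain≡K : chain 2≤m m≤s 1≤ℓ m>0 powers≤ℓ 1≤σ s≤ (δ * suc (length (moduli 2≤m m≤s 1≤ℓ m>0 powers≤ℓ))) σ
        ≡ growth m σ ℓ ^ (δ * suc (suc (numPrimeFactors m))) * σ
      chain≡K = trans (chain≡ 2≤m m≤s 1≤ℓ m>0 powers≤ℓ 1≤σ s≤ (δ * suc (length (moduli 2≤m m≤s 1≤ℓ m>0 powers≤ℓ))) σ)
        (cong (λ r → growth m σ ℓ ^ (δ * suc (suc r)) * σ) (length-primePowers m>0))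

  collapse : 8 * Formulas.nodes n₀ s ℓ m (c * (d * 3) + 1) ≤ 2 ^ ℓ → 4 * suc n₀ ≤ 2 ^ σ →
    growth m σ ℓ ^ ((c * (d * 3) + 1) * suc (suc (numPrimeFactors m))) * σ ≤ 2 ^ σ →
    ∀ {f} (D : CircuitFor TC n₀ f) → depth TC (CircuitFor.circ D) ≤ c → maxFanIn TC (CircuitFor.circ D) ≤ n →
    (𝓔 : CircuitFor (ACC m) n (MAJ n)) → depth (ACC m) (CircuitFor.circ 𝓔) ≤ d → (n + size (ACC m) (CircuitFor.circ 𝓔)) * m ≤ s →
    Σ (SymAnd n₀) λ S → symAndSize S ≤ 2 ^ (growth m σ ℓ ^ ((c * (d * 3) + 1) * suc (suc (numPrimeFactors m))) * σ) ×
      (∀ x → evalSymAnd S x ≡ f x)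
  collapse accurate samples≤ K≤ D depD fanD 𝓔 dep𝓔 wires≤
    with tc-output 1≤d 𝓔 dep𝓔 (subst (λ w → w * m ≤ s) (sym (wires≡ (ACC m) (CircuitFor.circ 𝓔))) wires≤) D fanD depD
  ... | t , h with collapse-form (c * (d * 3) + 1) t accurate samples≤ K≤
  ...   | S , sizeS , eq = S , sizeS , λ x → trans (eq x) (h x)

module Parameters (c k a m d : ℕ) (1≤c : 1 ≤ c) (1≤k : 1 ≤ k) (2≤m : 2 ≤ m) (1≤d : 1 ≤ d) where

  r = numPrimeFactors m

  -- The factor suc a lets n₀ = y ^ (2 * E) absorb the polylogarithmic factor of quasiLin a n₀.
  E = 13 * c * k * suc a * (r * d)
  δ = c * (d * 3) + 1
  L = δ * suc (suc r)

  m>0 : 0 < m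
  m>0 = <⇒≤ 2≤m

  1≤r : 1 ≤ r
  1≤r = 1≤numPrimeFactors 2≤m

  levels≤ : suc L * k ≤ E
  levels≤ = begin
    suc L * k                            ≤⟨ *-monoˡ-≤ k sucL≤ ⟩
    13 * (c * d * r) * k                 ≡⟨ lem c d r k ⟩
    13 * c * k * 1 * (r * d)             ≤⟨ *-monoˡ-≤ (r * d) (*-monoʳ-≤ (13 * c * k) (s≤s z≤n)) ⟩
    E ∎
    where
    open ≤-Reasoning
    lem : ∀ c d r k → 13 * (c * d * r) * k ≡ 13 * c * k * 1 * (r * d)
    lem = ℕ-Solver.solve-∀
    1≤cd : 1 ≤ c * d
    1≤cd = *-mono-≤ 1≤c 1≤d
    sucL≤ : suc L ≤ 13 * (c * d * r)
    sucL≤ = begin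
      -- Origin of 13: 3cd + 1 ≤ 4cd and r + 2 ≤ 3r give 12cdr, and the initial 1 is at most cdr.
      suc ((c * (d * 3) + 1) * suc (suc r))                 ≤⟨ s≤s (*-mono-≤ (+-monoʳ-≤ (c * (d * 3)) 1≤cd) (+-mono-≤ 1≤r (+-monoˡ-≤ r 1≤r))) ⟩
      1 + (c * (d * 3) + c * d) * (r + (r + r))             ≤⟨ +-monoˡ-≤ _ (*-mono-≤ 1≤cd 1≤r) ⟩
      c * d * r + (c * (d * 3) + c * d) * (r + (r + r))     ≡⟨ lem₂ c d r ⟩
      13 * (c * d * r) ∎
      where
      lem₂ : ∀ c d r → c * d * r + (c * (d * 3) + c * d) * (r + (r + r)) ≡ 13 * (c * d * r)
      lem₂ = ℕ-Solver.solve-∀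

  a<E : suc a ≤ E
  a<E = begin
    suc a                    ≡⟨ sym (trans (*-identityʳ _) (*-identityˡ (suc a))) ⟩
    1 * suc a * 1            ≤⟨ *-mono-≤ (*-monoˡ-≤ (suc a) (*-mono-≤ (*-mono-≤ (s≤s (z≤n {12})) 1≤c) 1≤k)) (*-mono-≤ 1≤r 1≤d) ⟩
    E ∎
    where open ≤-Reasoning

  -- Slopes independent of `n` and `y`: `s₁ * y` bounds `σ`, `l₁ * y` bounds `ℓ`, `c₁ * y` bounds
  -- both the growth per layer and `σ`, and `c₂ * y` bounds `a` and the logarithm of `n₀` plus one.
  s₁ l₁ c₁ c₂ : ℕ
  s₁ = m + 4 * E + 3
  l₁ = 3 + δ * suc s₁ + r
  c₁ = growth m s₁ l₁ + s₁
  c₂ = a + 2 * E + 1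

  module _ (n y : ℕ) (c₁≤y : c₁ ≤ y) (c₂≤y : c₂ ≤ y) (y≤ : y ^ (4 * E) ≤ n) (n< : n < suc y ^ (4 * E)) where

    -- `s` is the fan-in after reducing multiplicities, for at most n + 2^y wires, and `σ` its
    -- logarithm. In `ℓ`, the 3 pays for the accuracy 1/8, `δ * suc σ` for the number of nodes, and
    -- `r` lets a MOD_m node be a product of at most `ℓ` gates.
    n₀ s σ ℓ K : ℕ
    n₀ = y ^ (2 * E)
    s = (n + 2 ^ y) * m
    σ = m + (y * (4 * E) + y + 1) + 1
    ℓ = 3 + δ * suc σ + r
    K = growth m σ ℓ ^ L * σ

    1≤y : 1 ≤ y
    1≤y = ≤-trans (m≤n+m 1 (a + 2 * E)) c₂≤y

    n₀²≤n : n₀ * n₀ ≤ n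
    n₀²≤n = ≤-trans (≤-reflexive (trans (sym (^-distribˡ-+-* y (2 * E) (2 * E))) (cong (y ^_) (lem E)))) y≤
      where
      lem : ∀ E → 2 * E + 2 * E ≡ 4 * E
      lem = ℕ-Solver.solve-∀

    n₀>0 : 0 < n₀
    n₀>0 = m^n>0 y ⦃ ℕ.>-nonZero 1≤y ⦄ (2 * E)

    n₀≤n : n₀ ≤ n
    n₀≤n = ≤-trans (m≤m*n n₀ n₀ ⦃ ℕ.>-nonZero n₀>0 ⦄) n₀²≤n

    y≤n₀ : y ≤ n₀
    y≤n₀ = ≤-trans (≤-reflexive (sym (*-identityʳ y))) (^-monoʳ-≤ y ⦃ ℕ.>-nonZero 1≤y ⦄ {1} {2 * E}
      (≤-trans (≤-trans (s≤s z≤n) a<E) (m≤m+n E (E + 0))))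

    sn≤ : suc n ≤ 2 ^ (y * (4 * E))
    sn≤ = ≤-trans n< (≤-trans (^-monoˡ-≤ (4 * E) (n<2^n y)) (≤-reflexive (^-*-assoc 2 y (4 * E))))

    s≤ : suc s ≤ 2 ^ σ
    s≤ = begin
      suc ((n + 2 ^ y) * m)       ≤⟨ +-mono-≤ (m^n>0 2 (m + (y * (4 * E) + y + 1))) (≤-trans (≤-reflexive (*-comm (n + 2 ^ y) m)) (2^-* m (y * (4 * E) + y + 1) (n≤2^n m) inner)) ⟩
      2 ^ (m + (y * (4 * E) + y + 1)) + 2 ^ (m + (y * (4 * E) + y + 1)) ≡⟨ lem (2 ^ (m + (y * (4 * E) + y + 1))) ⟩
      2 ^ (m + (y * (4 * E) + y + 1)) * 2 ^ 1 ≡⟨ sym (^-distribˡ-+-* 2 (m + (y * (4 * E) + y + 1)) 1) ⟩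
      2 ^ σ ∎
      where
      open ≤-Reasoning
      lem : ∀ a → a + a ≡ a * 2
      lem = ℕ-Solver.solve-∀
      inner : n + 2 ^ y ≤ 2 ^ (y * (4 * E) + y + 1)
      inner = begin
        n + 2 ^ y ≤⟨ +-mono-≤ (≤-trans (≤-trans (n≤1+n n) sn≤) (^-monoʳ-≤ 2 (m≤m+n (y * (4 * E)) y))) (^-monoʳ-≤ 2 (m≤n+m y (y * (4 * E)))) ⟩
        2 ^ (y * (4 * E) + y) + 2 ^ (y * (4 * E) + y) ≡⟨ lem (2 ^ (y * (4 * E) + y)) ⟩
        2 ^ (y * (4 * E) + y) * 2 ^ 1 ≡⟨ sym (^-distribˡ-+-* 2 (y * (4 * E) + y) 1) ⟩
        2 ^ (y * (4 * E) + y + 1) ∎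

    m≤s : m ≤ s
    m≤s = m≤n*m m (n + 2 ^ y) ⦃ ℕ.>-nonZero (≤-trans (m^n>0 2 y) (m≤n+m (2 ^ y) n)) ⦄

    1≤σ : 1 ≤ σ
    1≤σ = m≤n+m 1 (m + (y * (4 * E) + y + 1))

    samples≤ : 4 * suc n₀ ≤ 2 ^ σ
    samples≤ = ≤-trans (2^-* 2 (y * (4 * E)) ≤-refl (≤-trans (s≤s n₀≤n) sn≤)) (^-monoʳ-≤ 2 (begin
      2 + y * (4 * E)         ≤⟨ +-mono-≤ 2≤m (≤-trans (m≤m+n _ y) (m≤m+n _ 1)) ⟩
      m + (y * (4 * E) + y + 1) ≤⟨ m≤m+n _ 1 ⟩
      σ ∎))
      where open ≤-Reasoning

    σ≤ : σ ≤ s₁ * y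
    σ≤ = begin
      m + (y * (4 * E) + y + 1) + 1         ≤⟨ +-mono-≤ (+-mono-≤ (m≤m*n m y) (+-monoʳ-≤ (y * (4 * E) + y) 1≤y)) 1≤y ⟩
      m * y + (y * (4 * E) + y + y) + y     ≡⟨ lem m E y ⟩
      s₁ * y ∎
      where
      open ≤-Reasoning
      instance
        y≢0 : NonZero y
        y≢0 = ℕ.>-nonZero 1≤y
      lem : ∀ m E y → m * y + (y * (4 * E) + y + y) + y ≡ (m + 4 * E + 3) * y
      lem = ℕ-Solver.solve-∀

    ℓ≤ : ℓ ≤ l₁ * y
    ℓ≤ = begin
      3 + δ * (1 + σ) + r           ≤⟨ +-mono-≤ (+-mono-≤ (m≤m*n 3 y) (*-monoʳ-≤ δ (+-mono-≤ 1≤y σ≤))) (m≤m*n r y) ⟩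
      3 * y + δ * (y + s₁ * y) + r * y ≡⟨ lem δ s₁ r y ⟩
      l₁ * y ∎
      where
      open ≤-Reasoning
      instance
        y≢0 : NonZero y
        y≢0 = ℕ.>-nonZero 1≤y
      lem : ∀ δ s r y → 3 * y + δ * (y + s * y) + r * y ≡ (3 + δ * suc s + r) * y
      lem = ℕ-Solver.solve-∀

    growth≤ : growth m σ ℓ ≤ growth m s₁ l₁ * y
    growth≤ = begin
      1 + 7 * m + 3 * m * (m + 5) * σ + 3 * m * m * ℓ
        ≤⟨ +-mono-≤ (+-mono-≤ (m≤m*n (1 + 7 * m) y) (*-monoʳ-≤ (3 * m * (m + 5)) σ≤)) (*-monoʳ-≤ (3 * m * m) ℓ≤) ⟩
      (1 + 7 * m) * y + 3 * m * (m + 5) * (s₁ * y) + 3 * m * m * (l₁ * y) ≡⟨ lem m s₁ l₁ y ⟩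
      growth m s₁ l₁ * y ∎
      where
      open ≤-Reasoning
      instance
        y≢0 : NonZero y
        y≢0 = ℕ.>-nonZero 1≤y
      lem : ∀ m s l y → (1 + 7 * m) * y + 3 * m * (m + 5) * (s * y) + 3 * m * m * (l * y) ≡ (1 + 7 * m + 3 * m * (m + 5) * s + 3 * m * m * l) * y
      lem = ℕ-Solver.solve-∀

    1≤c₁y : 1 ≤ c₁ * y
    1≤c₁y = *-mono-≤ (≤-trans (s≤s z≤n) (m≤m+n (growth m s₁ l₁) s₁)) 1≤y

    K≤ : K ≤ (c₁ * y) ^ suc L
    K≤ = ≤-trans (*-mono-≤ (^-monoˡ-≤ L (≤-trans growth≤ (*-monoˡ-≤ y (m≤m+n (growth m s₁ l₁) s₁))))
                            (≤-trans σ≤ (*-monoˡ-≤ y (m≤n+m s₁ (growth m s₁ l₁)))))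
                 (≤-reflexive (*-comm ((c₁ * y) ^ L) (c₁ * y)))

    K^k≤n₀ : K ^ k ≤ n₀
    K^k≤n₀ = begin
      K ^ k                     ≤⟨ ^-monoˡ-≤ k K≤ ⟩
      ((c₁ * y) ^ suc L) ^ k    ≡⟨ ^-*-assoc (c₁ * y) (suc L) k ⟩
      (c₁ * y) ^ (suc L * k)    ≤⟨ square-bound c₁ y (suc L * k) E c₁≤y 1≤c₁y levels≤ ⟩
      n₀ ∎
      where open ≤-Reasoning

    K≤2^σ : K ≤ 2 ^ σ
    K≤2^σ = ≤-trans (x≤x^k K) (≤-trans K^k≤n₀ (≤-trans (m≤n⇒m≤1+n ≤-refl) (≤-trans (m≤m+n (suc n₀) _) samples≤)))
      where
      x≤x^k : ∀ x → x ≤ x ^ k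
      x≤x^k zero    = z≤n
      x≤x^k (suc x) = ≤-trans (≤-reflexive (sym (*-identityʳ (suc x)))) (^-monoʳ-≤ (suc x) {1} {k} 1≤k)

    -- Of the two factors in n₀ * n₀ ≤ n, one is the linear part and the other absorbs the constant
    -- and the logarithms; so the circuit for MAJORITY on `n` inputs can serve every gate.
    quasiLin≤n : quasiLin a n₀ ≤ n
    quasiLin≤n = begin
      a * n₀ * (⌊log₂ n₀ ⌋ + 1) ^ a   ≤⟨ *-mono-≤ (*-monoˡ-≤ n₀ a≤) (^-monoˡ-≤ a log≤) ⟩
      c₂ * y * n₀ * (c₂ * y) ^ a      ≡⟨ lem (c₂ * y) n₀ ((c₂ * y) ^ a) ⟩
      n₀ * (c₂ * y) ^ suc a           ≤⟨ *-monoʳ-≤ n₀ (square-bound c₂ y (suc a) E c₂≤y (*-mono-≤ (m≤n+m 1 (a + 2 * E)) 1≤y) a<E) ⟩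
      n₀ * n₀                         ≤⟨ n₀²≤n ⟩
      n ∎
      where
      open ≤-Reasoning
      instance
        y≢0 : NonZero y
        y≢0 = ℕ.>-nonZero 1≤y
      lem : ∀ a b c → a * b * c ≡ b * (a * c)
      lem = ℕ-Solver.solve-∀
      lem₂ : ∀ y E → y * (2 * E) + y ≡ (2 * E + 1) * y
      lem₂ = ℕ-Solver.solve-∀
      a≤ : a ≤ c₂ * y
      a≤ = ≤-trans (≤-trans (m≤m+n a (2 * E)) (m≤m+n _ 1)) (m≤m*n c₂ y)
      log≤ : ⌊log₂ n₀ ⌋ + 1 ≤ c₂ * y
      log≤ = begin
        ⌊log₂ n₀ ⌋ + 1       ≤⟨ +-mono-≤ (≤-trans (⌊log₂⌋-mono-≤ (≤-trans (^-monoˡ-≤ (2 * E) (n≤2^n y)) (≤-reflexive (^-*-assoc 2 y (2 * E)))))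
                                  (≤-reflexive (⌊log₂[2^n]⌋≡n (y * (2 * E))))) 1≤y ⟩
        y * (2 * E) + y      ≡⟨ lem₂ y E ⟩
        (2 * E + 1) * y      ≤⟨ *-monoˡ-≤ y (≤-trans (m≤n+m (2 * E + 1) a) (≤-reflexive (sym (+-assoc a (2 * E) 1)))) ⟩
        c₂ * y ∎

    accurate : 8 * Formulas.nodes n₀ s ℓ m δ ≤ 2 ^ ℓ
    accurate = ≤-trans (2^-* 3 (δ * suc σ) ≤-refl (nodes-bound n₀ s ℓ m s≤ δ)) (^-monoʳ-≤ 2 (m≤m+n (3 + δ * suc σ) r))

    small-symAnd : ∀ {f} (D : CircuitFor TC n₀ f) → depth TC (CircuitFor.circ D) ≤ c →
      maxFanIn TC (CircuitFor.circ D) ≤ quasiLin a n₀ →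
      (𝓔 : CircuitFor (ACC m) n (MAJ n)) → depth (ACC m) (CircuitFor.circ 𝓔) ≤ d → size (ACC m) (CircuitFor.circ 𝓔) ≤ 2 ^ y →
      Σ (SymAnd n₀) λ S → symAndSize S ≤ 2 ^ K × (∀ x → evalSymAnd S x ≡ f x)
    small-symAnd D depD fanD 𝓔 dep𝓔 size𝓔 = collapse n₀ s ℓ m σ c d n 2≤m m≤s 1≤d (s≤s z≤n) (m≤n+m r (3 + δ * suc σ)) 1≤σ s≤
      accurate samples≤ K≤2^σ D depD (≤-trans fanD quasiLin≤n) 𝓔 dep𝓔 (*-monoˡ-≤ m (+-monoʳ-≤ n size𝓔))

theorem1p8 : SymAndHypothesis → MajorityLowerBound
-- 52 = 4 · 13, so that the exponent in the conclusion is exactly `4 * E`.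
theorem1p8 (c , k , a , 1<c , 1<k , N₀ , hyp) = 52 * c * k * suc a , 1≤q , bound
  where
  1≤q : 1 ≤ 52 * c * k * suc a
  1≤q = *-mono-≤ (*-mono-≤ (*-mono-≤ (s≤s (z≤n {51})) (<⇒≤ 1<c)) (<⇒≤ 1<k)) (s≤s (z≤n {a}))
  bound : ∀ m d → 2 ≤ m → 1 ≤ d → Σ ℕ λ N → ∀ n → N ≤ n → (D : CircuitFor (ACC m) n (MAJ n)) →
    depth (ACC m) (CircuitFor.circ D) ≤ d → ∀ x → x ^ (52 * c * k * suc a * numPrimeFactors m * d) ≤ n →
    2 ^ x ≤ size (ACC m) (CircuitFor.circ D)
  bound m d 2≤m 1≤d = Y ^ (4 * E) , λ n N≤n D dep x x≤ → ≮⇒≥ λ size< → refute n N≤n D dep x (subst (λ e → x ^ e ≤ n) e≡ x≤) size<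
    where
    open Parameters c k a m d (<⇒≤ 1<c) (<⇒≤ 1<k) 2≤m 1≤d
    -- From y ≥ Y follow c₁ ≤ y and c₂ ≤ y, and n₀ ≥ y ≥ N₀ is in the range of the hypothesis.
    Y = N₀ + (c₁ + c₂)
    e≡ : 52 * c * k * suc a * numPrimeFactors m * d ≡ 4 * E
    e≡ = lem c k (suc a) (numPrimeFactors m) d
      where
      lem : ∀ c k a r d → 52 * c * k * a * r * d ≡ 4 * (13 * c * k * a * (r * d))
      lem = ℕ-Solver.solve-∀
    refute : ∀ n → Y ^ (4 * E) ≤ n → (D : CircuitFor (ACC m) n (MAJ n)) → depth (ACC m) (CircuitFor.circ D) ≤ d →
      ∀ x → x ^ (4 * E) ≤ n → ¬ (size (ACC m) (CircuitFor.circ D) < 2 ^ x)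
    refute n N≤n D dep x x≤ size< with integer-root (4 * E) n (≤-trans (≤-trans (s≤s z≤n) a<E) (m≤m+n E (3 * E)))
    -- `y` is the largest number with y^(4E) ≤ n, so `x ≤ y` for every admissible `x`, and fewer
    -- than `2 ^ x` gates are at most `2 ^ y`.
    ... | y , y≤ , n< = absurd (hyp (y ^ (2 * E)) (≤-trans (≤-trans (m≤m+n N₀ (c₁ + c₂)) Y≤y) (y≤n₀ n y c₁≤y c₂≤y y≤ n<)))
      where
      Y≤y : Y ≤ y
      Y≤y = root-mono (4 * E) N≤n n<
      c₁≤y : c₁ ≤ y
      c₁≤y = ≤-trans (≤-trans (m≤m+n c₁ c₂) (m≤n+m (c₁ + c₂) N₀)) Y≤y
      c₂≤y : c₂ ≤ y
      c₂≤y = ≤-trans (≤-trans (m≤n+m c₂ c₁) (m≤n+m (c₁ + c₂) N₀)) Y≤y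
      absurd : _ → ⊥
      absurd (f , (T , depT , _ , fanT) , noSymAnd) =
        noSymAnd (K n y c₁≤y c₂≤y y≤ n<) (K^k≤n₀ n y c₁≤y c₂≤y y≤ n<)
          (small-symAnd n y c₁≤y c₂≤y y≤ n< T depT fanT D dep (≤-trans (<⇒≤ size<) (^-monoʳ-≤ 2 (root-mono (4 * E) x≤ n<))))
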